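{- There is a computable function $f$ and an algorithm that, given an instance $$\mathcal B=(U,\mathcal F,d,m,(B_1,\dots,B_m),(k_1,\dots,k_m),(\mathcal V_1,\dots,\mathcal V_m),s,F)$$ of Heterogeneous Multidimensional Fingerprint Bin Packing, computes a feasible partition or concludes that there is none in $$f\bigl(|\mathcal F|+d+m+\lVert B_1\rVert_1\bigr)\cdot\bigl(T(|U|)+|\mathcal B|^{O(1)}\bigr)$$ steps, where $T\colon\mathbb N\to\mathbb N$ is an upper bound on the time complexity of the predicates $\mathcal V_1,\dots,\mathcal V_m$.
   Context: $\mathbb N=\{0,1,2,\dots\}$, $\mathbb N^+=\{1,2,\dots\}$, $[n]=\{1,\dots,n\}$. A multiset over $\mathcal F$ is a function $\mathcal F\to\mathbb N$ giving multiplicities. $|\mathcal B|$ denotes the size of the instance. An instance of Heterogeneous Multidimensional Fingerprint Bin Packing consists of: a finite set $U$ of items; a finite set $\mathcal F$ of fingerprints; a dimension $d\in\mathbb N^+$; a number of bin kinds $m\in\mathbb N^+$; bin capacities $B_1,\dots,B_m\in\mathbb N^d$ with $\lVert B_1\rVert_1\ge\lVert B_2\rVert_1\ge\dots\ge\lVert B_m\rVert_1$; available bin counts $k_1,\dots,k_m$; predicates $\mathcal V_1,\dots,\mathcal V_m\colon\mathbb N^{\mathcal F}\to\{0,1\}$ deciding the validity of a multiset of fingerprints; item sizes $s\colon U\to\mathbb N^d\setminus\{0\}$ with $\lVert s(u)\rVert_1\le\lVert B_1\rVert_1$ for all $u\in U$; and item fingerprints $F\colon U\to\mathcal F$. A feasible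 partition is a partition $\{U_{i,j}\}_{i\in[m],\,j\in[k_i]}$ of $U$ such that for all $i,j$: $\sum_{u\in U_{i,j}}s(u)\le B_i$ (componentwise), and $\mathcal V_i$ evaluates to $1$ on the multiset of the fingerprints $F(u)$, $u\in U_{i,j}$ (counted with multiplicity). -}

module Defs where

open import Data.Bool.Base using (Bool; true; false)
open import Data.Fin.Base using (Fin; toℕ; fromℕ<)
import Data.Fin.Base as Fin
open import Data.Fin.Subset using (Subset; inside; outside; _∈_)
open import Data.Nat.Base using (ℕ; _+_; _≤_; _<_)
open import Data.Nat.Binary.Base using (ℕᵇ; 2[1+_]; 1+[2_]; fromℕ)
import Data.Nat.Binary.Base as ℕᵇ
open import Data.Product.Base using (Σ; ∃-syntax; _×_; _,_)
open import Data.Vec.Base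
  using (Vec; []; _∷_; lookup; replicate; zipWith; map; sum; allFin; _[_]≔_)
open import Data.Vec.Relation.Binary.Pointwise.Inductive using (Pointwise)
open import Relation.Binary.PropositionalEquality.Core using (_≡_; _≢_)
open import Relation.Nullary.Negation.Core using (¬_)

------------------------------------------------------------------------
-- Model of computation
--
-- Algorithms are terms of an untyped call-by-value functional language
-- over binary trees, with a big-step environment semantics that counts
-- evaluation steps.  Every rule is a constant number of pointer
-- operations for a fixed program (trees and environments are shared,
-- never copied, and there is no primitive arithmetic or equality test),
-- so the step count agrees with RAM or Turing machine time up to a
-- polynomial.

-- Well-scoped terms with n free de Bruijn variables.
data Term (n : ℕ) : Set where
  var   : Fin n → Term n
  nil   : Term n
  cons  : Term n → Term n → Term n
  -- case e a b: a if e is nil; b if e is a cons, where variable 0 is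
  -- its left and variable 1 its right component.
  case  : Term n → Term n → Term (2 + n) → Term n
  let′  : Term n → Term (1 + n) → Term n
  -- Recursive function: variable 0 is the argument, variable 1 the
  -- function itself.
  fun   : Term (2 + n) → Term n
  app   : Term n → Term n → Term n

data Val : Set where
  nil  : Val
  cons : Val → Val → Val
  clos : ∀ {n} → Term (2 + n) → Vec Val n → Val

infix 4 _⊢_⇓_[_] _·_⇓_[_]

mutual

  -- In environment ρ, e evaluates to v in exactly t steps.
  data _⊢_⇓_[_] {n : ℕ} (ρ : Vec Val n) : Term n → Val → ℕ → Set where

    var      : ∀ x → ρ ⊢ var x ⇓ lookup ρ x [ 1 ]

    nil      : ρ ⊢ nil ⇓ nil [ 1 ]

    cons     : ∀ {e₁ e₂ v₁ v₂ t₁ t₂} →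
               ρ ⊢ e₁ ⇓ v₁ [ t₁ ] → ρ ⊢ e₂ ⇓ v₂ [ t₂ ] →
               ρ ⊢ cons e₁ e₂ ⇓ cons v₁ v₂ [ 1 + t₁ + t₂ ]

    caseNil  : ∀ {e a b v t₁ t₂} →
               ρ ⊢ e ⇓ nil [ t₁ ] → ρ ⊢ a ⇓ v [ t₂ ] →
               ρ ⊢ case e a b ⇓ v [ 1 + t₁ + t₂ ]

    caseCons : ∀ {e a b l r v t₁ t₂} →
               ρ ⊢ e ⇓ cons l r [ t₁ ] → (l ∷ r ∷ ρ) ⊢ b ⇓ v [ t₂ ] →
               ρ ⊢ case e a b ⇓ v [ 1 + t₁ + t₂ ]

    let′     : ∀ {e b w v t₁ t₂} →
               ρ ⊢ e ⇓ w [ t₁ ] → (w ∷ ρ) ⊢ b ⇓ v [ t₂ ] →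
               ρ ⊢ let′ e b ⇓ v [ 1 + t₁ + t₂ ]

    fun      : ∀ {e} → ρ ⊢ fun e ⇓ clos e ρ [ 1 ]

    app      : ∀ {e₁ e₂ v w r t₁ t₂ t₃} →
               ρ ⊢ e₁ ⇓ v [ t₁ ] → ρ ⊢ e₂ ⇓ w [ t₂ ] → v · w ⇓ r [ t₃ ] →
               ρ ⊢ app e₁ e₂ ⇓ r [ 1 + t₁ + t₂ + t₃ ]

  -- The function value v applied to w returns r in exactly t steps.
  data _·_⇓_[_] : Val → Val → Val → ℕ → Set where

    beta : ∀ {n} {e : Term (2 + n)} {ρ : Vec Val n} {w r t} →
           (w ∷ clos e ρ ∷ ρ) ⊢ e ⇓ r [ t ] → clos e ρ · w ⇓ r [ t ]

-- Number of nodes.  A function value is opaque and counts as one node.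
size : Val → ℕ
size nil        = 1
size (cons v w) = 1 + size v + size w
size (clos _ _) = 1

------------------------------------------------------------------------
-- Encoding of data

encBool : Bool → Val
encBool false = nil
encBool true  = cons nil nil

-- Numbers are written in (bijective) binary, least significant digit
-- first, so their encoding has logarithmic size.
encℕᵇ : ℕᵇ → Val
encℕᵇ ℕᵇ.zero  = nil
encℕᵇ 2[1+ x ] = cons (encBool false) (encℕᵇ x)
encℕᵇ 1+[2 x ] = cons (encBool true) (encℕᵇ x)

encℕ : ℕ → Val
encℕ n = encℕᵇ (fromℕ n)

encFin : ∀ {n} → Fin n → Val
encFin i = encℕ (toℕ i)

encVec : ∀ {a} {A : Set a} → (A → Val) → ∀ {n} → Vec A n → Val
encVec enc []       = nil
encVec enc (x ∷ xs) = cons (enc x) (encVec enc xs)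

Computable : (ℕ → ℕ) → Set
Computable f =
  Σ (Term 1) λ p → ∀ n → ∃[ t ] (encℕ n ∷ []) ⊢ p ⇓ encℕ (f n) [ t ]

------------------------------------------------------------------------
-- Heterogeneous Multidimensional Fingerprint Bin Packing

-- The 1-norm on ℕᵈ; on multisets it is the cardinality.
‖_‖₁ : ∀ {d} → Vec ℕ d → ℕ
‖ v ‖₁ = sum v

-- A multiset over Fin q, given by its multiplicities.
Multiset : ℕ → Set
Multiset q = Vec ℕ q

-- The item set is U = Fin n and the fingerprint set is Fin q.
record Instance : Set where
  field
    n q d m     : ℕ
    d>0         : 0 < d
    m>0         : 0 < m
    capacity    : Vec (Vec ℕ d) m
    available   : Vec ℕ m
    valid       : Fin m → Multiset q → Bool
    itemSize    : Vec (Vec ℕ d) n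
    fingerprint : Vec (Fin q) n

  B₁ : Vec ℕ d
  B₁ = lookup capacity (fromℕ< m>0)

  field
    capacity-decreasing : ∀ i j → i Fin.≤ j →
                          ‖ lookup capacity j ‖₁ ≤ ‖ lookup capacity i ‖₁
    itemSize≢0          : ∀ u → lookup itemSize u ≢ replicate d 0
    itemSize≤B₁         : ∀ u → ‖ lookup itemSize u ‖₁ ≤ ‖ B₁ ‖₁

-- Σ_{u ∈ S} x_u
sumOver : ∀ {n d} → Subset n → Vec (Vec ℕ d) n → Vec ℕ d
sumOver         []            []       = replicate _ 0
sumOver         (inside  ∷ S) (x ∷ xs) = zipWith _+_ x (sumOver S xs)
sumOver         (outside ∷ S) (x ∷ xs) = sumOver S xs

singleton : ∀ {q} → Fin q → Multiset q
singleton φ = replicate _ 0 [ φ ]≔ 1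

fingerprintsOf : ∀ {n q} → Vec (Fin q) n → Subset n → Multiset q
fingerprintsOf F S = sumOver S (map singleton F)

module _ (𝓑 : Instance) where
  open Instance 𝓑

  -- Parts may be empty, but empty parts are subject to the validity
  -- condition as well.
  record FeasiblePartition : Set where
    field
      part     : (i : Fin m) → Fin (lookup available i) → Subset n
      covering : ∀ u → Σ (Fin m) λ i →
                       Σ (Fin (lookup available i)) λ j → u ∈ part i j
      disjoint : ∀ {u i j i′ j′} → u ∈ part i j → u ∈ part i′ j′ →
                 _≡_ {A = Σ (Fin m) λ i → Fin (lookup available i)}
                     (i , j) (i′ , j′)
      fits     : ∀ i j →
                 Pointwise _≤_ (sumOver (part i j) itemSize) (lookup capacity i)
      isValid  : ∀ i j → valid i (fingerprintsOf fingerprint (part i j)) ≡ true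

  -- A partition is output as the list, over all items u, of the index
  -- pair (i , j) of the part containing u.  (Listing all parts would take
  -- space exponential in the binary encoding of the numbers kᵢ.)
  encPartition : FeasiblePartition → Val
  encPartition P = encVec encIndex (allFin n)
    where
    open FeasiblePartition P
    encIndex : Fin n → Val
    encIndex u = let (i , j , _) = covering u in cons (encFin i) (encFin j)

  data CorrectAnswer : Val → Set where
    found : (P : FeasiblePartition) → CorrectAnswer (cons (encPartition P) nil)
    none  : ¬ FeasiblePartition → CorrectAnswer nil

  -- Programs for the predicates, with time complexity bounded by T: on
  -- every multiset of at most s elements they take at most T s steps.
  record Evaluators (T : ℕ → ℕ) : Set where
    field
      program : Vec Val m
      correct : ∀ i (M : Multiset q) s → ‖ M ‖₁ ≤ s →
                ∃[ t ] (lookup program i · encVec encℕ M ⇓ encBool (valid i M) [ t ])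
                       × t ≤ T s

  -- The predicates are passed to an algorithm as function values; n, d
  -- and m are the lengths of the respective lists.
  encInstance : Vec Val m → Val
  encInstance program =
    cons (encℕ q)
    (cons (encVec (encVec encℕ) capacity)
    (cons (encVec encℕ available)
    (cons (encVec (λ v → v) program)
    (cons (encVec (encVec encℕ) itemSize)
          (encVec encFin fingerprint)))))

  parameter : ℕ
  parameter = q + d + m + ‖ B₁ ‖₁

{-# OPTIONS --safe #-}
module Submission where

-- Bins hold at most ‖ B₁ ‖₁ items, so it suffices to keep ‖ B₁ ‖₁ items of
-- each type (size and fingerprint): their sublists C that fit kind k and
-- are valid for it give the columns (k , C), whose number depends on the
-- parameter only, and a feasible partition is a multiset of columns with
-- prescribed numbers of items of each type and of bins of each kind.  Of
-- the k_i bins of a kind at most n are nonempty, hence k_i can be replaced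
-- by min (n + 1) k_i.
--
-- Such a multiset is found from the binary digits of the multiplicities,
-- least significant first: if b is the residual demand, choose the set ε
-- of columns with an odd multiplicity and continue with (b - Σ ε) / 2.
-- After k steps the residual differs from b / 2 ^ k by at most the sum W
-- of all columns, so after removing duplicates only (W + 1) ^ #tokens
-- states remain, and there are O(log n) steps.

open import Defs
open import Data.Bool.Base using (Bool; true; false; if_then_else_; not)
open import Data.Empty using (⊥; ⊥-elim)
open import Data.Fin.Base using (Fin; zero; suc; toℕ; fromℕ<)
open import Data.Fin.Patterns
open import Data.Fin.Properties using (toℕ-injective; toℕ<n; toℕ-fromℕ<)
import Data.Fin.Properties as Fin
import Data.Fin.Subset as Subset
open import Data.Fin.Subset using (Subset)
open import Data.List.Base using (List; []; _∷_; length; _++_; replicate; upTo; applyUpTo; map; concat; drop; zip; foldr)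
import Data.List.Base as List
open import Data.List.Membership.Propositional using (_∈_)
open import Data.List.Membership.Propositional.Properties using (∈-∃++; ∈-++⁺ˡ; ∈-++⁺ʳ; ∈-++⁻; ∈-map⁺; ∈-map⁻; ∈-upTo⁺; ∈-concat⁺′; ∈-concat⁻′; ∈-tabulate⁺; ∈-tabulate⁻)
open import Data.List.Properties using (length-++; length-map; length-replicate; length-upTo; length-tabulate; map-cong; map-∘; map-applyUpTo; applyUpTo-∷ʳ)
open import Data.List.Relation.Binary.Permutation.Propositional using (_↭_; prep; swap; ↭-sym; ↭-refl; ↭-reflexive; ↭-trans)
import Data.List.Relation.Binary.Permutation.Propositional as Perm
import Data.List.Relation.Binary.Permutation.Propositional.Properties as Perm
open import Data.List.Relation.Unary.All as All using (All; []; _∷_)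
import Data.List.Relation.Unary.All.Properties as All
open import Data.List.Relation.Unary.Any as Any using (Any; here; there)
import Data.List.Relation.Unary.Any.Properties as Any
open import Data.Nat.Base hiding (_/_)
open import Data.Nat.Binary.Base using (ℕᵇ; 2[1+_]; 1+[2_]; fromℕ; fromℕ')
import Data.Nat.Binary.Base as ℕᵇ
open import Data.Nat.Binary.Properties using (toℕ-fromℕ; fromℕ-toℕ; fromℕ≡fromℕ')
open import Data.Nat.DivMod using (_/_; /-monoˡ-≤; m*n/n≡m)
open import Data.Nat.ListAction using (sum)
open import Data.Nat.ListAction.Properties using (sum-↭)
open import Data.Nat.Properties
open import Data.Nat.Tactic.RingSolver using (solve-∀)
open import Data.Product.Base using (Σ; ∃-syntax; _×_; _,_; proj₁; proj₂)
open import Data.Sum.Base using (_⊎_; inj₁; inj₂)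
open import Data.Unit.Base using (⊤; tt)
open import Data.Vec.Base as Vec using (Vec; []; _∷_; lookup; toList)
import Data.Vec.Properties as Vec
open import Data.Vec.Properties using (tabulate∘lookup; tabulate-cong; lookup-zipWith; lookup-map; lookup⇒[]=; []=⇒lookup; length-toList; lookup-replicate)
open import Data.Vec.Relation.Binary.Pointwise.Inductive using (Pointwise; []; _∷_)
open import Function.Base using (_∘_; id)
open import Relation.Binary.PropositionalEquality using (_≡_; _≢_; refl; sym; trans; cong; cong₂; subst; module ≡-Reasoning)
open import Relation.Nullary using (yes; no)

-- Growth functions and classes of time bounds

-- Dynamic programming over the residual demand itself would meet about n to the power of the number
-- of tokens many vectors, with n the number of items, which is not fixed-parameter tractable; this
-- is the obstacle that the search by digits avoids. The cap is n + 1 and not n because validity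
-- also concerns empty parts. If more than n bins of a kind are available, every feasible partition
-- leaves one of them empty. With n + 1 bins to be used, the search must take the empty column of
-- that kind, which exists only if the empty multiset is valid for it. The predicates are function
-- values of unknown cost T, and the bound allows a factor depending on the parameter in front of T
-- but no power of the input size. Hence they are called only while the columns are built, once for
-- each kind and fitting sublist. The function f is an iterated exponential whose height is fixed by
-- the program: such bounds are closed under sums, products and powers, so time bounds compose along
-- the syntax without ever being computed.

ones : ℕ → ℕ
ones zero    = 0
ones (suc k) = suc (2 * ones k)

-- 2 ^ (3 + x) ∸ 1; the summand 3 makes it dominate 2 * x, x * x and 2 ^ x.
E : ℕ → ℕ
E x = ones (3 + x)

tow : ℕ → ℕ → ℕ
tow zero    k = k
tow (suc h) k = E (tow h k)

E-suc : ∀ x → E (suc x) ≡ suc (E x + E x)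
E-suc x = cong suc (cong (E x +_) (+-identityʳ (E x)))

E>0 : ∀ x → 1 ≤ E x
E>0 x = s≤s z≤n

2x<E : ∀ x → suc (2 * x) ≤ E x
2x<E zero    = s≤s z≤n
2x<E (suc x) = subst (suc (2 * suc x) ≤_) (sym (E-suc x)) (begin
  suc (2 * suc x)            ≡⟨ lem x ⟩
  suc (2 + 2 * x)            ≤⟨ s≤s (+-mono-≤ {2} {E x} (s≤s (s≤s z≤n)) (≤-trans (n≤1+n _) (2x<E x))) ⟩
  suc (E x + E x)            ∎)
  where
  open ≤-Reasoning
  lem : ∀ x → 1 + 2 * (1 + x) ≡ 3 + 2 * x
  lem = solve-∀

x*x≤E : ∀ x → x * x ≤ E x
x*x≤E zero    = z≤n
x*x≤E (suc x) = subst (suc x * suc x ≤_) (sym (E-suc x)) (begin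
  suc x * suc x               ≡⟨ lem x ⟩
  x * x + suc (2 * x)         ≤⟨ +-mono-≤ (x*x≤E x) (2x<E x) ⟩
  E x + E x                   ≤⟨ n≤1+n _ ⟩
  suc (E x + E x)             ∎)
  where
  open ≤-Reasoning
  lem : ∀ x → (1 + x) * (1 + x) ≡ x * x + (1 + 2 * x)
  lem = solve-∀

2^x≤E : ∀ x → 2 ^ x ≤ E x
2^x≤E zero    = s≤s z≤n
2^x≤E (suc x) = subst (2 ^ suc x ≤_) (sym (E-suc x))
  (≤-trans (≤-reflexive (cong (2 ^ x +_) (+-identityʳ (2 ^ x))))
           (≤-trans (+-mono-≤ (2^x≤E x) (2^x≤E x)) (n≤1+n _)))

x≤E : ∀ x → x ≤ E x
x≤E x = ≤-trans (m≤m+n x (x + 0)) (≤-trans (n≤1+n _) (2x<E x))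

tow-≤ : ∀ {h h′} k → h ≤′ h′ → tow h k ≤ tow h′ k
tow-≤ k (≤′-reflexive refl) = ≤-refl
tow-≤ {h} {suc h′} k (≤′-step p) = ≤-trans (tow-≤ k p) (x≤E _)

tow-≤₁ : ∀ h h′ k → tow h k ≤ tow (h + h′) k
tow-≤₁ h h′ k = tow-≤ {h} k (≤⇒≤′ (m≤m+n h h′))

tow-≤₂ : ∀ h h′ k → tow h′ k ≤ tow (h + h′) k
tow-≤₂ h h′ k = tow-≤ {h′} k (≤⇒≤′ (m≤n+m h′ h))

-- Each application of `E` adds at least one, so the height alone dominates a constant; `par-const`
-- absorbs constants in this way.
h≤tow : ∀ h k → h ≤ tow h k
h≤tow zero    k = z≤n
h≤tow (suc h) k =
  ≤-trans (s≤s (≤-trans (h≤tow h k) (m≤m+n (tow h k) _))) (2x<E (tow h k))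

-- Both summands are below the tower of height h + h′, and one more level covers the doubling; for
-- products it covers the squaring.
tow-+ : ∀ h h′ k → tow h k + tow h′ k ≤ tow (suc (h + h′)) k
tow-+ h h′ k = ≤-trans (+-mono-≤ (tow-≤₁ h h′ k) (tow-≤₂ h h′ k))
  (≤-trans (≤-reflexive (cong (tow (h + h′) k +_) (sym (+-identityʳ _))))
           (≤-trans (n≤1+n _) (2x<E (tow (h + h′) k))))

tow-* : ∀ h h′ k → tow h k * tow h′ k ≤ tow (suc (h + h′)) k
tow-* h h′ k = ≤-trans (*-mono-≤ (tow-≤₁ h h′ k) (tow-≤₂ h h′ k)) (x*x≤E (tow (h + h′) k))

-- The parameter and (one less than) the size of an input.
record Scale : Set where
  constructor scale
  field par sz : ℕ
open Scale public

bound : ℕ → ℕ → Scale → ℕ → ℕ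
bound h c s τ = tow h (par s) * (τ + suc (sz s) ^ c)

-- τ is the cost of a predicate call, which may enter linearly only.
record Lin {I : Set} (σ : I → Scale) (τ X : I → ℕ) : Set where
  constructor lin
  field
    h c : ℕ
    ≤bound : ∀ ι → X ι ≤ bound h c (σ ι) (τ ι)

FPT : {I : Set} → (I → Scale) → (I → ℕ) → Set
FPT σ = Lin σ (λ _ → 0)

record Par {I : Set} (σ : I → Scale) (X : I → ℕ) : Set where
  constructor para
  field
    h : ℕ
    ≤tow : ∀ ι → X ι ≤ tow h (par (σ ι))

s^c≤₁ : ∀ s c c′ → suc s ^ c ≤ suc s ^ (c + c′)
s^c≤₁ s c c′ = ^-monoʳ-≤ (suc s) (m≤m+n c c′)

s^c≤₂ : ∀ s c c′ → suc s ^ c′ ≤ suc s ^ (c + c′)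
s^c≤₂ s c c′ = ^-monoʳ-≤ (suc s) (m≤n+m c′ c)

module _ {I : Set} {σ : I → Scale} where

  par-≤ : ∀ {X Y} → (∀ ι → X ι ≤ Y ι) → Par σ Y → Par σ X
  par-≤ p (para h q) = para h λ ι → ≤-trans (p ι) (q ι)

  par-const : ∀ k → Par σ (λ _ → k)
  par-const k = para k λ ι → h≤tow k _

  par-par : Par σ (par ∘ σ)
  par-par = para 0 λ ι → ≤-refl

  par-+ : ∀ {X Y} → Par σ X → Par σ Y → Par σ (λ ι → X ι + Y ι)
  par-+ (para h p) (para h′ q) =
    para (suc (h + h′)) λ ι → ≤-trans (+-mono-≤ (p ι) (q ι)) (tow-+ h h′ _)

  par-* : ∀ {X Y} → Par σ X → Par σ Y → Par σ (λ ι → X ι * Y ι)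
  par-* (para h p) (para h′ q) =
    para (suc (h + h′)) λ ι → ≤-trans (*-mono-≤ (p ι) (q ι)) (tow-* h h′ _)

  par-suc : ∀ {X} → Par σ X → Par σ (λ ι → suc (X ι))
  par-suc = par-+ (par-const 1)

  par-2^ : ∀ {X} → Par σ X → Par σ (λ ι → 2 ^ X ι)
  par-2^ (para h p) = para (suc h) λ ι → ≤-trans (^-monoʳ-≤ 2 (p ι)) (2^x≤E (tow h (par (σ ι))))

  par-^ : ∀ {X Y} → Par σ X → Par σ Y → Par σ (λ ι → X ι ^ Y ι)
  par-^ {X} {Y} p q = par-≤ (λ ι → begin
    X ι ^ Y ι         ≤⟨ ^-monoˡ-≤ (Y ι) (x≤2^x (X ι)) ⟩
    (2 ^ X ι) ^ Y ι   ≡⟨ ^-*-assoc 2 (X ι) (Y ι) ⟩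
    2 ^ (X ι * Y ι)   ∎) (par-2^ (par-* p q))
    where
    open ≤-Reasoning
    x≤2^x : ∀ x → x ≤ 2 ^ x
    x≤2^x zero    = z≤n
    x≤2^x (suc x) = +-mono-≤ (m^n>0 2 x) (≤-trans (x≤2^x x) (m≤m+n _ 0))

  module _ {τ : I → ℕ} where

    lin-≤ : ∀ {X Y} → (∀ ι → X ι ≤ Y ι) → Lin σ τ Y → Lin σ τ X
    lin-≤ p (lin h c q) = lin h c λ ι → ≤-trans (p ι) (q ι)

    par→lin : ∀ {X} → Par σ X → Lin σ τ X
    par→lin (para h p) = lin h 0 λ ι → ≤-trans (p ι)
      (≤-trans (≤-reflexive (sym (*-identityʳ _))) (*-monoʳ-≤ (tow h _) (m≤n+m 1 (τ ι))))

    lin-const : ∀ k → Lin σ τ (λ _ → k)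
    lin-const k = par→lin (par-const k)

    lin-+ : ∀ {X Y} → Lin σ τ X → Lin σ τ Y → Lin σ τ (λ ι → X ι + Y ι)
    lin-+ {X} {Y} (lin h c p) (lin h′ c′ q) = lin (suc (h + h′)) (c + c′) λ ι →
      let k = par (σ ι); s = sz (σ ι) in begin
      X ι + Y ι
        ≤⟨ +-mono-≤ (p ι) (q ι) ⟩
      tow h k * (τ ι + suc s ^ c) + tow h′ k * (τ ι + suc s ^ c′)
        ≤⟨ +-mono-≤ (*-monoʳ-≤ (tow h k) (+-monoʳ-≤ (τ ι) (s^c≤₁ s c c′)))
                    (*-monoʳ-≤ (tow h′ k) (+-monoʳ-≤ (τ ι) (s^c≤₂ s c c′))) ⟩
      tow h k * (τ ι + suc s ^ (c + c′)) + tow h′ k * (τ ι + suc s ^ (c + c′))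
        ≡⟨ *-distribʳ-+ (τ ι + suc s ^ (c + c′)) (tow h k) (tow h′ k) ⟨
      (tow h k + tow h′ k) * (τ ι + suc s ^ (c + c′))
        ≤⟨ *-monoˡ-≤ (τ ι + suc s ^ (c + c′)) (tow-+ h h′ k) ⟩
      bound (suc (h + h′)) (c + c′) (σ ι) (τ ι) ∎
      where open ≤-Reasoning

    lin-suc : ∀ {X} → Lin σ τ X → Lin σ τ (λ ι → suc (X ι))
    lin-suc = lin-+ (lin-const 1)

    -- A factor depending on the parameter only keeps τ linear. A factor that grows with the input
    -- size would not, which is why `fpt-*` is restricted to τ = 0.
    par-*-lin : ∀ {X Y} → Par σ X → Lin σ τ Y → Lin σ τ (λ ι → X ι * Y ι)
    par-*-lin {X} {Y} (para h p) (lin h′ c q) = lin (suc (h + h′)) c λ ι → begin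
      X ι * Y ι
        ≤⟨ *-mono-≤ (p ι) (q ι) ⟩
      tow h (par (σ ι)) * bound h′ c (σ ι) (τ ι)
        ≡⟨ *-assoc (tow h (par (σ ι))) (tow h′ (par (σ ι))) _ ⟨
      tow h (par (σ ι)) * tow h′ (par (σ ι)) * (τ ι + suc (sz (σ ι)) ^ c)
        ≤⟨ *-monoˡ-≤ _ (tow-* h h′ _) ⟩
      bound (suc (h + h′)) c (σ ι) (τ ι) ∎
      where open ≤-Reasoning

    fpt→lin : ∀ {X} → FPT σ X → Lin σ τ X
    fpt→lin (lin h c p) = lin h c λ ι →
      ≤-trans (p ι) (*-monoʳ-≤ (tow h (par (σ ι))) (m≤n+m _ (τ ι)))

    lin-τ : Lin σ τ τ
    lin-τ = lin 1 0 λ ι → ≤-trans (m≤m+n (τ ι) 1)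
      (≤-trans (≤-reflexive (sym (*-identityˡ _))) (*-monoˡ-≤ (τ ι + 1) (E>0 (par (σ ι)))))

  fpt-* : ∀ {X Y} → FPT σ X → FPT σ Y → FPT σ (λ ι → X ι * Y ι)
  fpt-* {X} {Y} (lin h c p) (lin h′ c′ q) = lin (suc (h + h′)) (c + c′) λ ι →
    let k = par (σ ι); s = suc (sz (σ ι)) in begin
    X ι * Y ι
      ≤⟨ *-mono-≤ (p ι) (q ι) ⟩
    (tow h k * s ^ c) * (tow h′ k * s ^ c′)
      ≡⟨ [m*n]*[o*p]≡[m*o]*[n*p] (tow h k) (s ^ c) (tow h′ k) (s ^ c′) ⟩
    (tow h k * tow h′ k) * (s ^ c * s ^ c′)
      ≡⟨ cong (tow h k * tow h′ k *_) (^-distribˡ-+-* s c c′) ⟨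
    (tow h k * tow h′ k) * s ^ (c + c′)
      ≤⟨ *-monoˡ-≤ _ (tow-* h h′ k) ⟩
    bound (suc (h + h′)) (c + c′) (σ ι) 0 ∎
    where open ≤-Reasoning

  fpt-sz : FPT σ (λ ι → suc (sz (σ ι)))
  fpt-sz = lin 1 1 λ ι → ≤-trans
    (≤-trans (≤-reflexive (sym (trans (*-identityˡ _) (*-identityʳ _)))) (*-monoˡ-≤ (suc (sz (σ ι)) ^ 1) (E>0 (par (σ ι))))) ≤-refl

-- A uniform bound survives every reindexing. Loop bodies are run over inputs paired with a position
-- in the loop, and π forgets the position.
re-lin : ∀ {I J : Set} {σ : I → Scale} {τ X} (π : J → I) →
         Lin σ τ X → Lin (σ ∘ π) (τ ∘ π) (X ∘ π)
re-lin π (lin h c p) = lin h c (p ∘ π)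

re-par : ∀ {I J : Set} {σ : I → Scale} {X} (π : J → I) →
         Par σ X → Par (σ ∘ π) (X ∘ π)
re-par π (para h p) = para h (p ∘ π)

-- Evaluation of families of inputs

encL : {A : Set} → (A → Val) → List A → Val
encL enc []       = nil
encL enc (x ∷ xs) = cons (enc x) (encL enc xs)

v0 : ∀ {n} → Term (1 + n)
v0 = var 0F
v1 : ∀ {n} → Term (2 + n)
v1 = var 1F
v2 : ∀ {n} → Term (3 + n)
v2 = var 2F
v3 : ∀ {n} → Term (4 + n)
v3 = var 3F
v4 : ∀ {n} → Term (5 + n)
v4 = var 4F
v5 : ∀ {n} → Term (6 + n)
v5 = var 5F
v6 : ∀ {n} → Term (7 + n)
v6 = var 6F
v7 : ∀ {n} → Term (8 + n)
v7 = var 7F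
v8 : ∀ {n} → Term (9 + n)
v8 = var 8F
v9 : ∀ {n} → Term (10 + n)
v9 = var 9F
v10 : ∀ {n} → Term (11 + n)
v10 = var (suc 9F)
v11 : ∀ {n} → Term (12 + n)
v11 = var (suc (suc 9F))
v12 : ∀ {n} → Term (13 + n)
v12 = var (suc (suc (suc 9F)))
v13 : ∀ {n} → Term (14 + n)
v13 = var (suc (suc (suc (suc 9F))))
v16 : ∀ {n} → Term (17 + n)
v16 = var (suc (suc (suc (suc (suc (suc (suc 9F)))))))
v17 : ∀ {n} → Term (18 + n)
v17 = var (suc (suc (suc (suc (suc (suc (suc (suc 9F))))))))

-- Because h and c of Lin do not depend on ι, rules for Runs never mention
-- an explicit time bound; only the lengths of the lists that are recursed
-- over have to be bounded.
record Runs {I : Set} {n} (σ : I → Scale) (τ : I → ℕ)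
            (ρ : I → Vec Val n) (e : Term n) (v : I → Val) : Set where
  constructor runs
  field
    time : I → ℕ
    eval : ∀ ι → ρ ι ⊢ e ⇓ v ι [ time ι ]
    cost : Lin σ τ time

record Applies {I : Set} (σ : I → Scale) (τ : I → ℕ) (f w r : I → Val) : Set where
  constructor applies
  field
    time : I → ℕ
    eval : ∀ ι → f ι · w ι ⇓ r ι [ time ι ]
    cost : Lin σ τ time

module _ {I : Set} {n : ℕ} {σ : I → Scale} {τ : I → ℕ} {ρ : I → Vec Val n} where

  castR : ∀ {e v v′} → (∀ ι → v ι ≡ v′ ι) → Runs σ τ ρ e v → Runs σ τ ρ e v′
  castR {e} eq (runs t d c) = runs t (λ ι → subst (λ w → ρ ι ⊢ e ⇓ w [ t ι ]) (eq ι) (d ι)) c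

  varR : ∀ {x} → Runs σ τ ρ (var x) (λ ι → lookup (ρ ι) x)
  varR {x} = runs _ (λ ι → var x) (lin-const 1)

  nilR : Runs σ τ ρ nil (λ ι → nil)
  nilR = runs _ (λ ι → nil) (lin-const 1)

  consR : ∀ {e₁ e₂ v₁ v₂} → Runs σ τ ρ e₁ v₁ → Runs σ τ ρ e₂ v₂ →
          Runs σ τ ρ (cons e₁ e₂) (λ ι → cons (v₁ ι) (v₂ ι))
  consR (runs _ d₁ c₁) (runs _ d₂ c₂) =
    runs _ (λ ι → cons (d₁ ι) (d₂ ι)) (lin-suc (lin-+ c₁ c₂))

  letR : ∀ {e b w v} → Runs σ τ ρ e w → Runs σ τ (λ ι → w ι ∷ ρ ι) b v →
         Runs σ τ ρ (let′ e b) v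
  letR (runs _ d₁ c₁) (runs _ d₂ c₂) =
    runs _ (λ ι → let′ (d₁ ι) (d₂ ι)) (lin-suc (lin-+ c₁ c₂))

  unpairR : ∀ {e a b v} {w₁ w₂ : I → Val} → Runs σ τ ρ e (λ ι → cons (w₁ ι) (w₂ ι)) →
            Runs σ τ (λ ι → w₁ ι ∷ w₂ ι ∷ ρ ι) b v →
            Runs σ τ ρ (case e a b) v
  unpairR (runs _ d₁ c₁) (runs _ d₂ c₂) =
    runs _ (λ ι → caseCons (d₁ ι) (d₂ ι)) (lin-suc (lin-+ c₁ c₂))

  appR : ∀ {e₁ e₂ f w r} → Runs σ τ ρ e₁ f → Runs σ τ ρ e₂ w →
         Applies σ τ f w r → Runs σ τ ρ (app e₁ e₂) r
  appR (runs _ d₁ c₁) (runs _ d₂ c₂) (applies _ d₃ c₃) =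
    runs _ (λ ι → app (d₁ ι) (d₂ ι) (d₃ ι)) (lin-suc (lin-+ (lin-+ c₁ c₂) c₃))

  iteR : ∀ {A : Set} (enc : A → Val) {e a c} {b : I → Bool} {x y : I → A} →
         Runs σ τ ρ e (encBool ∘ b) →
         Runs σ τ (λ ι → nil ∷ nil ∷ ρ ι) c (enc ∘ x) →
         Runs σ τ ρ a (enc ∘ y) →
         Runs σ τ ρ (case e a c) (λ ι → enc (if b ι then x ι else y ι))
  iteR enc {e} {a} {c} {b} {x} {y} (runs t d k) (runs t₁ d₁ k₁) (runs t₂ d₂ k₂) =
    runs (λ ι → 1 + t ι + (if b ι then t₁ ι else t₂ ι))
         (λ ι → branch (b ι) (d ι) (d₁ ι) (d₂ ι))
         (lin-≤ (λ ι → +-monoʳ-≤ (1 + t ι) (choose (b ι)))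
                (lin-+ (lin-suc k) (lin-+ k₁ k₂)))
    where
    branch : ∀ {ρ : Vec Val n} {t u w} (b : Bool) {x y} → ρ ⊢ e ⇓ encBool b [ t ] →
             (nil ∷ nil ∷ ρ) ⊢ c ⇓ enc x [ u ] → ρ ⊢ a ⇓ enc y [ w ] →
             ρ ⊢ case e a c ⇓ enc (if b then x else y) [ 1 + t + (if b then u else w) ]
    branch true  d d₁ d₂ = caseCons d d₁
    branch false d d₁ d₂ = caseNil d d₂
    choose : ∀ (b : Bool) {u w} → (if b then u else w) ≤ u + w
    choose true  = m≤m+n _ _
    choose false = m≤n+m _ _

-- The index type of the branch for a nonempty list. The equation makes facts known about `xs`
-- available for head and tail there.
record ConsCase {I A : Set} (xs : I → List A) : Set where
  constructor conscase
  field
    ix : I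
    hd : A
    tl : List A
    eq : xs ix ≡ hd ∷ tl

caseListR : ∀ {I A : Set} {n} {σ : I → Scale} {τ} {ρ : I → Vec Val n} {enc : A → Val}
            {e a b} {xs : I → List A} (v : I → List A → Val) →
            Runs σ τ ρ e (encL enc ∘ xs) →
            Runs σ τ ρ a (λ ι → v ι []) →
            (let open ConsCase in
             Runs {ConsCase xs} (σ ∘ ix) (τ ∘ ix)
                  (λ j → enc (hd j) ∷ encL enc (tl j) ∷ ρ (ix j)) b
                  (λ j → v (ix j) (hd j ∷ tl j))) →
            Runs σ τ ρ (case e a b) (λ ι → v ι (xs ι))
caseListR {I} {A} {n} {σ} {τ} {ρ} {enc} {e} {a} {b} {xs} v
          (runs t d k) (runs t₁ d₁ k₁) (runs t₂ d₂ (lin h c q)) =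
  runs (λ ι → 1 + t ι + tm ι (xs ι) refl) (λ ι → go ι (xs ι) refl (d ι))
       -- The time `t₂` is defined only for inputs with a nonempty list; its uniform bound makes
       -- sense for every ι and takes its place.
       (lin-+ (lin-suc k) (lin-≤ (λ ι → le ι (xs ι) refl) (lin-+ k₁ (lin {τ = τ} {X = λ ι → bound h c (σ ι) (τ ι)} h c (λ ι → ≤-refl)))))
  where
  tm : ∀ ι ys → xs ι ≡ ys → ℕ
  tm ι []       eq = t₁ ι
  tm ι (y ∷ ys) eq = t₂ (conscase ι y ys eq)
  go : ∀ ι ys (eq : xs ι ≡ ys) → ρ ι ⊢ e ⇓ encL enc ys [ t ι ] →
       ρ ι ⊢ case e a b ⇓ v ι ys [ 1 + t ι + tm ι ys eq ]
  go ι []       eq d = caseNil d (d₁ ι)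
  go ι (y ∷ ys) eq d = caseCons d (d₂ (conscase ι y ys eq))
  le : ∀ ι ys eq → tm ι ys eq ≤ t₁ ι + bound h c (σ ι) (τ ι)
  le ι []       eq = m≤m+n _ _
  le ι (y ∷ ys) eq = ≤-trans (q _) (m≤n+m _ _)

-- The numbers of rounds by which a time bound may be multiplied: polynomial ones if τ = 0,
-- otherwise only those bounded by the parameter.
Iter : ∀ {I : Set} → (I → Scale) → (I → ℕ) → (I → ℕ) → Set
Iter σ τ X = ∀ {Y} → Lin σ τ Y → Lin σ τ (λ ι → X ι * Y ι)

-- Primitive recursion over a list with a parameter.  On x ∷ ys and p,
-- next sees x, ys, x ∷ ys and p as variables 0 to 3 and computes the
-- parameter of the recursive call; its result is variable 0 of step,
-- where the others are shifted by one.  The context of the fold starts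
-- at variable 4 in base, 6 in next and 7 in step.
foldBody : ∀ {n} → Term (4 + n) → Term (6 + n) → Term (7 + n) → Term (2 + n)
foldBody base next step =
  case v0 nil (case v0 base (let′ (app v5 (cons v1 next)) step))

foldT : ∀ {n} → Term n → Term n → Term (4 + n) → Term (6 + n) → Term (7 + n) → Term n
foldT l p base next step = app (fun (foldBody base next step)) (cons l p)

-- `FoldNil` and `FoldCons` pair an input with a position in its loop. The invariant is a component,
-- so the bounds that a loop body needs hold throughout its index type.
record FoldNil {I A P : Set} (Inv : I → List A → P → Set) : Set where
  constructor foldnil
  field
    ix  : I
    pm  : P
    inv : Inv ix [] pm

record FoldCons {I A P : Set} (Inv : I → List A → P → Set) : Set where
  constructor foldcons
  field
    ix  : I
    hd  : A
    tl  : List A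
    pm  : P
    inv : Inv ix (hd ∷ tl) pm

module _ {I A P : Set} {n : ℕ} {σ : I → Scale} {τ : I → ℕ} {ρ : I → Vec Val n}
         {enc : A → Val} {encP : P → Val} {l p : Term n}
         {base : Term (4 + n)} {next : Term (6 + n)} {step : Term (7 + n)}
         {xs : I → List A} {p₀ : I → P}
         (Inv : I → List A → P → Set)
         (upd : I → A → List A → P → P)
         (res : I → List A → P → Val) where

  private
    f : I → Val
    f ι = clos (foldBody base next step) (ρ ι)

    ρ-nil : FoldNil Inv → Vec Val (4 + n)
    ρ-nil j = nil ∷ encP pm ∷ cons nil (encP pm) ∷ f ix ∷ ρ ix
      where open FoldNil j

    ρ-next : FoldCons Inv → Vec Val (6 + n)
    ρ-next j = enc hd ∷ encL enc tl ∷ encL enc (hd ∷ tl) ∷ encP pm ∷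
               cons (encL enc (hd ∷ tl)) (encP pm) ∷ f ix ∷ ρ ix
      where open FoldCons j

    ρ-step : FoldCons Inv → Vec Val (7 + n)
    ρ-step j = res ix tl (upd ix hd tl pm) ∷ ρ-next j
      where open FoldCons j

  -- The bounds of the three bodies are uniform in the position, so one number covers every round
  -- and the total is that number times the number of rounds.
  foldR : Runs σ τ ρ l (encL enc ∘ xs) → Runs σ τ ρ p (encP ∘ p₀) →
          Iter σ τ (λ ι → suc (length (xs ι))) →
          (∀ ι → Inv ι (xs ι) (p₀ ι)) →
          (∀ ι x ys p → Inv ι (x ∷ ys) p → Inv ι ys (upd ι x ys p)) →
          (let open FoldNil in
           Runs (σ ∘ ix) (τ ∘ ix) ρ-nil base (λ j → res (ix j) [] (pm j))) →
          (let open FoldCons in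
           Runs (σ ∘ ix) (τ ∘ ix) ρ-next next
                (λ j → encP (upd (ix j) (hd j) (tl j) (pm j)))) →
          (let open FoldCons in
           Runs (σ ∘ ix) (τ ∘ ix) ρ-step step
                (λ j → res (ix j) (hd j ∷ tl j) (pm j))) →
          Runs σ τ ρ (foldT l p base next step) (λ ι → res ι (xs ι) (p₀ ι))
  foldR (runs tl dl kl) (runs tp dp kp) iter inv₀ inv₁
        (runs tb db (lin hb cb qb)) (runs tn dn (lin hn cn qn)) (runs ts ds (lin hs cs qs)) =
    runs (λ ι → 1 + 1 + (1 + tl ι + tp ι) + tm ι (xs ι) (p₀ ι) (inv₀ ι))
         (λ ι → app fun (cons (dl ι) (dp ι)) (go ι (xs ι) (p₀ ι) (inv₀ ι)))
         (lin-+ (lin-+ (lin-const 2) (lin-suc (lin-+ kl kp)))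
                (lin-≤ (λ ι → le ι (xs ι) (p₀ ι) (inv₀ ι)) (iter linB)))
    where
    tm : ∀ ι ys p → Inv ι ys p → ℕ
    tm ι []       p i = 1 + 1 + (1 + 1 + tb (foldnil ι p i))
    tm ι (x ∷ ys) p i =
      1 + 1 + (1 + 1 + (1 + (1 + 1 + (1 + 1 + tn (foldcons ι x ys p i))
                        + tm ι ys _ (inv₁ ι x ys p i)) + ts (foldcons ι x ys p i)))
    go : ∀ ι ys p i → f ι · cons (encL enc ys) (encP p) ⇓ res ι ys p [ tm ι ys p i ]
    go ι []       p i = beta (caseCons (var _) (caseNil (var _) (db (foldnil ι p i))))
    go ι (x ∷ ys) p i =
      beta (caseCons (var _) (caseCons (var _)
        (let′ (app (var _) (cons (var _) (dn _)) (go ι ys _ (inv₁ ι x ys p i))) (ds _))))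
    B : I → ℕ
    -- Nine evaluation steps per round are spent by `foldBody` itself.
    B ι = 9 + (bound hb cb (σ ι) (τ ι) + (bound hn cn (σ ι) (τ ι) + bound hs cs (σ ι) (τ ι)))
    refl-lin : ∀ h c → Lin σ τ (λ ι → bound h c (σ ι) (τ ι))
    refl-lin h c = lin h c λ ι → ≤-refl
    linB : Lin σ τ B
    linB = lin-+ (lin-const 9) (lin-+ (refl-lin hb cb) (lin-+ (refl-lin hn cn) (refl-lin hs cs)))
    le : ∀ ι ys p i → tm ι ys p i ≤ suc (length ys) * B ι
    le ι [] p i = begin
      4 + tb _              ≤⟨ +-monoʳ-≤ 4 (qb _) ⟩
      4 + bound hb cb (σ ι) (τ ι)   ≤⟨ +-mono-≤ {4} {9} (m≤m+n 4 5) (m≤m+n _ _) ⟩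
      B ι                   ≡⟨ +-identityʳ (B ι) ⟨
      B ι + 0               ∎
      where open ≤-Reasoning
    le ι (x ∷ ys) p i = begin
      4 + (1 + (2 + (2 + tn j) + r) + ts j)       ≡⟨ lem (tn j) r (ts j) ⟩
      9 + (0 + (tn j + ts j)) + r                 ≤⟨ +-mono-≤ (+-monoʳ-≤ 9 (+-mono-≤ {0} {bound hb cb (σ ι) (τ ι)} z≤n (+-mono-≤ (qn j) (qs j)))) (le ι ys _ _) ⟩
      B ι + suc (length ys) * B ι                 ∎
      where
      open ≤-Reasoning
      j = foldcons ι x ys p i
      r = tm ι ys _ (inv₁ ι x ys p i)
      lem : ∀ a r b → 4 + (1 + (2 + (2 + a) + r) + b) ≡ 9 + (0 + (a + b)) + r
      lem = solve-∀

FPT→Iter : ∀ {I : Set} {σ : I → Scale} {X} → FPT σ X → Iter σ (λ _ → 0) (λ ι → suc (X ι))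
FPT→Iter f = fpt-* (lin-suc f)

Par→Iter : ∀ {I : Set} {σ : I → Scale} {τ X} → Par σ X → Iter σ τ (λ ι → suc (X ι))
Par→Iter f = par-*-lin (par-suc f)

liftR : ∀ {I : Set} {n} {σ : I → Scale} {τ} {ρ : I → Vec Val n} {e v} →
        Runs σ (λ _ → 0) ρ e v → Runs σ τ ρ e v
liftR (runs t d k) = runs t d (fpt→lin k)

module _ {I J : Set} {n : ℕ} {σ : I → Scale} {τ : I → ℕ} {ρ : I → Vec Val n} where

  reR : ∀ {e v} (π : J → I) → Runs σ τ ρ e v → Runs (σ ∘ π) (τ ∘ π) (ρ ∘ π) e (v ∘ π)
  reR π (runs t d k) = runs (t ∘ π) (d ∘ π) (re-lin π k)

castEnv : ∀ {I : Set} {n} {σ : I → Scale} {τ : I → ℕ} {ρ ρ′ : I → Vec Val n} {e v} →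
          (∀ ι → ρ ι ≡ ρ′ ι) → Runs σ τ ρ e v → Runs σ τ ρ′ e v
castEnv {e = e} {v} eq (runs t d k) =
  runs t (λ ι → subst (λ r → r ⊢ e ⇓ v ι [ t ι ]) (eq ι) (d ι)) k

-- Unary numbers

tickV : Val
tickV = cons nil nil

tick : ∀ {n} → Term n
tick = cons nil nil

encU : ℕ → Val
encU zero    = nil
encU (suc k) = cons tickV (encU k)

tickR : ∀ {I : Set} {n} {σ : I → Scale} {τ} {ρ : I → Vec Val n} → Runs σ τ ρ tick (λ _ → tickV)
tickR = consR nilR nilR

foldrT : ∀ {n} → Term n → Term (4 + n) → Term (7 + n) → Term n
foldrT l base step = foldT l nil base nil step

module _ {I A : Set} {n : ℕ} {σ : I → Scale} {τ : I → ℕ} {ρ : I → Vec Val n}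
         {enc : A → Val} {l : Term n} {base : Term (4 + n)} {step : Term (7 + n)} {xs : I → List A}
         (Inv : I → List A → Set) (res : I → List A → Val) where

  private
    Inv′ : I → List A → ⊤ → Set
    Inv′ ι ys _ = Inv ι ys

    f : I → Val
    f ι = clos (foldBody base nil step) (ρ ι)

  foldrR : Runs σ τ ρ l (encL enc ∘ xs) →
           Iter σ τ (λ ι → suc (length (xs ι))) →
           (∀ ι → Inv ι (xs ι)) →
           (∀ ι x ys → Inv ι (x ∷ ys) → Inv ι ys) →
           Runs σ τ (λ ι → nil ∷ nil ∷ cons nil nil ∷ f ι ∷ ρ ι) base (λ ι → res ι []) →
           (let open FoldCons in
            Runs {FoldCons Inv′} (σ ∘ ix) (τ ∘ ix)
              (λ j → res (ix j) (tl j) ∷ enc (hd j) ∷ encL enc (tl j) ∷ encL enc (hd j ∷ tl j) ∷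
                     nil ∷ cons (encL enc (hd j ∷ tl j)) nil ∷ f (ix j) ∷ ρ (ix j))
              step (λ j → res (ix j) (hd j ∷ tl j))) →
           Runs σ τ ρ (foldrT l base step) (λ ι → res ι (xs ι))
  foldrR rl it i₀ i₁ rb rs =
    foldR {encP = λ _ → nil} {p₀ = λ _ → tt} Inv′ (λ _ _ _ _ → tt) (λ ι ys _ → res ι ys)
      rl nilR it i₀ (λ ι x ys _ → i₁ ι x ys) (reR FoldNil.ix rb) nilR rs

encU-replicate : ∀ k → encU k ≡ encL (λ _ → tickV) (replicate k tt)
encU-replicate zero    = refl
encU-replicate (suc k) = cong (cons tickV) (encU-replicate k)

encU-length : ∀ (ys : List ⊤) → encU (length ys) ≡ encL (λ _ → tickV) ys
encU-length []       = refl
encU-length (_ ∷ ys) = cong (cons tickV) (encU-length ys)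

record FoldSuc {I : Set} (Inv : I → ℕ → Set) : Set where
  constructor foldsuc
  field
    ix  : I
    num : ℕ
    inv : Inv ix (suc num)

module _ {I : Set} {n : ℕ} {σ : I → Scale} {ρ : I → Vec Val n}
         {l : Term n} {base : Term (4 + n)} {step : Term (7 + n)} {k : I → ℕ}
         (Inv : I → ℕ → Set) (res : I → ℕ → Val) where

  private
    f : I → Val
    f ι = clos (foldBody base nil step) (ρ ι)

  -- A unary number has the same code as a list of ticks, so `foldrR` applies; the casts translate
  -- between a list of units and its length.
  foldUR : Runs σ (λ _ → 0) ρ l (encU ∘ k) → FPT σ k →
           (∀ ι → Inv ι (k ι)) →
           (∀ ι m → Inv ι (suc m) → Inv ι m) →
           Runs σ (λ _ → 0) (λ ι → nil ∷ nil ∷ cons nil nil ∷ f ι ∷ ρ ι) base (λ ι → res ι 0) →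
           (let open FoldSuc in
            Runs {FoldSuc Inv} (σ ∘ ix) (λ _ → 0)
              (λ j → res (ix j) (num j) ∷ tickV ∷ encU (num j) ∷ encU (suc (num j)) ∷
                     nil ∷ cons (encU (suc (num j))) nil ∷ f (ix j) ∷ ρ (ix j))
              step (λ j → res (ix j) (suc (num j)))) →
           Runs σ (λ _ → 0) ρ (foldrT l base step) (λ ι → res ι (k ι))
  foldUR rl fk i₀ i₁ rb rs =
    castR (λ ι → cong (res ι) (length-replicate (k ι)))
      (foldrR {xs = λ ι → replicate (k ι) tt} (λ ι ys → Inv ι (length ys)) (λ ι ys → res ι (length ys))
        (castR (λ ι → encU-replicate (k ι)) rl)
        (FPT→Iter (lin-≤ (λ ι → ≤-reflexive (length-replicate (k ι))) fk))
        (λ ι → subst (Inv ι) (sym (length-replicate (k ι))) (i₀ ι))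
        (λ ι x ys → i₁ ι (length ys))
        rb
        (castEnv (λ j → cong (env j) (encU-length (FoldCons.tl j)))
          (reR (λ j → foldsuc (FoldCons.ix j) (length (FoldCons.tl j)) (FoldCons.inv j)) rs)))
    where
    env : FoldCons {P = ⊤} (λ ι ys _ → Inv ι (length ys)) → Val → Vec Val (7 + n)
    env j w = res ix (length tl) ∷ tickV ∷ w ∷ cons tickV w ∷ nil ∷ cons (cons tickV w) nil ∷ f ix ∷ ρ ix
      where open FoldCons j

-- Codes and their equality

-- Function values cannot be compared, so structural equality is reflexive only on values without
-- closures.
data Flat : Val → Set where
  nil  : Flat nil
  cons : ∀ {v w} → Flat v → Flat w → Flat (cons v w)

eqV : Val → Val → Bool
eqV nil        nil        = true
eqV (cons a b) (cons c d) = if eqV a c then eqV b d else false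
eqV _          _          = false

eqV-refl : ∀ {v} → Flat v → eqV v v ≡ true
eqV-refl nil        = refl
eqV-refl (cons p q) rewrite eqV-refl p = eqV-refl q

eqV-sound : ∀ v w → eqV v w ≡ true → v ≡ w
eqV-sound nil        nil        _ = refl
eqV-sound (cons a b) (cons c d) e with eqV a c in eq
... | true = cong₂ cons (eqV-sound a c eq) (eqV-sound b d e)

-- Equality is defined through the codes, so it is by definition what the program tests; `flat`
-- makes it reflexive and `inj` makes it sound.
record Code (A : Set) : Set where
  field
    enc  : A → Val
    flat : ∀ x → Flat (enc x)
    inj  : ∀ {x y} → enc x ≡ enc y → x ≡ y

  _==_ : A → A → Bool
  x == y = eqV (enc x) (enc y)

  ==-refl : ∀ x → (x == x) ≡ true
  ==-refl x = eqV-refl (flat x)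

  ==-sound : ∀ x y → (x == y) ≡ true → x ≡ y
  ==-sound x y e = inj (eqV-sound _ _ e)

  count : A → List A → ℕ
  count a []       = 0
  count a (x ∷ xs) = if a == x then suc (count a xs) else count a xs

eqBody : ∀ {n} → Term (2 + n)
eqBody = case v0 nil (case v0 (case v1 tick nil)
  (case v3 nil (case (app v7 (cons v2 v0)) nil (app v9 (cons v5 v3)))))

eqT : ∀ {n} → Term n → Term n → Term n
eqT a b = app (fun eqBody) (cons a b)

-- The two values are traversed in parallel, so the size of the first bounds the time whatever the
-- second is. The 30 is a generous cost per node.
eq-eval : ∀ {n} (ρ : Vec Val n) {v w} → Flat v → Flat w →
          ∃[ t ] (clos eqBody ρ · cons v w ⇓ encBool (eqV v w) [ t ]) × t ≤ 30 * size v
eq-eval ρ nil nil =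
  _ , beta (caseCons (var _) (caseNil (var _) (caseNil (var _) (cons nil nil)))) , m≤m+n _ 21
eq-eval ρ nil (cons p q) =
  _ , beta (caseCons (var _) (caseNil (var _) (caseCons (var _) nil))) , m≤m+n _ 23
eq-eval ρ {cons a b} (cons p q) nil =
  _ , beta (caseCons (var _) (caseCons (var _) (caseNil (var _) nil))) ,
  ≤-trans (m≤m+n 7 23) (≤-trans (m≤m+n 30 _) (≤-reflexive (sym (*-suc 30 (size a + size b)))))
eq-eval ρ {cons a b} {cons c d} (cons p q) (cons p′ q′)
  with eqV a c | eq-eval ρ p p′ | eq-eval ρ q q′
... | true  | t , e , le | t′ , e′ , le′ =
  _ , beta (caseCons (var _) (caseCons (var _) (caseCons (var _)
        (caseCons (app (var _) (cons (var _) (var _)) e) (app (var _) (cons (var _) (var _)) e′))))) ,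
  (begin
    1 + 1 + (1 + 1 + (1 + 1 + (1 + (5 + t) + (5 + t′)))) ≡⟨ lem t t′ ⟩
    17 + (t + t′)                     ≤⟨ +-mono-≤ (m≤m+n 17 13) (+-mono-≤ le le′) ⟩
    30 + (30 * size a + 30 * size b)  ≡⟨ lem₂ (size a) (size b) ⟩
    30 * size (cons a b)              ∎)
  where
  open ≤-Reasoning
  lem : ∀ t t′ → 1 + 1 + (1 + 1 + (1 + 1 + (1 + (5 + t) + (5 + t′)))) ≡ 17 + (t + t′)
  lem = solve-∀
  lem₂ : ∀ x y → 30 + (30 * x + 30 * y) ≡ 30 * suc (x + y)
  lem₂ = solve-∀
... | false | t , e , le | _ =
  _ , beta (caseCons (var _) (caseCons (var _) (caseCons (var _)
        (caseNil (app (var _) (cons (var _) (var _)) e) nil)))) ,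
  (begin
    1 + 1 + (1 + 1 + (1 + 1 + (1 + (5 + t) + 1))) ≡⟨ lem t ⟩
    13 + (t + 0)                      ≤⟨ +-mono-≤ (m≤m+n 13 17) (+-mono-≤ le z≤n) ⟩
    30 + (30 * size a + 30 * size b)  ≡⟨ lem₂ (size a) (size b) ⟩
    30 * size (cons a b)              ∎)
  where
  open ≤-Reasoning
  lem : ∀ t → 1 + 1 + (1 + 1 + (1 + 1 + (1 + (5 + t) + 1))) ≡ 13 + (t + 0)
  lem = solve-∀
  lem₂ : ∀ x y → 30 + (30 * x + 30 * y) ≡ 30 * suc (x + y)
  lem₂ = solve-∀

module _ {I A : Set} (C : Code A) {n : ℕ} {σ : I → Scale} {ρ : I → Vec Val n} where
  open Code C

  eqR : ∀ {e₁ e₂} {x y : I → A} →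
        Runs σ (λ _ → 0) ρ e₁ (enc ∘ x) → Runs σ (λ _ → 0) ρ e₂ (enc ∘ y) →
        FPT σ (λ ι → size (enc (x ι))) →
        Runs σ (λ _ → 0) ρ (eqT e₁ e₂) (λ ι → encBool (x ι == y ι))
  eqR {x = x} {y} r₁ r₂ f = appR (runs _ (λ ι → fun) (lin-const 1)) (consR r₁ r₂)
    (applies _ (λ ι → proj₁ (proj₂ (ev ι)))
      (lin-≤ (λ ι → proj₂ (proj₂ (ev ι))) (fpt-* (lin-const 30) f)))
    where
    ev : ∀ ι → _
    ev ι = eq-eval (ρ ι) (flat (x ι)) (flat (y ι))

appT : ∀ {n} → Term n → Term n → Term n
appT a b = case (cons a b) nil (foldrT v0 v5 (cons v1 v0))

monusT : ∀ {n} → Term n → Term n → Term n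
monusT a b = case (cons a b) nil (foldrT v1 v4 (case v0 nil v1))

minT : ∀ {n} → Term n → Term n → Term n
minT a b = case (cons a b) nil (monusT v0 (monusT v0 v1))

isNilT : ∀ {n} → Term n → Term n
isNilT e = case e tick nil

isZero : ℕ → Bool
isZero zero    = true
isZero (suc _) = false

always : ∀ {I A : Set} → I → A → Set
always _ _ = ⊤

module _ {I : Set} {n : ℕ} {σ : I → Scale} {ρ : I → Vec Val n} where

  private
    R : Term n → (I → Val) → Set
    R = Runs σ (λ _ → 0) ρ

  appR′ : ∀ {A : Set} {enc : A → Val} {a b xs ys} →
          R a (encL enc ∘ xs) → R b (encL enc ∘ ys) → FPT σ (length ∘ xs) →
          R (appT a b) (λ ι → encL enc (xs ι ++ ys ι))
  appR′ {enc = enc} {ys = ys} ra rb f = unpairR (consR ra rb)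
    (foldrR always (λ ι zs → encL enc (zs ++ ys ι)) varR (FPT→Iter f) _ _ varR (consR varR varR))

  addR : ∀ {a b x y} → R a (encU ∘ x) → R b (encU ∘ y) → FPT σ x →
         R (appT a b) (λ ι → encU (x ι + y ι))
  addR {y = y} ra rb f = unpairR (consR ra rb)
    (foldUR always (λ ι k → encU (k + y ι)) varR f _ _ varR (consR varR varR))

  predR : ∀ {e k} → R e (encU ∘ k) → R (case e nil v1) (λ ι → encU (pred (k ι)))
  predR {e} {k} (runs t d c) = runs (λ ι → 1 + t ι + 1) (λ ι → go ι (k ι) (d ι)) (lin-+ (lin-suc c) (lin-const 1))
    where
    go : ∀ ι m {s} → ρ ι ⊢ e ⇓ encU m [ s ] → ρ ι ⊢ case e nil v1 ⇓ encU (pred m) [ 1 + s + 1 ]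
    go ι zero    d = caseNil d nil
    go ι (suc m) d = caseCons d (var _)

  isZeroR : ∀ {e k} → R e (encU ∘ k) → R (isNilT e) (λ ι → encBool (isZero (k ι)))
  isZeroR {e} {k} (runs t d c) = runs (λ ι → 1 + t ι + tm (k ι)) (λ ι → go ι (k ι) (d ι))
    (lin-+ (lin-suc c) (lin-≤ (λ ι → tm≤ (k ι)) (lin-const 3)))
    where
    tm : ℕ → ℕ
    tm zero    = 3
    tm (suc _) = 1
    tm≤ : ∀ m → tm m ≤ 3
    tm≤ zero    = ≤-refl
    tm≤ (suc m) = s≤s z≤n
    go : ∀ ι m {s} → ρ ι ⊢ e ⇓ encU m [ s ] → ρ ι ⊢ isNilT e ⇓ encBool (isZero m) [ 1 + s + tm m ]
    go ι zero    d = caseNil d (cons nil nil)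
    go ι (suc m) d = caseCons d nil

monusR : ∀ {I : Set} {n} {σ : I → Scale} {ρ : I → Vec Val n} {a b x y} →
         Runs σ (λ _ → 0) ρ a (encU ∘ x) → Runs σ (λ _ → 0) ρ b (encU ∘ y) → FPT σ y →
         Runs σ (λ _ → 0) ρ (monusT a b) (λ ι → encU (x ι ∸ y ι))
monusR {x = x} ra rb f = unpairR (consR ra rb)
  (foldUR always (λ ι k → encU (x ι ∸ k)) varR f _ _ varR
    (castR (λ j → cong encU (pred[m∸n]≡m∸[1+n] (x (FoldSuc.ix j)) (FoldSuc.num j))) (predR varR)))

-- Binary numbers

-- Bijective binary has the digits 1 and 2, here written `true` and `false`.
bits : ℕᵇ → List Bool
bits ℕᵇ.zero  = []
bits 2[1+ x ] = false ∷ bits x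
bits 1+[2 x ] = true ∷ bits x

bval : List Bool → ℕ
bval []       = 0
bval (b ∷ bs) = if b then suc (bval bs + bval bs) else suc (suc (bval bs + bval bs))

encℕ-bits : ∀ x → encℕᵇ x ≡ encL encBool (bits x)
encℕ-bits ℕᵇ.zero  = refl
encℕ-bits 2[1+ x ] = cong (cons _) (encℕ-bits x)
encℕ-bits 1+[2 x ] = cong (cons _) (encℕ-bits x)

bval-bits : ∀ x → bval (bits x) ≡ ℕᵇ.toℕ x
bval-bits ℕᵇ.zero  = refl
bval-bits 2[1+ x ] rewrite bval-bits x =
  lem (ℕᵇ.toℕ x)
  where
  lem : ∀ v → suc (suc (v + v)) ≡ 2 * suc v
  lem = solve-∀
bval-bits 1+[2 x ] rewrite bval-bits x = cong (λ v → suc (ℕᵇ.toℕ x + v)) (sym (+-identityʳ _))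

incBits : List Bool → List Bool
incBits []       = true ∷ []
incBits (b ∷ bs) = if b then false ∷ bs else true ∷ incBits bs

incBits-bits : ∀ x → incBits (bits x) ≡ bits (ℕᵇ.suc x)
incBits-bits ℕᵇ.zero  = refl
incBits-bits 2[1+ x ] = cong (true ∷_) (incBits-bits x)
incBits-bits 1+[2 x ] = refl

-- encℕ and the list of its digits are opaque to keep unification from
-- unfolding fromℕ.
opaque

  encN : ℕ → Val
  encN = encℕ

  digits : ℕ → List Bool
  digits k = bits (fromℕ k)

  encN≡encℕ : ∀ k → encN k ≡ encℕ k
  encN≡encℕ k = refl

  encN-digits : ∀ k → encN k ≡ encL encBool (digits k)
  encN-digits k = encℕ-bits (fromℕ k)

  bval-digits : ∀ k → bval (digits k) ≡ k
  bval-digits k = trans (bval-bits (fromℕ k)) (toℕ-fromℕ k)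

  incBits-digits : ∀ k → incBits (digits k) ≡ digits (suc k)
  incBits-digits k rewrite fromℕ≡fromℕ' k | fromℕ≡fromℕ' (suc k) = incBits-bits (fromℕ' k)

  digits-0 : digits 0 ≡ []
  digits-0 = refl

length≤bval : ∀ bs → length bs ≤ bval bs
length≤bval []           = z≤n
length≤bval (true ∷ bs)  = s≤s (≤-trans (length≤bval bs) (m≤m+n _ _))
length≤bval (false ∷ bs) = s≤s (≤-trans (length≤bval bs) (m≤n⇒m≤1+n (m≤m+n _ _)))

bval-tail : ∀ b bs → bval bs ≤ bval (b ∷ bs)
bval-tail true  bs = m≤n⇒m≤1+n (m≤m+n _ _)
bval-tail false bs = m≤n⇒m≤1+n (m≤n⇒m≤1+n (m≤m+n _ _))

length-digits : ∀ k → length (digits k) ≤ k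
length-digits k = subst (length (digits k) ≤_) (bval-digits k) (length≤bval (digits k))

size-bits : ∀ bs → size (encL encBool bs) ≤ 1 + 4 * length bs
size-bits []           = ≤-refl
size-bits (true ∷ bs)  = ≤-trans (+-monoʳ-≤ 4 (size-bits bs)) (≤-reflexive (lem (length bs)))
  where
  lem : ∀ l → 4 + (1 + 4 * l) ≡ 1 + 4 * suc l
  lem = solve-∀
size-bits (false ∷ bs) = ≤-trans (m≤n+m _ 2) (≤-trans (+-monoʳ-≤ 4 (size-bits bs)) (≤-reflexive (lem (length bs))))
  where
  lem : ∀ l → 4 + (1 + 4 * l) ≡ 1 + 4 * suc l
  lem = solve-∀

size-encN : ∀ k → size (encN k) ≤ 1 + 4 * k
size-encN k = subst (λ v → size v ≤ 1 + 4 * k) (sym (encN-digits k))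
  (≤-trans (size-bits (digits k)) (s≤s (*-monoʳ-≤ 4 (length-digits k))))

toUT : ∀ {n} → Term n → Term n
toUT e = foldrT e nil (case v1 (cons tick (cons tick (appT v0 v0))) (cons tick (appT v2 v2)))

capT : ∀ {n} → Term n → Term n → Term n
capT c e = case (cons c e) nil (foldrT v1 nil
  (minT v7 (case v1 (cons tick (cons tick (appT v0 v0))) (cons tick (appT v2 v2)))))

incT : ∀ {n} → Term n → Term n
incT e = foldrT e (cons tick nil) (case v1 (cons tick v0) (cons nil v4))

binT : ∀ {n} → Term n → Term n
binT e = foldrT e nil (incT v0)

natsT : ∀ {n} → Term n → Term n
natsT e = foldrT e nil (appT v0 (cons (binT v2) nil))

module _ {I : Set} {n : ℕ} {σ : I → Scale} {ρ : I → Vec Val n} where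

  private
    R : Term n → (I → Val) → Set
    R = Runs σ (λ _ → 0) ρ

  minR : ∀ {a b x y} → R a (encU ∘ x) → R b (encU ∘ y) → FPT σ x → FPT σ y →
         R (minT a b) (λ ι → encU (x ι ⊓ y ι))
  minR {x = x} {y} ra rb fx fy = unpairR (consR ra rb)
    (castR (λ ι → cong encU (lem (x ι) (y ι)))
      (monusR varR (monusR varR varR fy) (lin-≤ (λ ι → m∸n≤m (x ι) (y ι)) fx)))
    where
    lem : ∀ a b → a ∸ (a ∸ b) ≡ a ⊓ b
    lem a b with ≤-total b a
    ... | inj₁ b≤a = trans (m∸[m∸n]≡n b≤a) (sym (m≥n⇒m⊓n≡n b≤a))
    ... | inj₂ a≤b rewrite m≤n⇒m∸n≡0 a≤b = sym (m≤n⇒m⊓n≡m a≤b)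

module _ {I : Set} {n : ℕ} {σ : I → Scale} {ρ : I → Vec Val n} where

  private
    R : Term n → (I → Val) → Set
    R = Runs σ (λ _ → 0) ρ

  bitsR : ∀ {e k} → R e (encN ∘ k) → R e (λ ι → encL encBool (digits (k ι)))
  bitsR {k = k} = castR λ ι → encN-digits (k ι)

  bitsR⁻¹ : ∀ {e k} → R e (λ ι → encL encBool (digits (k ι))) → R e (encN ∘ k)
  bitsR⁻¹ {k = k} = castR λ ι → sym (encN-digits (k ι))

  toUR : ∀ {e k} → R e (encN ∘ k) → FPT σ k → R (toUT e) (encU ∘ k)
  toUR {k = k} r f = castR (λ ι → cong encU (bval-digits (k ι)))
    (foldrR {xs = digits ∘ k} (λ ι bs → bval bs ≤ k ι) (λ ι bs → encU (bval bs))
      (bitsR r) (FPT→Iter (lin-≤ (λ ι → length-digits (k ι)) f))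
      (λ ι → ≤-reflexive (bval-digits (k ι)))
      (λ ι b bs → ≤-trans (bval-tail b bs))
      nilR
      (iteR encU varR
        (consR tickR (addR varR varR le))
        (consR tickR (consR tickR (addR varR varR le)))))
    where
    open FoldCons
    Inv : I → List Bool → ⊤ → Set
    Inv ι bs _ = bval bs ≤ k ι
    le : FPT (σ ∘ ix) (λ (j : FoldCons Inv) → bval (tl j))
    le = lin-≤ (λ j → ≤-trans (bval-tail (hd j) (tl j)) (inv j)) (re-lin ix f)

  -- The available counts may be exponential in their code length and must not be written in unary.
  -- Truncating at m after every Horner step keeps the intermediate values below 3 + 2 * m, and by
  -- `⊓-cut` truncating before the doubling does not change the truncated result.
  capR : ∀ {c e m k} → R c (encU ∘ m) → R e (encN ∘ k) →
         FPT σ m → FPT σ (λ ι → length (digits (k ι))) →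
         R (capT c e) (λ ι → encU (m ι ⊓ k ι))
  capR {m = m} {k} rc re fm fk = castR (λ ι → cong (λ v → encU (m ι ⊓ v)) (bval-digits (k ι)))
    (unpairR (consR rc (bitsR re))
      (foldrR {xs = digits ∘ k} always (λ ι bs → encU (m ι ⊓ bval bs)) varR (FPT→Iter fk) _ _
        (castR (λ ι → cong encU (sym (⊓-zeroʳ (m ι)))) nilR)
        (castR (λ j → cong encU (eq (hd j) (m (ix j)) (bval (tl j))))
          (minR varR
            (iteR encU varR
              (consR tickR (addR varR varR le))
              (consR tickR (consR tickR (addR varR varR le))))
            (re-lin ix fm)
            (lin-≤ (λ j → cut (hd j) (m (ix j)) (bval (tl j)))
              (lin-+ (lin-const 2) (lin-+ (re-lin ix fm) (re-lin ix fm))))))))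
    where
    open FoldCons
    le : FPT (σ ∘ ix) (λ (j : FoldCons {P = ⊤} (λ ι ys _ → always ι ys)) → m (ix j) ⊓ bval (tl j))
    le = lin-≤ (λ j → m⊓n≤m _ _) (re-lin ix fm)
    cut : ∀ (b : Bool) m v → (if b then suc (m ⊓ v + m ⊓ v) else suc (suc (m ⊓ v + m ⊓ v))) ≤ 2 + (m + m)
    cut true  m v = m≤n⇒m≤1+n (s≤s (+-mono-≤ (m⊓n≤m m v) (m⊓n≤m m v)))
    cut false m v = s≤s (s≤s (+-mono-≤ (m⊓n≤m m v) (m⊓n≤m m v)))
    ⊓-cut : ∀ c m v → m ⊓ (c + (m ⊓ v + m ⊓ v)) ≡ m ⊓ (c + (v + v))
    ⊓-cut c m v with ≤-total m v
    ... | inj₂ v≤m rewrite m≥n⇒m⊓n≡n v≤m = refl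
    ... | inj₁ m≤v rewrite m≤n⇒m⊓n≡m m≤v =
      trans (m≤n⇒m⊓n≡m (≤-trans (m≤m+n m m) (m≤n+m (m + m) c)))
            (sym (m≤n⇒m⊓n≡m (≤-trans m≤v (≤-trans (m≤m+n v v) (m≤n+m (v + v) c)))))
    eq : ∀ (b : Bool) m v →
         m ⊓ (if b then suc (m ⊓ v + m ⊓ v) else suc (suc (m ⊓ v + m ⊓ v))) ≡
         m ⊓ (if b then suc (v + v) else suc (suc (v + v)))
    eq true  = ⊓-cut 1
    eq false = ⊓-cut 2

  incR : ∀ {e k} → R e (encN ∘ k) → FPT σ k → R (incT e) (λ ι → encN (suc (k ι)))
  incR {k = k} r f = bitsR⁻¹ (castR (λ ι → cong (encL encBool) (incBits-digits (k ι)))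
    (foldrR {xs = digits ∘ k} always (λ ι bs → encL encBool (incBits bs))
      (bitsR r) (FPT→Iter (lin-≤ (λ ι → length-digits (k ι)) f)) _ _
      (consR tickR nilR)
      (iteR (encL encBool) varR (consR nilR varR) (consR tickR varR))))

binR : ∀ {I : Set} {n} {σ : I → Scale} {ρ : I → Vec Val n} {e k} →
       Runs σ (λ _ → 0) ρ e (encU ∘ k) → FPT σ k → Runs σ (λ _ → 0) ρ (binT e) (encN ∘ k)
binR {k = k} r f = foldUR (λ ι m → m ≤ k ι) (λ ι m → encN m) r f (λ ι → ≤-refl) (λ ι m → <⇒≤)
  (castR (λ ι → sym (trans (encN-digits 0) (cong (encL encBool) digits-0))) nilR)
  (incR varR (lin-≤ (λ j → <⇒≤ (inv j)) (re-lin ix f)))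
  where open FoldSuc

natsR : ∀ {I : Set} {n} {σ : I → Scale} {ρ : I → Vec Val n} {e k} →
        Runs σ (λ _ → 0) ρ e (encU ∘ k) → FPT σ k →
        Runs σ (λ _ → 0) ρ (natsT e) (λ ι → encL encN (upTo (k ι)))
natsR {k = k} r f = foldUR (λ ι m → m ≤ k ι) (λ ι m → encL encN (upTo m)) r f (λ ι → ≤-refl) (λ ι m → <⇒≤)
  nilR
  (castR (λ j → cong (encL encN) (applyUpTo-∷ʳ id (num j)))
    (appR′ varR (consR (binR varR fn) nilR) (lin-≤ (λ j → ≤-reflexive (length-upTo (num j))) fn)))
  where
  open FoldSuc
  fn : FPT _ (num {Inv = λ ι m → m ≤ k ι})
  fn = lin-≤ (λ j → <⇒≤ (inv j)) (re-lin ix f)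

open Code

cons-inj : ∀ {a b c d} → Val.cons a b ≡ cons c d → a ≡ c × b ≡ d
cons-inj refl = refl , refl

codeℕ : Code ℕ
codeℕ .enc  = encN
codeℕ .flat k rewrite encN-digits k = go (digits k)
  where
  go : ∀ bs → Flat (encL encBool bs)
  go []           = nil
  go (false ∷ bs) = cons nil (go bs)
  go (true ∷ bs)  = cons (cons nil nil) (go bs)
codeℕ .inj {x} {y} e = trans (sym (bval-digits x))
  (trans (cong bval (go _ _ (trans (sym (encN-digits x)) (trans e (encN-digits y))))) (bval-digits y))
  where
  go : ∀ bs cs → encL encBool bs ≡ encL encBool cs → bs ≡ cs
  go []           []           e = refl
  go (false ∷ bs) (false ∷ cs) e = cong (false ∷_) (go bs cs (proj₂ (cons-inj e)))
  go (true ∷ bs)  (true ∷ cs)  e = cong (true ∷_) (go bs cs (proj₂ (cons-inj e)))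

codeU : Code ℕ
codeU .enc = encU
codeU .flat zero    = nil
codeU .flat (suc k) = cons (cons nil nil) (codeU .flat k)
codeU .inj {zero}  {zero}  e = refl
codeU .inj {suc x} {suc y} e = cong suc (codeU .inj (proj₂ (cons-inj e)))

encPair : {A B : Set} → (A → Val) → (B → Val) → A × B → Val
encPair encA encB (x , y) = cons (encA x) (encB y)

codePair : {A B : Set} → Code A → Code B → Code (A × B)
codePair C D .enc = encPair (C .enc) (D .enc)
codePair C D .flat (x , y) = cons (C .flat x) (D .flat y)
codePair C D .inj e = let e₁ , e₂ = cons-inj e in cong₂ _,_ (C .inj e₁) (D .inj e₂)

codeList : {A : Set} → Code A → Code (List A)
codeList C .enc = encL (C .enc)
codeList C .flat []       = nil
codeList C .flat (x ∷ xs) = cons (C .flat x) (codeList C .flat xs)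
codeList C .inj {[]}     {[]}     e = refl
codeList C .inj {x ∷ xs} {y ∷ ys} e =
  let e₁ , e₂ = cons-inj e in cong₂ _∷_ (C .inj e₁) (codeList C .inj e₂)

open Code
open FoldCons using () renaming (ix to ixᶜ; hd to hdᶜ; tl to tlᶜ; pm to pmᶜ; inv to invᶜ)
open FoldSuc using () renaming (ix to ixˢ; num to numˢ; inv to invˢ)

Runs₀ : {I : Set} {n : ℕ} → (I → Scale) → (I → Vec Val n) → Term n → (I → Val) → Set
Runs₀ σ = Runs σ (λ _ → 0)

-- Lists

countT : ∀ {n} → Term n → Term n → Term n
countT a l = case (cons a l) nil (foldrT v1 nil (case (eqT v7 v1) v0 (cons tick v2)))

count≤length : ∀ {A} (C : Code A) a xs → count C a xs ≤ length xs
count≤length C a []       = z≤n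
count≤length C a (x ∷ xs) with _==_ C a x
... | true  = s≤s (count≤length C a xs)
... | false = m≤n⇒m≤1+n (count≤length C a xs)

countR : ∀ {I A : Set} (C : Code A) {n} {σ : I → Scale} {ρ : I → Vec Val n} {e l}
         {a : I → A} {xs : I → List A} →
         Runs₀ σ ρ e (enc C ∘ a) → Runs₀ σ ρ l (encL (enc C) ∘ xs) →
         FPT σ (λ ι → size (enc C (a ι))) → FPT σ (length ∘ xs) →
         Runs₀ σ ρ (countT e l) (λ ι → encU (count C (a ι) (xs ι)))
countR C {a = a} re rl fa fl = unpairR (consR re rl)
  (foldrR always (λ ι ys → encU (count C (a ι) ys)) varR (FPT→Iter fl) _ _ nilR
    (iteR encU (eqR C varR varR (re-lin ixᶜ fa)) (consR tickR varR) varR))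

concatT : ∀ {n} → Term n → Term n
concatT l = foldrT l nil (appT v1 v0)

concatR : ∀ {I A : Set} {enc : A → Val} {n} {σ : I → Scale} {ρ : I → Vec Val n} {l}
          {xss : I → List (List A)} {Z : I → ℕ} →
          Runs₀ σ ρ l (encL (encL enc) ∘ xss) → FPT σ (length ∘ xss) →
          FPT σ Z → (∀ ι → All (λ xs → length xs ≤ Z ι) (xss ι)) →
          Runs₀ σ ρ (concatT l) (λ ι → encL enc (concat (xss ι)))
concatR {enc = enc} {Z = Z} r f fZ all =
  foldrR (λ ι → All (λ xs → length xs ≤ Z ι)) (λ ι xss → encL enc (concat xss)) r (FPT→Iter f)
    all (λ ι x ys → All.tail) nilR
    (appR′ varR varR (lin-≤ (λ j → All.head (invᶜ j)) (re-lin ixᶜ fZ)))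

length-concat≤ : ∀ {A : Set} {Z} {xss : List (List A)} → All (λ xs → length xs ≤ Z) xss →
                 length (concat xss) ≤ length xss * Z
length-concat≤ []                     = z≤n
length-concat≤ {xss = xs ∷ xss} (p ∷ ps) =
  ≤-trans (≤-reflexive (length-++ xs)) (+-mono-≤ p (length-concat≤ ps))

subs : ∀ {A : Set} → List A → List (List A)
subs []       = [] ∷ []
subs (x ∷ xs) = map (x ∷_) (subs xs) ++ subs xs

length-subs : ∀ {A : Set} (xs : List A) → length (subs xs) ≡ 2 ^ length xs
length-subs []       = refl
length-subs (x ∷ xs) = trans (length-++ (map (x ∷_) (subs xs)))
  (cong₂ _+_ (trans (length-map (x ∷_) (subs xs)) (length-subs xs))
             (trans (length-subs xs) (sym (+-identityʳ _))))

subs-length : ∀ {A : Set} (xs : List A) → All (λ ys → length ys ≤ length xs) (subs xs)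
subs-length []       = z≤n ∷ []
subs-length (x ∷ xs) = All.++⁺ (All.map⁺ (All.map s≤s (subs-length xs)))
                               (All.map m≤n⇒m≤1+n (subs-length xs))

mapConsT : ∀ {n} → Term n → Term n → Term n
mapConsT x l = case (cons x l) nil (foldrT v1 nil (cons (cons v7 v1) v0))

subsT : ∀ {n} → Term n → Term n
subsT l = foldrT l (cons nil nil) (appT (mapConsT v1 v0) v0)

mapConsR : ∀ {I A : Set} {enc : A → Val} {n} {σ : I → Scale} {ρ : I → Vec Val n} {e l}
           {x : I → A} {xss : I → List (List A)} →
           Runs₀ σ ρ e (enc ∘ x) → Runs₀ σ ρ l (encL (encL enc) ∘ xss) → FPT σ (length ∘ xss) →
           Runs₀ σ ρ (mapConsT e l) (λ ι → encL (encL enc) (map (x ι ∷_) (xss ι)))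
mapConsR {enc = enc} {x = x} re rl f = unpairR (consR re rl)
  (foldrR always (λ ι xss → encL (encL enc) (map (x ι ∷_) xss)) varR (FPT→Iter f) _ _
    nilR (consR (consR varR varR) varR))

subsR : ∀ {I A : Set} {enc : A → Val} {n} {σ : I → Scale} {ρ : I → Vec Val n} {l}
        {xs : I → List A} →
        Runs₀ σ ρ l (encL enc ∘ xs) → Par σ (length ∘ xs) →
        Runs₀ σ ρ (subsT l) (λ ι → encL (encL enc) (subs (xs ι)))
subsR {enc = enc} {xs = xs} r p =
  foldrR (λ ι ys → length ys ≤ length (xs ι)) (λ ι ys → encL (encL enc) (subs ys)) r (Par→Iter p)
    (λ ι → ≤-refl) (λ ι x ys → <⇒≤)
    (consR nilR nilR)
    (appR′ (mapConsR varR varR f) varR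
      (lin-≤ (λ j → ≤-reflexive (length-map _ (subs (tlᶜ j)))) f))
  where
  f : FPT _ (λ j → length (subs (tlᶜ {P = ⊤} {Inv = λ ι ys _ → length ys ≤ length (xs ι)} j)))
  f = lin-≤ (λ j → ≤-trans (≤-reflexive (length-subs (tlᶜ j))) (^-monoʳ-≤ 2 (<⇒≤ (invᶜ j))))
        (re-lin ixᶜ (par→lin (par-2^ p)))

zipT : ∀ {n} → Term n → Term n → Term n
zipT a b = foldT a b nil (case v3 nil v1) (case v4 nil (cons (cons v3 v0) v2))

zipR : ∀ {I A B : Set} {encA : A → Val} {encB : B → Val} {n} {σ : I → Scale} {ρ : I → Vec Val n}
       {e e′} {xs : I → List A} {ys : I → List B} →
       Runs₀ σ ρ e (encL encA ∘ xs) → Runs₀ σ ρ e′ (encL encB ∘ ys) → FPT σ (length ∘ xs) →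
       Runs₀ σ ρ (zipT e e′) (λ ι → encL (encPair encA encB) (zip (xs ι) (ys ι)))
zipR {encA = encA} {encB} ra rb f =
  foldR (λ _ _ _ → ⊤) (λ ι x xs ys → drop 1 ys) (λ ι xs ys → encL (encPair encA encB) (zip xs ys))
    ra rb (FPT→Iter f) _ _ nilR
    (caseListR {xs = pmᶜ} (λ j ys → encL encB (drop 1 ys)) varR nilR varR)
    (caseListR {xs = pmᶜ} (λ j ys → encL (encPair encA encB) (zip (hdᶜ j ∷ tlᶜ j) ys)) varR nilR
      (consR (consR varR varR)
        (castR (λ j → cong (λ ys → encL (encPair encA encB) (zip (tlᶜ (ConsCase.ix j)) (drop 1 ys)))
                           (ConsCase.eq j)) varR)))

-- The last N occurrences of each element survive. N is the norm of the first capacity for the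
-- items, and N = 1 removes duplicates from the tokens.
keep : ∀ {A} → Code A → ℕ → List A → List A
keep C N []       = []
keep C N (x ∷ xs) = if isZero (N ∸ count C x (keep C N xs)) then keep C N xs else x ∷ keep C N xs

keep-length : ∀ {A} (C : Code A) N xs → length (keep C N xs) ≤ length xs
keep-length C N []       = z≤n
keep-length C N (x ∷ xs) with isZero (N ∸ count C x (keep C N xs))
... | true  = m≤n⇒m≤1+n (keep-length C N xs)
... | false = s≤s (keep-length C N xs)

keepT : ∀ {n} → Term n → Term n → Term n
keepT N l = case (cons N l) nil
  (foldrT v1 nil (case (isNilT (monusT v7 (countT v1 v0))) (cons v1 v0) v2))

keepR : ∀ {I A : Set} (C : Code A) {n} {σ : I → Scale} {ρ : I → Vec Val n} {e l}
        {N : I → ℕ} {xs : I → List A} {Z : I → ℕ} →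
        Runs₀ σ ρ e (encU ∘ N) → Runs₀ σ ρ l (encL (enc C) ∘ xs) →
        FPT σ (length ∘ xs) → FPT σ Z → (∀ ι → All (λ x → size (enc C x) ≤ Z ι) (xs ι)) →
        Runs₀ σ ρ (keepT e l) (λ ι → encL (enc C) (keep C (N ι) (xs ι)))
keepR {I} {A} C {σ = σ} {N = N} {xs} {Z} re rl f fZ all = unpairR (consR re rl)
  (foldrR Inv (λ ι ys → encL (enc C) (keep C (N ι) ys)) varR (FPT→Iter f)
    (λ ι → all ι , ≤-refl) (λ ι x ys (p , q) → All.tail p , <⇒≤ q)
    nilR
    (iteR (encL (enc C))
      (isZeroR (monusR varR
        (countR C varR varR (lin-≤ (λ j → All.head (proj₁ (invᶜ j))) (re-lin ixᶜ fZ)) fk)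
        (lin-≤ (λ j → count≤length C (hdᶜ j) (keep C (N (ixᶜ j)) (tlᶜ j))) fk)))
      varR (consR varR varR)))
  where
  Inv : I → List A → Set
  Inv ι ys = All (λ x → size (enc C x) ≤ Z ι) ys × length ys ≤ length (xs ι)
  fk : FPT (σ ∘ ixᶜ) (λ (j : FoldCons {P = ⊤} (λ ι ys _ → Inv ι ys)) → length (keep C (N (ixᶜ j)) (tlᶜ j)))
  fk = lin-≤ (λ j → ≤-trans (keep-length C (N (ixᶜ j)) (tlᶜ j)) (<⇒≤ (proj₂ (invᶜ j)))) (re-lin ixᶜ f)

repT : ∀ {n} → Term n → Term n → Term n
repT k x = case (cons k x) nil (foldrT v0 nil (cons v8 v0))

repR : ∀ {I A : Set} {enc : A → Val} {n} {σ : I → Scale} {ρ : I → Vec Val n} {e l}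
       {k : I → ℕ} {x : I → A} →
       Runs₀ σ ρ e (encU ∘ k) → Runs₀ σ ρ l (enc ∘ x) → FPT σ k →
       Runs₀ σ ρ (repT e l) (λ ι → encL enc (replicate (k ι) (x ι)))
repR {enc = enc} {x = x} re rl f = unpairR (consR re rl)
  (foldUR always (λ ι m → encL enc (replicate m (x ι))) varR f _ _ nilR (consR varR varR))

fstsT sndsT : ∀ {n} → Term n → Term n
fstsT l = foldrT l nil (cons (case v1 nil v0) v0)
sndsT l = foldrT l nil (cons (case v1 nil v1) v0)

module _ {I A B : Set} {encA : A → Val} {encB : B → Val} {n : ℕ} {σ : I → Scale} {ρ : I → Vec Val n}
         {e : Term n} {xs : I → List (A × B)}
         (r : Runs₀ σ ρ e (encL (encPair encA encB) ∘ xs)) (f : FPT σ (length ∘ xs)) where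

  fstsR : Runs₀ σ ρ (fstsT e) (λ ι → encL encA (map proj₁ (xs ι)))
  fstsR = foldrR always (λ ι xs → encL encA (map proj₁ xs)) r (FPT→Iter f) _ _ nilR
    (consR (unpairR varR varR) varR)

  sndsR : Runs₀ σ ρ (sndsT e) (λ ι → encL encB (map proj₂ (xs ι)))
  sndsR = foldrR always (λ ι xs → encL encB (map proj₂ xs)) r (FPT→Iter f) _ _ nilR
    (consR (unpairR varR varR) varR)

-- Columns

-- The token of an item is its size vector and its fingerprint; the token
-- of the bin kind i is ([] , i).
Tok : Set
Tok = List ℕ × ℕ

codeTok : Code Tok
codeTok = codePair (codeList codeℕ) codeℕ

encTok : Tok → Val
encTok = enc codeTok

head₀ : List ℕ → ℕ
head₀ []      = 0
head₀ (x ∷ _) = x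

heads : List (List ℕ) → ℕ
heads []       = 0
heads (s ∷ ss) = head₀ s + heads ss

fits : List ℕ → List (List ℕ) → Bool
fits []       ss = true
fits (B ∷ Bs) ss = if isZero (heads ss ∸ B) then fits Bs (map (drop 1) ss) else false

headsT tailsT : ∀ {n} → Term n → Term n
headsT e = foldrT e nil (appT (case v1 nil (toUT v0)) v0)
tailsT e = foldrT e nil (cons (case v1 nil v1) v0)

fitsT : ∀ {n} → Term n → Term n → Term n
fitsT a b = foldT a b tick (tailsT v3) (case (isNilT (monusT (headsT v4) (toUT v1))) nil v2)

SizesBelow : ℕ → List (List ℕ) → Set
SizesBelow Z ss = length ss ≤ Z × All (All (_≤ Z)) ss

SizesBelow-tails : ∀ {Z ss} → SizesBelow Z ss → SizesBelow Z (map (drop 1) ss)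
SizesBelow-tails {ss = ss} (l , p) = ≤-trans (≤-reflexive (length-map (drop 1) ss)) l , All.map⁺ (All.map (λ {s} → go {s}) p)
  where
  go : ∀ {s} → All (_≤ _) s → All (_≤ _) (drop 1 s)
  go []      = []
  go (_ ∷ q) = q

module _ {I : Set} {n : ℕ} {σ : I → Scale} {ρ : I → Vec Val n} {e : Term n} {ss : I → List (List ℕ)} where

  headsR : {Z : I → ℕ} → Runs₀ σ ρ e (encL (encL encN) ∘ ss) → FPT σ Z → (∀ ι → SizesBelow (Z ι) (ss ι)) →
           Runs₀ σ ρ (headsT e) (λ ι → encU (heads (ss ι)))
  headsR {Z} r f all = foldrR (λ ι → All (All (_≤ Z ι))) (λ ι ss → encU (heads ss))
    r (FPT→Iter (lin-≤ (proj₁ ∘ all) f)) (proj₂ ∘ all) (λ _ _ _ → All.tail) nilR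
    (addR (caseListR {xs = hdᶜ} (λ _ s → encU (head₀ s)) varR nilR
            (toUR varR (lin-≤ (λ j → All.head (subst (All _) (ConsCase.eq j) (All.head (invᶜ (ConsCase.ix j)))))
                              (re-lin (ixᶜ ∘ ConsCase.ix) f))))
          varR
          (lin-≤ (λ j → h≤ (All.head (invᶜ j))) (re-lin ixᶜ f)))
    where
    h≤ : ∀ {z s} → All (_≤ z) s → head₀ s ≤ z
    h≤ []      = z≤n
    h≤ (p ∷ _) = p

  tailsR : Runs₀ σ ρ e (encL (encL encN) ∘ ss) → FPT σ (length ∘ ss) →
           Runs₀ σ ρ (tailsT e) (λ ι → encL (encL encN) (map (drop 1) (ss ι)))
  tailsR r f = foldrR always (λ ι ss → encL (encL encN) (map (drop 1) ss)) r (FPT→Iter f) _ _ nilR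
    (consR (caseListR {xs = hdᶜ} (λ _ s → encL encN (drop 1 s)) varR nilR varR) varR)

fitsR : ∀ {I : Set} {n} {σ : I → Scale} {ρ : I → Vec Val n} {e e′}
        {cap : I → List ℕ} {ss : I → List (List ℕ)} {Z : I → ℕ} →
        Runs₀ σ ρ e (encL encN ∘ cap) → Runs₀ σ ρ e′ (encL (encL encN) ∘ ss) → FPT σ Z →
        (∀ ι → length (cap ι) ≤ Z ι) → (∀ ι → All (_≤ Z ι) (cap ι)) → (∀ ι → SizesBelow (Z ι) (ss ι)) →
        Runs₀ σ ρ (fitsT e e′) (λ ι → encBool (fits (cap ι) (ss ι)))
fitsR {I} {Z = Z} r r′ f lc ac as =
  foldR Inv (λ _ _ _ ss → map (drop 1) ss) (λ _ cap ss → encBool (fits cap ss)) r r′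
    (FPT→Iter (lin-≤ lc f)) (λ ι → ac ι , as ι)
    (λ { ι x ys p (a , b) → All.tail a , SizesBelow-tails b })
    tickR
    (tailsR varR (lin-≤ (λ j → proj₁ (proj₂ (invᶜ j))) (re-lin ixᶜ f)))
    (iteR encBool
      (isZeroR (monusR (headsR varR (re-lin ixᶜ f) (λ j → proj₂ (invᶜ j))) (toUR varR hdB) hdB))
      varR nilR)
  where
  Inv : I → List ℕ → List (List ℕ) → Set
  Inv ι cap ss = All (_≤ Z ι) cap × SizesBelow (Z ι) ss
  hdB : FPT _ (hdᶜ {Inv = Inv})
  hdB = lin-≤ (λ j → All.head (proj₁ (invᶜ j))) (re-lin ixᶜ f)

mset : ℕ → List Tok → List ℕ
mset q C = map (λ φ → count codeℕ φ (map proj₂ C)) (upTo q)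

msetT : ∀ {n} → Term n → Term n → Term n
msetT q C = case (cons (natsT q) (sndsT C)) nil (foldrT v0 nil (cons (binT (countT v1 v8)) v0))

upTo-≤ : ∀ q → All (_≤ q) (upTo q)
upTo-≤ q = All.applyUpTo⁺₁ id q <⇒≤

msetR : ∀ {I : Set} {n} {σ : I → Scale} {ρ : I → Vec Val n} {e e′}
        {q : I → ℕ} {C : I → List Tok} →
        Runs₀ σ ρ e (encU ∘ q) → Runs₀ σ ρ e′ (encL encTok ∘ C) → FPT σ q → FPT σ (length ∘ C) →
        Runs₀ σ ρ (msetT e e′) (λ ι → encL encN (mset (q ι) (C ι)))
msetR {q = q} {C} r r′ fq fC = unpairR (consR (natsR r fq) (sndsR r′ fC))
  (foldrR {xs = upTo ∘ q} (λ ι → All (_≤ q ι)) (λ ι φs → encL encN (map (λ φ → count codeℕ φ (map proj₂ (C ι))) φs))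
    varR (FPT→Iter (lin-≤ (λ ι → ≤-reflexive (length-upTo (q ι))) fq))
    (λ ι → upTo-≤ (q ι)) (λ _ _ _ → All.tail) nilR
    (consR (binR (countR codeℕ varR varR
              (lin-≤ (λ j → ≤-trans (size-encN (hdᶜ j)) (s≤s (*-monoʳ-≤ 4 (All.head (invᶜ j)))))
                     (lin-suc (fpt-* (lin-const 4) (re-lin ixᶜ fq)))) fC′)
             (lin-≤ (λ j → count≤length codeℕ (hdᶜ j) (map proj₂ (C (ixᶜ j)))) fC′))
           varR))
  where
  fC′ : FPT _ (λ (j : FoldCons {P = ⊤} (λ ι ys _ → All (_≤ q ι) ys)) → length (map proj₂ (C (ixᶜ j))))
  fC′ = lin-≤ (λ j → ≤-reflexive (length-map proj₂ (C (ixᶜ j)))) (re-lin ixᶜ fC)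

-- The field `ok` is the mathematical predicate and leaves no trace in the code; `KindOK` ties it to
-- the runs of `prog`.
record Kind : Set where
  constructor kind
  field
    cap  : List ℕ
    av   : ℕ
    prog : Val
    idx  : ℕ
    ok   : List Tok → Bool
open Kind

encKind : Kind → Val
encKind k = cons (encL encN (cap k)) (cons (encN (av k)) (cons (prog k) (encN (idx k))))

kindTok : Kind → Tok
kindTok k = [] , idx k

Col : Set
Col = List Tok

addCol : Kind → List Tok → List Col → List Col
addCol k C r =
  if fits (cap k) (map proj₁ C) then (if ok k C then (kindTok k ∷ C) ∷ r else r) else r

kindCols : Kind → List (List Tok) → List Col
kindCols k = foldr (addCol k) []

cols : List (List Tok) → List Kind → List Col
cols Cs []       = []
cols Cs (k ∷ ks) = kindCols k Cs ++ cols Cs ks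

addCol-length : ∀ k C r → length (addCol k C r) ≤ suc (length r)
addCol-length k C r with fits (cap k) (map proj₁ C) | ok k C
... | true  | true  = ≤-refl
... | true  | false = n≤1+n _
... | false | _     = n≤1+n _

kindCols-length : ∀ k Cs → length (kindCols k Cs) ≤ length Cs
kindCols-length k []       = z≤n
kindCols-length k (C ∷ Cs) = ≤-trans (addCol-length k C (kindCols k Cs)) (s≤s (kindCols-length k Cs))

kindColsT : ∀ {n} → Term n → Term n → Term n → Term n
kindColsT q k l = case (cons q (cons k l)) nil (case v1 nil (case v0 nil (case v1 nil (case v1 nil
  (foldrT v7 nil (case (fitsT v11 (fstsT v1)) v0
    (case (app v9 (msetT v17 v3)) v2 (cons (cons (cons nil v12) v5) v4))))))))

colsT : ∀ {n} → Term n → Term n → Term n → Term n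
colsT q ks l = case (cons q (cons ks l)) nil (case v1 nil
  (foldrT v0 nil (let′ (kindColsT v9 v1 v8) (appT v0 v1))))

-- Z bounds everything that depends on the parameter only; a call of the
-- predicate of kind k on C costs at most t.
record KindOK (q Z t : ℕ) (Cs : List (List Tok)) (k : Kind) : Set where
  field
    cap-length : length (cap k) ≤ Z
    cap≤       : All (_≤ Z) (cap k)
    call       : All (λ C → ∃[ u ] (prog k · encL encN (mset q C) ⇓ encBool (ok k C) [ u ]) × u ≤ t) Cs

module _ {I : Set} {n : ℕ} {σ : I → Scale} {τ : I → ℕ} {ρ : I → Vec Val n} {e₁ e₂ e₃ : Term n}
         {q Z : I → ℕ} {Cs : I → List (List Tok)}
         (rq : Runs σ τ ρ e₁ (encU ∘ q)) (rC : Runs σ τ ρ e₃ (encL (encL encTok) ∘ Cs))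
         (fq : Par σ q) (fC : Par σ (length ∘ Cs)) (fZ : Par σ Z)
         (Cs≤ : ∀ ι → All (λ C → SizesBelow (Z ι) (map proj₁ C)) (Cs ι)) where

  -- The only calls of the predicates, at most one for each sublist. The number of sublists is
  -- bounded by the parameter, so `Par→Iter` applies and τ remains linear.
  kindColsR : {k : I → Kind} → (∀ ι → KindOK (q ι) (Z ι) (τ ι) (Cs ι) (k ι)) →
              Runs σ τ ρ e₂ (encKind ∘ k) →
              Runs σ τ ρ (kindColsT e₁ e₂ e₃) (λ ι → encL (encL encTok) (kindCols (k ι) (Cs ι)))
  kindColsR {k} K rk = unpairR (consR rq (consR rk rC)) (unpairR varR (unpairR varR (unpairR varR (unpairR varR
    (foldrR Inv (λ ι Cs → encL (encL encTok) (kindCols (k ι) Cs)) varR (Par→Iter fC)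
      (λ ι → Cs≤ ι , KindOK.call (K ι)) (λ { ι x ys (a , b) → All.tail a , All.tail b }) nilR
      (iteR (encL (encL encTok))
        (liftR (fitsR varR (fstsR varR C-len) (re-lin ixᶜ (par→lin fZ))
          (KindOK.cap-length ∘ K ∘ ixᶜ) (KindOK.cap≤ ∘ K ∘ ixᶜ) (All.head ∘ proj₁ ∘ invᶜ)))
        (iteR (encL (encL encTok))
          (appR varR (liftR (msetR varR varR (re-lin ixᶜ (par→lin fq)) C-len))
            (applies _ (λ j → proj₁ (proj₂ (All.head (proj₂ (invᶜ j)))))
                       (lin-≤ (λ j → proj₂ (proj₂ (All.head (proj₂ (invᶜ j))))) lin-τ)))
          (consR (consR (consR nilR varR) varR) varR)
          varR)
        varR))))))
    where
    Inv : I → List (List Tok) → Set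
    Inv ι Cs = All (λ C → SizesBelow (Z ι) (map proj₁ C)) Cs ×
               All (λ C → ∃[ u ] (prog (k ι) · encL encN (mset (q ι) C) ⇓ encBool (ok (k ι) C) [ u ]) × u ≤ τ ι) Cs
    C-len : FPT (σ ∘ ixᶜ) (λ (j : FoldCons {P = ⊤} (λ ι ys _ → Inv ι ys)) → length (hdᶜ j))
    C-len = lin-≤ (λ j → ≤-trans (≤-reflexive (sym (length-map proj₁ (hdᶜ j)))) (proj₁ (All.head (proj₁ (invᶜ j)))))
                  (re-lin ixᶜ (par→lin fZ))

colsR : ∀ {I : Set} {n} {σ : I → Scale} {τ : I → ℕ} {ρ : I → Vec Val n} {e₁ e₂ e₃}
        {q Z : I → ℕ} {ks : I → List Kind} {Cs : I → List (List Tok)} →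
        Runs σ τ ρ e₁ (encU ∘ q) → Runs σ τ ρ e₂ (encL encKind ∘ ks) →
        Runs σ τ ρ e₃ (encL (encL encTok) ∘ Cs) →
        Par σ q → Par σ (length ∘ ks) → Par σ (length ∘ Cs) → Par σ Z →
        (∀ ι → All (λ C → SizesBelow (Z ι) (map proj₁ C)) (Cs ι)) →
        (∀ ι → All (KindOK (q ι) (Z ι) (τ ι) (Cs ι)) (ks ι)) →
        Runs σ τ ρ (colsT e₁ e₂ e₃) (λ ι → encL (encL encTok) (cols (Cs ι) (ks ι)))
colsR {q = q} {Z} {ks} {Cs} rq rk rC fq fk fC fZ Cs≤ K =
  unpairR (consR rq (consR rk rC)) (unpairR varR
    (foldrR (λ ι → All (KindOK (q ι) (Z ι) _ (Cs ι))) (λ ι ks → encL (encL encTok) (cols (Cs ι) ks))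
      varR (Par→Iter fk) K (λ _ _ _ → All.tail) nilR
      -- `appR′` is a rule for τ = 0, so the part that calls predicates is evaluated first and bound
      -- by a `let`.
      (letR (kindColsR varR varR (re-par ixᶜ fq) (re-par ixᶜ fC) (re-par ixᶜ fZ) (Cs≤ ∘ ixᶜ)
              (λ j → All.head (invᶜ j)) varR)
        (liftR (appR′ varR varR (lin-≤ (λ j → kindCols-length (hdᶜ j) (Cs (ixᶜ j)))
          (re-lin ixᶜ (par→lin fC))))))))

-- The dynamic program

Res : Set
Res = List (Tok × ℕ)

codeRes : Code Res
codeRes = codeList (codePair codeTok codeU)

State : Set
State = Res × List Col

encCols : List Col → Val
encCols = encL (encL encTok)

encState : State → Val
encState = encPair (enc codeRes) encCols

cnt : Tok → List Tok → ℕ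
cnt = count codeTok

start : List Tok → List Tok → Res
start b = map (λ τ → τ , cnt τ b)

-- Truncated subtraction and rounded halving hide whether the demand covers the choice and has its
-- parity. Both hold exactly if `recomb` undoes `next`, and this is the test made by `attempt`.
next recomb : List Tok → Res → Res
next a   = map (λ (τ , c) → τ , ⌊ c ∸ cnt τ a /2⌋)
recomb a = map (λ (τ , c) → τ , cnt τ a + (c + c))

zeros : Res → Res
zeros = map (λ (τ , c) → τ , 0)

-- Makes 2 ^ k copies: the digit chosen at level k has this weight.
dbl : {A : Set} → ℕ → List A → List A
dbl zero    xs = xs
dbl (suc k) xs = dbl k xs ++ dbl k xs

length-dbl : ∀ {A : Set} k (xs : List A) → length (dbl k xs) ≡ 2 ^ k * length xs
length-dbl zero    xs = sym (+-identityʳ _)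
length-dbl (suc k) xs = trans (length-++ (dbl k xs)) (trans (cong₂ _+_ (length-dbl k xs) (length-dbl k xs))
  (lem (2 ^ k) (length xs)))
  where
  lem : ∀ x y → x * y + x * y ≡ 2 * x * y
  lem = solve-∀

-- States with equal residuals have the same continuations, so one partial solution per residual is
-- enough.
insert : State → List State → List State
insert s S = if isZero (count codeRes (proj₁ s) (map proj₁ S)) then s ∷ S else S

attempt : ℕ → State → List Col → List State → List State
attempt k (r , sol) ε S =
  if _==_ codeRes r (recomb (concat ε) (next (concat ε) r))
  then insert (next (concat ε) r , dbl k ε ++ sol) S else S

expand : ℕ → List (List Col) → State → List State → List State
expand k E s S = foldr (attempt k s) S E

level : ℕ → List (List Col) → List State → List State
level k E = foldr (expand k E) []

loop : List (List Col) → List State → ℕ → List State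
loop E S zero    = S
loop E S (suc k) = level k E (loop E S k)

search : List State → List (List Col)
search []            = []
search ((r , s) ∷ S) = if _==_ codeRes r (zeros r) then s ∷ [] else search S

startT nextT recombT : ∀ {n} → Term n → Term n → Term n
startT b toks = case (cons toks b) nil (foldrT v0 nil (cons (cons v1 (countT v1 v8)) v0))

-- The fold carries the pair of the rounded half and the parity.
halfT : ∀ {n} → Term n → Term n
halfT e = case (foldrT e (cons nil nil)
  (case v0 nil (case v1 (cons v0 tick) (cons (cons tick v2) nil)))) nil v0

nextT a r = case (cons r a) nil (foldrT v0 nil
  (case v1 nil (cons (cons v0 (halfT (monusT v1 (countT v0 v10)))) v2)))
recombT a r = case (cons r a) nil (foldrT v0 nil
  (case v1 nil (cons (cons v0 (appT (countT v0 v10) (appT v1 v1))) v2)))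

zerosT : ∀ {n} → Term n → Term n
zerosT r = foldrT r nil (cons (case v1 nil (cons v0 nil)) v0)

dblT : ∀ {n} → Term n → Term n → Term n
dblT k xs = case (cons xs k) nil (foldrT v1 v4 (appT v0 v0))

attemptT : ∀ {n} → Term n → Term n → Term n → Term n → Term n
attemptT k s ε S = case (cons s (cons ε (cons k S))) nil (case v1 nil (case v1 nil
  (case v4 nil (let′ (concatT v4) (let′ (nextT v0 v1)
    (case (eqT v2 (recombT v1 v0)) v5
      (case (isNilT (countT v2 (fstsT v7))) v7
        (cons (cons v4 (appT (dblT v8 v10) v7)) v9))))))))

levelT : ∀ {n} → Term n → Term n → Term n → Term n
levelT k E S = case (cons k (cons E S)) nil (case v1 nil
  (foldrT v1 nil (foldrT v7 v4 (attemptT v16 v8 v1 v0))))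

loopT : ∀ {n} → Term n → Term n → Term n → Term n
loopT k E S = case (cons k (cons E S)) nil (case v1 nil (foldrT v2 v5 (levelT v2 v7 v0)))

searchT : ∀ {n} → Term n → Term n
searchT S = foldrT S nil (case v1 nil (case (eqT v0 (zerosT v0)) v2 (cons v3 nil)))

EntryOK : ℕ → Tok × ℕ → Set
EntryOK Z (τ , c) = size (encTok τ) ≤ Z × c ≤ Z

ResOK : ℕ → Res → Set
ResOK Z r = length r ≤ Z × All (EntryOK Z) r

size-encU : ∀ k → size (encU k) ≡ 1 + 4 * k
size-encU zero    = refl
size-encU (suc k) = trans (cong (4 +_) (size-encU k)) (lem k)
  where
  lem : ∀ k → 4 + (1 + 4 * k) ≡ 1 + 4 * suc k
  lem = solve-∀

-- An entry takes two `cons` nodes, a token of size at most Z and a unary number of size at most 1 +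
-- 4 * Z.
sizeBound : ℕ → ℕ
sizeBound Z = suc (Z * (3 + (Z + 4 * Z)))

size-res : ∀ {Z r} → ResOK Z r → size (enc codeRes r) ≤ sizeBound Z
size-res {Z} {r} (l , p) = ≤-trans (go p) (s≤s (*-monoˡ-≤ (3 + (Z + 4 * Z)) l))
  where
  lem : ∀ a b c → 1 + (1 + a + (1 + b)) + suc c ≡ suc (3 + (a + b) + c)
  lem = solve-∀
  go : ∀ {r} → All (EntryOK Z) r → size (enc codeRes r) ≤ suc (length r * (3 + (Z + 4 * Z)))
  go [] = ≤-refl
  go {(τ , c) ∷ r} ((a , b) ∷ ps) = ≤-trans
    (s≤s (+-mono-≤ (s≤s (+-mono-≤ a (≤-trans (≤-reflexive (size-encU c)) (s≤s (*-monoʳ-≤ 4 b))))) (go ps)))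
    (≤-reflexive (lem Z (4 * Z) (length r * (3 + (Z + 4 * Z)))))

next-ok : ∀ {Z} a {r} → ResOK Z r → ResOK Z (next a r)
next-ok a {r} (l , p) = ≤-trans (≤-reflexive (length-map _ r)) l ,
  All.map⁺ (All.map (λ {(τ , c)} (u , v) → u , ≤-trans (⌊n/2⌋≤n (c ∸ cnt τ a)) (≤-trans (m∸n≤m c (cnt τ a)) v)) p)

sizeBound-fpt : ∀ {I : Set} {σ : I → Scale} {Z} → FPT σ Z → FPT σ (sizeBound ∘ Z)
sizeBound-fpt f = lin-suc (fpt-* f (lin-+ (lin-const 3) (lin-+ f (fpt-* (lin-const 4) f))))

isOdd : ℕ → Bool
isOdd zero    = false
isOdd (suc k) = not (isOdd k)

half-suc : ∀ k → ⌊ suc k /2⌋ ≡ (if isOdd k then suc ⌊ k /2⌋ else ⌊ k /2⌋)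
half-suc zero          = refl
half-suc (suc zero)    = refl
half-suc (suc (suc k)) with isOdd k | half-suc k
... | true  | e = cong suc e
... | false | e = cong suc e

module _ {I : Set} {n : ℕ} {σ : I → Scale} {ρ : I → Vec Val n} where

  startR : ∀ {e e′} {b toks : I → List Tok} {Z : I → ℕ} →
           Runs₀ σ ρ e (encL encTok ∘ b) → Runs₀ σ ρ e′ (encL encTok ∘ toks) →
           FPT σ (length ∘ b) → FPT σ (length ∘ toks) → FPT σ Z →
           (∀ ι → All (λ τ → size (encTok τ) ≤ Z ι) (toks ι)) →
           Runs₀ σ ρ (startT e e′) (λ ι → enc codeRes (start (b ι) (toks ι)))
  startR {b = b} {Z = Z} r r′ fb ft fZ all = unpairR (consR r′ r)
    (foldrR (λ ι → All (λ τ → size (encTok τ) ≤ Z ι)) (λ ι toks → enc codeRes (start (b ι) toks))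
      varR (FPT→Iter ft) all (λ _ _ _ → All.tail) nilR
      (consR (consR varR (countR codeTok {xs = b ∘ ixᶜ} varR varR
        (lin-≤ (λ j → All.head (invᶜ j)) (re-lin ixᶜ fZ)) (re-lin ixᶜ fb))) varR))

  halfR : ∀ {e k} → Runs₀ σ ρ e (encU ∘ k) → FPT σ k → Runs₀ σ ρ (halfT e) (λ ι → encU ⌊ k ι /2⌋)
  halfR {k = k} r f = unpairR
    (foldUR always (λ ι m → cons (encU ⌊ m /2⌋) (encBool (isOdd m))) r f _ _ (consR nilR nilR)
      (unpairR varR (castR (λ j → eq (numˢ j))
        (iteR id {b = isOdd ∘ numˢ} {x = λ j → cons (encU (suc ⌊ numˢ j /2⌋)) nil} {y = λ j → cons (encU ⌊ numˢ j /2⌋) tickV}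
          varR (consR (consR tickR varR) nilR) (consR varR tickR)))))
    varR
    where
    eq : ∀ m → (if isOdd m then cons (encU (suc ⌊ m /2⌋)) nil else cons (encU ⌊ m /2⌋) tickV) ≡
               cons (encU ⌊ suc m /2⌋) (encBool (not (isOdd m)))
    eq m rewrite half-suc m with isOdd m
    ... | true  = refl
    ... | false = refl

  zerosR : ∀ {e r} → Runs₀ σ ρ e (enc codeRes ∘ r) → FPT σ (length ∘ r) →
           Runs₀ σ ρ (zerosT e) (λ ι → enc codeRes (zeros (r ι)))
  zerosR re f = foldrR always (λ ι r → enc codeRes (zeros r)) re (FPT→Iter f) _ _ nilR
    (consR (unpairR varR (consR varR nilR)) varR)

  dblR : ∀ {A B : Set} {encA : A → Val} {encB : B → Val} {e e′} {k : I → List A} {xs : I → List B} {Z : I → ℕ} →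
         Runs₀ σ ρ e (encL encA ∘ k) → Runs₀ σ ρ e′ (encL encB ∘ xs) → FPT σ Z →
         (∀ ι → length (k ι) ≤ Z ι) → (∀ ι → 2 ^ length (k ι) * length (xs ι) ≤ Z ι) →
         Runs₀ σ ρ (dblT e e′) (λ ι → encL encB (dbl (length (k ι)) (xs ι)))
  dblR {encB = encB} {k = k} {xs} r r′ f lk ld = unpairR (consR r′ r)
    (foldrR (λ ι ys → length ys ≤ length (k ι)) (λ ι ys → encL encB (dbl (length ys) (xs ι)))
      varR (FPT→Iter (lin-≤ lk f)) (λ ι → ≤-refl) (λ _ _ _ → <⇒≤) varR
      (appR′ varR varR (lin-≤ (λ j → ≤-trans (≤-reflexive (length-dbl (length (tlᶜ j)) (xs (ixᶜ j))))
        (≤-trans (*-monoˡ-≤ (length (xs (ixᶜ j))) (^-monoʳ-≤ 2 (<⇒≤ (invᶜ j)))) (ld (ixᶜ j)))) (re-lin ixᶜ f))))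

module _ {I : Set} {n : ℕ} {σ : I → Scale} {ρ : I → Vec Val n} {e e′ : Term n}
         {a : I → List Tok} {r : I → Res} {Z : I → ℕ}
         (ra : Runs₀ σ ρ e (encL encTok ∘ a)) (rr : Runs₀ σ ρ e′ (enc codeRes ∘ r))
         (fa : FPT σ (length ∘ a)) (fZ : FPT σ Z) (ok : ∀ ι → ResOK (Z ι) (r ι)) where

  private
    Inv : I → Res → Set
    Inv ι = All (EntryOK (Z ι))

    J : Set
    J = FoldCons {P = ⊤} (λ ι ys _ → Inv ι ys)

    tokF : FPT (σ ∘ ixᶜ) (λ (j : J) → size (encTok (proj₁ (hdᶜ j))))
    tokF = lin-≤ (λ j → proj₁ (All.head (invᶜ j))) (re-lin ixᶜ fZ)

    cF : FPT (σ ∘ ixᶜ) (λ (j : J) → proj₂ (hdᶜ j))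
    cF = lin-≤ (λ j → proj₂ (All.head (invᶜ j))) (re-lin ixᶜ fZ)

    aF : FPT (σ ∘ ixᶜ) (λ (j : J) → cnt (proj₁ (hdᶜ j)) (a (ixᶜ j)))
    aF = lin-≤ (λ j → count≤length codeTok (proj₁ (hdᶜ j)) (a (ixᶜ j))) (re-lin ixᶜ fa)

  nextR : Runs₀ σ ρ (nextT e e′) (λ ι → enc codeRes (next (a ι) (r ι)))
  nextR = unpairR (consR rr ra)
    (foldrR Inv (λ ι r → enc codeRes (next (a ι) r)) varR (FPT→Iter (lin-≤ (proj₁ ∘ ok) fZ)) (proj₂ ∘ ok)
      (λ _ _ _ → All.tail) nilR
      (unpairR varR (consR (consR varR
        (halfR (monusR varR (countR codeTok {xs = a ∘ ixᶜ} varR varR tokF (re-lin ixᶜ fa)) aF)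
               (lin-≤ (λ j → m∸n≤m (proj₂ (hdᶜ j)) (cnt (proj₁ (hdᶜ j)) (a (ixᶜ j)))) cF))) varR)))

  recombR : Runs₀ σ ρ (recombT e e′) (λ ι → enc codeRes (recomb (a ι) (r ι)))
  recombR = unpairR (consR rr ra)
    (foldrR Inv (λ ι r → enc codeRes (recomb (a ι) r)) varR (FPT→Iter (lin-≤ (proj₁ ∘ ok) fZ)) (proj₂ ∘ ok)
      (λ _ _ _ → All.tail) nilR
      (unpairR varR (consR (consR varR
        (addR (countR codeTok {xs = a ∘ ixᶜ} varR varR tokF (re-lin ixᶜ fa)) (addR varR varR cF) aF)) varR)))

ChoiceOK : ℕ → List Col → Set
ChoiceOK Z ε = length ε ≤ Z × All (λ c → length c ≤ Z) ε

attemptR : ∀ {I A : Set} {encA : A → Val} {n} {σ : I → Scale} {ρ : I → Vec Val n} {e₁ e₂ e₃ e₄}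
           {k : I → List A} {s : I → State} {ε : I → List Col} {S : I → List State} {Z : I → ℕ} →
           Runs₀ σ ρ e₁ (encL encA ∘ k) → Runs₀ σ ρ e₂ (encState ∘ s) →
           Runs₀ σ ρ e₃ (encCols ∘ ε) → Runs₀ σ ρ e₄ (encL encState ∘ S) →
           FPT σ Z → (∀ ι → length (k ι) ≤ Z ι) → (∀ ι → 2 ^ length (k ι) ≤ Z ι) →
           (∀ ι → ResOK (Z ι) (proj₁ (s ι))) → (∀ ι → ChoiceOK (Z ι) (ε ι)) →
           FPT σ (length ∘ S) →
           Runs₀ σ ρ (attemptT e₁ e₂ e₃ e₄) (λ ι → encL encState (attempt (length (k ι)) (s ι) (ε ι) (S ι)))
attemptR {σ = σ} {k = k} {s} {ε} {S} {Z} r₁ r₂ r₃ r₄ fZ lk l2 so εo fS =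
  unpairR (consR r₂ (consR r₃ (consR r₁ r₄))) (unpairR varR (unpairR varR (unpairR varR
    (letR (concatR {xss = ε} varR (lin-≤ (proj₁ ∘ εo) fZ) fZ (proj₂ ∘ εo))
    (letR (nextR {a = concat ∘ ε} {r = proj₁ ∘ s} varR varR fa fZ so)
    (iteR (encL encState)
      (eqR codeRes {x = proj₁ ∘ s} varR (recombR {a = concat ∘ ε} {r = r′} varR varR fa fZ ro)
        (lin-≤ (size-res ∘ so) (sizeBound-fpt fZ)))
      (iteR (encL encState)
        (isZeroR (countR codeRes {a = r′} varR (fstsR {xs = S} varR fS)
          (lin-≤ (size-res ∘ ro) (sizeBound-fpt fZ))
          (lin-≤ (λ ι → ≤-reflexive (length-map proj₁ (S ι))) fS)))
        (consR (consR varR (appR′ (dblR {k = k} {xs = ε} {Z = λ ι → Z ι + Z ι * Z ι} varR varR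
            (lin-+ fZ (fpt-* fZ fZ)) (λ ι → ≤-trans (lk ι) (m≤m+n _ _)) (λ ι → ≤-trans (d≤ ι) (m≤n+m _ _)))
          varR (lin-≤ (λ ι → ≤-trans (≤-reflexive (length-dbl (length (k ι)) (ε ι))) (d≤ ι)) (fpt-* fZ fZ)))) varR)
        varR)
      varR))))))
  where
  d≤ : ∀ ι → 2 ^ length (k ι) * length (ε ι) ≤ Z ι * Z ι
  d≤ ι = *-mono-≤ (l2 ι) (proj₁ (εo ι))
  r′ : _ → Res
  r′ ι = next (concat (ε ι)) (proj₁ (s ι))
  ro : ∀ ι → ResOK (Z ι) (r′ ι)
  ro ι = next-ok (concat (ε ι)) (so ι)
  fa : FPT σ (λ ι → length (concat (ε ι)))
  fa = lin-≤ (λ ι → ≤-trans (length-concat≤ (proj₂ (εo ι))) (*-monoˡ-≤ (Z ι) (proj₁ (εo ι)))) (fpt-* fZ fZ)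

attempt-length : ∀ k s ε S → length (attempt k s ε S) ≤ suc (length S)
attempt-length k (r , sol) ε S with _==_ codeRes r (recomb (concat ε) (next (concat ε) r))
... | false = n≤1+n _
... | true with isZero (count codeRes (next (concat ε) r) (map proj₁ S))
...   | true  = ≤-refl
...   | false = n≤1+n _

expand-length : ∀ k E s S → length (expand k E s S) ≤ length E + length S
expand-length k []      s S = ≤-refl
expand-length k (ε ∷ E) s S = ≤-trans (attempt-length k s ε (expand k E s S)) (s≤s (expand-length k E s S))

level-length : ∀ k E S → length (level k E S) ≤ length S * length E
level-length k E []      = z≤n
level-length k E (s ∷ S) = ≤-trans (expand-length k E s (level k E S)) (+-monoʳ-≤ (length E) (level-length k E S))

StatesOK : ℕ → List State → Set
StatesOK Z S = length S ≤ Z × All (λ s → ResOK Z (proj₁ s)) S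

ChoicesOK : ℕ → List (List Col) → Set
ChoicesOK Z E = length E ≤ Z × All (ChoiceOK Z) E

levelR : ∀ {I A : Set} {encA : A → Val} {n} {σ : I → Scale} {ρ : I → Vec Val n} {e₁ e₂ e₃}
         {k : I → List A} {E : I → List (List Col)} {S : I → List State} {Z : I → ℕ} →
         Runs₀ σ ρ e₁ (encL encA ∘ k) → Runs₀ σ ρ e₂ (encL encCols ∘ E) →
         Runs₀ σ ρ e₃ (encL encState ∘ S) →
         FPT σ Z → (∀ ι → length (k ι) ≤ Z ι) → (∀ ι → 2 ^ length (k ι) ≤ Z ι) →
         (∀ ι → StatesOK (Z ι) (S ι)) → (∀ ι → ChoicesOK (Z ι) (E ι)) →
         Runs₀ σ ρ (levelT e₁ e₂ e₃) (λ ι → encL encState (level (length (k ι)) (E ι) (S ι)))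
levelR {I} {σ = σ} {k = k} {E} {S} {Z} r₁ r₂ r₃ fZ lk l2 So Eo =
  unpairR (consR r₁ (consR r₂ r₃)) (unpairR varR
    (foldrR Inv (λ ι S → encL encState (level (length (k ι)) (E ι) S)) varR
      (FPT→Iter (lin-≤ (proj₁ ∘ So) fZ)) So (λ { ι x ys (l , p) → <⇒≤ l , All.tail p }) nilR
      (foldrR {xs = E ∘ ixᶜ} Inv₂
        (λ j E′ → encL encState (expand (length (k (ixᶜ j))) E′ (hdᶜ j) (level (length (k (ixᶜ j))) (E (ixᶜ j)) (tlᶜ j))))
        varR (FPT→Iter (lin-≤ (proj₁ ∘ Eo ∘ ixᶜ) (re-lin ixᶜ fZ))) (Eo ∘ ixᶜ)
        (λ { j x ys (l , p) → <⇒≤ l , All.tail p }) varR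
        (attemptR {k = k ∘ ixᶜ ∘ ixᶜ} {s = hdᶜ ∘ ixᶜ} varR varR varR varR (re-lin (ixᶜ ∘ ixᶜ) fZ)
          (lk ∘ ixᶜ ∘ ixᶜ) (l2 ∘ ixᶜ ∘ ixᶜ) (λ j → All.head (proj₂ (invᶜ (ixᶜ j)))) (λ j → All.head (proj₂ (invᶜ j)))
          (lin-≤ acc≤ (re-lin (ixᶜ ∘ ixᶜ) (lin-+ fZ (fpt-* fZ fZ))))))))
  where
  Inv : I → List State → Set
  Inv ι = StatesOK (Z ι)
  J : Set
  J = FoldCons {P = ⊤} (λ ι ys _ → Inv ι ys)
  Inv₂ : J → List (List Col) → Set
  Inv₂ j = ChoicesOK (Z (ixᶜ j))
  -- At most Z states come from the state being expanded and at most Z * Z from those expanded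
  -- before it.
  acc≤ : ∀ (j : FoldCons {P = ⊤} (λ ι ys _ → Inv₂ ι ys)) → let i = ixᶜ (ixᶜ j) in
         length (expand (length (k i)) (tlᶜ j) (hdᶜ (ixᶜ j)) (level (length (k i)) (E i) (tlᶜ (ixᶜ j))))
         ≤ Z i + Z i * Z i
  acc≤ j = ≤-trans (expand-length (length (k i)) (tlᶜ j) (hdᶜ (ixᶜ j)) (level (length (k i)) (E i) (tlᶜ (ixᶜ j))))
    (+-mono-≤ (<⇒≤ (proj₁ (invᶜ j)))
      (≤-trans (level-length (length (k i)) (E i) (tlᶜ (ixᶜ j)))
        (*-mono-≤ (<⇒≤ (proj₁ (invᶜ (ixᶜ j)))) (proj₁ (Eo i)))))
    where i = ixᶜ (ixᶜ j)

-- The loop runs along a list k, and the tail left in a round serves as the number of its level, so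
-- no separate counter is kept.
loopR : ∀ {I A : Set} {encA : A → Val} {n} {σ : I → Scale} {ρ : I → Vec Val n} {e₁ e₂ e₃}
        {k : I → List A} {E : I → List (List Col)} {S : I → List State} {Z : I → ℕ} →
        Runs₀ σ ρ e₁ (encL encA ∘ k) → Runs₀ σ ρ e₂ (encL encCols ∘ E) →
        Runs₀ σ ρ e₃ (encL encState ∘ S) →
        FPT σ Z → (∀ ι → length (k ι) ≤ Z ι) → (∀ ι → 2 ^ length (k ι) ≤ Z ι) →
        (∀ ι i → StatesOK (Z ι) (loop (E ι) (S ι) i)) → (∀ ι → ChoicesOK (Z ι) (E ι)) →
        Runs₀ σ ρ (loopT e₁ e₂ e₃) (λ ι → encL encState (loop (E ι) (S ι) (length (k ι))))
loopR {k = k} {E} {S} r₁ r₂ r₃ fZ lk l2 So Eo =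
  unpairR (consR r₁ (consR r₂ r₃)) (unpairR varR
    (foldrR (λ ι ys → length ys ≤ length (k ι)) (λ ι ys → encL encState (loop (E ι) (S ι) (length ys)))
      varR (FPT→Iter (lin-≤ lk fZ)) (λ ι → ≤-refl) (λ _ _ _ → <⇒≤) varR
      (levelR {k = tlᶜ} {E = E ∘ ixᶜ} varR varR varR (re-lin ixᶜ fZ)
        (λ j → ≤-trans (<⇒≤ (invᶜ j)) (lk (ixᶜ j)))
        (λ j → ≤-trans (^-monoʳ-≤ 2 (<⇒≤ (invᶜ j))) (l2 (ixᶜ j)))
        (λ j → So (ixᶜ j) (length (tlᶜ j))) (Eo ∘ ixᶜ))))

searchR : ∀ {I : Set} {n} {σ : I → Scale} {ρ : I → Vec Val n} {e} {S : I → List State} {Z : I → ℕ} →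
          Runs₀ σ ρ e (encL encState ∘ S) → FPT σ Z → (∀ ι → StatesOK (Z ι) (S ι)) →
          Runs₀ σ ρ (searchT e) (λ ι → encL encCols (search (S ι)))
searchR {Z = Z} r fZ ok = foldrR (λ ι → All (λ s → ResOK (Z ι) (proj₁ s))) (λ ι S → encL encCols (search S)) r
  (FPT→Iter (lin-≤ (proj₁ ∘ ok) fZ)) (proj₂ ∘ ok) (λ _ _ _ → All.tail) nilR
  (unpairR varR (iteR (encL encCols)
    (eqR codeRes varR (zerosR varR (lin-≤ (λ j → proj₁ (All.head (invᶜ j))) (re-lin ixᶜ fZ)))
      (lin-≤ (λ j → size-res (All.head (invᶜ j))) (sizeBound-fpt (re-lin ixᶜ fZ))))
    (consR varR nilR) varR))

-- From columns to an assignment of the items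

Index : Set
Index = ℕ × ℕ

encIndex : Index → Val
encIndex = encPair encN encN

Supply : Set
Supply = List (Tok × Index)

encSupply : Supply → Val
encSupply = encL (encPair encTok encIndex)

tag : Index → List Tok → Supply
tag v = map (λ x → x , v)

-- The j-th bin of its kind gets the index j by counting the bins of that
-- kind that come after it.
supply : List Col → Supply
supply []             = []
supply ([] ∷ cs)      = supply cs
supply ((k ∷ C) ∷ cs) = tag (proj₂ k , cnt k (concat cs)) C ++ supply cs

look : Tok → Supply → Index
look u []            = 0 , 0
look u ((x , v) ∷ s) = if _==_ codeTok u x then v else look u s

remove : Tok → Supply → Supply
remove u []            = []
remove u ((x , v) ∷ s) = if _==_ codeTok u x then s else (x , v) ∷ remove u s

assign : List Tok → Supply → List Index
assign []       s = []
assign (u ∷ us) s = look u s ∷ assign us (remove u s)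

tagT lookT removeT assignT : ∀ {n} → Term n → Term n → Term n
tagT v C = case (cons v C) nil (foldrT v1 nil (cons (cons v1 v7) v0))
lookT u s = case (cons u s) nil (foldrT v1 tick (case v1 nil (case (eqT v9 v0) v2 v3)))
removeT u s = case (cons u s) nil (foldrT v1 nil (case v1 nil (case (eqT v9 v0) (cons v3 v2) v6)))
assignT us s = foldT us s nil (removeT v0 v3) (cons (lookT v1 v4) v0)

supplyT : ∀ {n} → Term n → Term n
supplyT cs = foldrT cs nil (case v1 v0
  (appT (tagT (cons (case v0 nil v1) (binT (countT v0 (concatT v4)))) v1) v2))

remove-length : ∀ u s → length (remove u s) ≤ length s
remove-length u []            = z≤n
remove-length u ((x , v) ∷ s) with _==_ codeTok u x
... | true  = n≤1+n _
... | false = s≤s (remove-length u s)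

encN-0 : encN 0 ≡ nil
encN-0 = trans (encN-digits 0) (cong (encL encBool) digits-0)

TokOK : ℕ → Tok → Set
TokOK Z x = size (encTok x) ≤ Z

SolOK : ℕ → List Col → Set
SolOK Z cs = length cs ≤ Z × All (λ c → length c ≤ Z × All (TokOK Z) c) cs

module _ {I : Set} {n : ℕ} {σ : I → Scale} {ρ : I → Vec Val n} where

  tagR : ∀ {e e′} {v : I → Index} {C : I → List Tok} →
         Runs₀ σ ρ e (encIndex ∘ v) → Runs₀ σ ρ e′ (encL encTok ∘ C) → FPT σ (length ∘ C) →
         Runs₀ σ ρ (tagT e e′) (λ ι → encSupply (tag (v ι) (C ι)))
  tagR {v = v} r r′ f = unpairR (consR r r′)
    (foldrR always (λ ι C → encSupply (tag (v ι) C)) varR (FPT→Iter f) _ _ nilR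
      (consR (consR varR varR) varR))

  lookR : ∀ {e e′} {u : I → Tok} {s : I → Supply} →
          Runs₀ σ ρ e (encTok ∘ u) → Runs₀ σ ρ e′ (encSupply ∘ s) →
          FPT σ (λ ι → size (encTok (u ι))) → FPT σ (length ∘ s) →
          Runs₀ σ ρ (lookT e e′) (λ ι → encIndex (look (u ι) (s ι)))
  lookR {u = u} r r′ fu fs = unpairR (consR r r′)
    (foldrR always (λ ι s → encIndex (look (u ι) s)) varR (FPT→Iter fs) _ _
      -- The term `tick` evaluates to the code of the default pair (0 , 0).
      (castR (λ ι → cong (λ z → cons z z) (sym encN-0)) tickR)
      (unpairR varR (iteR encIndex (eqR codeTok {x = u ∘ ixᶜ} varR varR (re-lin ixᶜ fu)) varR varR)))

  removeR : ∀ {e e′} {u : I → Tok} {s : I → Supply} →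
            Runs₀ σ ρ e (encTok ∘ u) → Runs₀ σ ρ e′ (encSupply ∘ s) →
            FPT σ (λ ι → size (encTok (u ι))) → FPT σ (length ∘ s) →
            Runs₀ σ ρ (removeT e e′) (λ ι → encSupply (remove (u ι) (s ι)))
  removeR {u = u} r r′ fu fs = unpairR (consR r r′)
    (foldrR always (λ ι s → encSupply (remove (u ι) s)) varR (FPT→Iter fs) _ _ nilR
      (unpairR varR (iteR encSupply (eqR codeTok {x = u ∘ ixᶜ} varR varR (re-lin ixᶜ fu)) varR (consR varR varR))))

assignR : ∀ {I : Set} {n} {σ : I → Scale} {ρ : I → Vec Val n} {e e′} {us : I → List Tok} {s : I → Supply} {Z : I → ℕ} →
          Runs₀ σ ρ e (encL encTok ∘ us) → Runs₀ σ ρ e′ (encSupply ∘ s) →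
          FPT σ (length ∘ us) → FPT σ (length ∘ s) → FPT σ Z → (∀ ι → All (TokOK (Z ι)) (us ι)) →
          Runs₀ σ ρ (assignT e e′) (λ ι → encL encIndex (assign (us ι) (s ι)))
assignR {I} {us = us} {s} {Z} r r′ fu fs fZ all =
  foldR {encP = encSupply} Inv (λ _ u _ s → remove u s) (λ _ us s → encL encIndex (assign us s)) r r′ (FPT→Iter fu)
    (λ ι → ≤-refl , all ι)
    (λ { ι u us s (l , p) → ≤-trans (remove-length u s) l , All.tail p }) nilR
    (removeR {s = pmᶜ} varR varR fh fp)
    (consR (lookR {s = pmᶜ} varR varR fh fp) varR)
  where
  Inv : I → List Tok → Supply → Set
  Inv ι us s′ = length s′ ≤ length (s ι) × All (TokOK (Z ι)) us
  fh : FPT _ (λ (j : FoldCons Inv) → size (encTok (hdᶜ j)))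
  fh = lin-≤ (λ j → All.head (proj₂ (invᶜ j))) (re-lin ixᶜ fZ)
  fp : FPT _ (λ (j : FoldCons Inv) → length (pmᶜ j))
  fp = lin-≤ (λ j → proj₁ (invᶜ j)) (re-lin ixᶜ fs)

supplyR : ∀ {I : Set} {n} {σ : I → Scale} {ρ : I → Vec Val n} {e} {cs : I → List Col} {Z : I → ℕ} →
          Runs₀ σ ρ e (encCols ∘ cs) → FPT σ Z → (∀ ι → SolOK (Z ι) (cs ι)) →
          Runs₀ σ ρ (supplyT e) (λ ι → encSupply (supply (cs ι)))
supplyR {I} {σ = σ} {cs = cs} {Z} r fZ ok =
  foldrR Inv (λ ι cs → encSupply (supply cs)) r (FPT→Iter (lin-≤ (proj₁ ∘ ok) fZ)) ok
    (λ { _ _ _ (l , p) → <⇒≤ l , All.tail p }) nilR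
    (caseListR {xs = hdᶜ} (λ j c → encSupply (supply (c ∷ tlᶜ j))) varR varR
      (appR′ (tagR {v = λ j → proj₂ (ConsCase.hd j) , cnt (ConsCase.hd j) (concat (tlᶜ (ConsCase.ix j)))}
          (consR (unpairR varR varR)
            (binR (countR codeTok {a = ConsCase.hd} {xs = concat ∘ tlᶜ ∘ ConsCase.ix} varR
                (concatR {xss = tlᶜ ∘ ConsCase.ix} {Z = Z ∘ ixᶜ ∘ ConsCase.ix} varR
                  (lin-≤ (λ j → <⇒≤ (proj₁ (invᶜ (ConsCase.ix j)))) fZ′) fZ′ lens)
                (lin-≤ (λ j → All.head (proj₂ (hd-ok j))) fZ′) fc)
              (lin-≤ (λ j → count≤length codeTok (ConsCase.hd j) (concat (tlᶜ (ConsCase.ix j)))) fc)))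
          varR C-len)
        varR (lin-≤ (λ j → ≤-reflexive (length-map _ (ConsCase.tl j))) C-len)))
  where
  Inv : I → List Col → Set
  Inv ι cs = SolOK (Z ι) cs
  K : Set
  K = ConsCase (hdᶜ {P = ⊤} {Inv = λ ι ys _ → Inv ι ys})
  fZ′ : FPT (σ ∘ ixᶜ ∘ ConsCase.ix) (λ (j : K) → Z (ixᶜ (ConsCase.ix j)))
  fZ′ = re-lin (ixᶜ ∘ ConsCase.ix) fZ
  hd-ok : ∀ (j : K) → length (ConsCase.hd j ∷ ConsCase.tl j) ≤ Z (ixᶜ (ConsCase.ix j)) ×
                      All (TokOK (Z (ixᶜ (ConsCase.ix j)))) (ConsCase.hd j ∷ ConsCase.tl j)
  hd-ok j = subst (λ c → length c ≤ Z _ × All (TokOK (Z _)) c) (ConsCase.eq j)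
                  (All.head (proj₂ (invᶜ (ConsCase.ix j))))
  lens : ∀ (j : K) → All (λ c → length c ≤ Z (ixᶜ (ConsCase.ix j))) (tlᶜ (ConsCase.ix j))
  lens j = All.map proj₁ (All.tail (proj₂ (invᶜ (ConsCase.ix j))))
  fc : FPT (σ ∘ ixᶜ ∘ ConsCase.ix) (λ (j : K) → length (concat (tlᶜ (ConsCase.ix j))))
  fc = lin-≤ (λ j → ≤-trans (length-concat≤ (lens j)) (*-monoˡ-≤ _ (<⇒≤ (proj₁ (invᶜ (ConsCase.ix j))))))
         (fpt-* fZ′ fZ′)
  C-len : FPT (σ ∘ ixᶜ ∘ ConsCase.ix) (λ (j : K) → length (ConsCase.tl j))
  C-len = lin-≤ (λ j → <⇒≤ (proj₁ (hd-ok j))) fZ′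

lenT : ∀ {n} → Term n → Term n
lenT l = foldrT l nil (cons tick v0)

lenR : ∀ {I A : Set} {enc : A → Val} {n} {σ : I → Scale} {ρ : I → Vec Val n} {e} {xs : I → List A} →
       Runs₀ σ ρ e (encL enc ∘ xs) → FPT σ (length ∘ xs) → Runs₀ σ ρ (lenT e) (λ ι → encU (length (xs ι)))
lenR r f = foldrR always (λ ι xs → encU (length xs)) r (FPT→Iter f) _ _ nilR (consR tickR varR)

-- If the columns used are nonempty, no multiplicity exceeds the length of b. One round more than
-- this length has bijective digits then shifts every multiplicity to 0.
solve : List Tok → List Tok → List Col → List (List Col)
solve b toks cs = search (loop (subs cs) ((start b toks , []) ∷ []) (suc (length (digits (length b)))))

solveT : ∀ {n} → Term n → Term n → Term n → Term n
solveT b toks cs = case (cons b (cons toks cs)) nil (case v1 nil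
  -- The extra cell in front of the digits provides the additional round.
  (searchT (loopT (cons nil (binT (lenT v2))) (subsT v1) (cons (cons (startT v2 v0) nil) nil))))

-- L bijective digits denote at least 2 ^ L - 1. Hence the copies made by `dbl` are only
-- polynomially many.
2^digits : ∀ k → 2 ^ length (digits k) ≤ suc k
2^digits k = subst (λ v → 2 ^ length (digits k) ≤ suc v) (bval-digits k) (go (digits k))
  where
  dd : ∀ x → suc x + suc x ≡ suc (suc (x + x))
  dd x = cong suc (+-suc x x)
  go : ∀ bs → 2 ^ length bs ≤ suc (bval bs)
  go []           = ≤-refl
  go (true ∷ bs)  = ≤-trans (+-mono-≤ (go bs) (≤-trans (≤-reflexive (+-identityʳ _)) (go bs))) (≤-reflexive (dd _))
  go (false ∷ bs) = ≤-trans (+-mono-≤ (go bs) (≤-trans (≤-reflexive (+-identityʳ _)) (go bs)))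
                            (≤-trans (≤-reflexive (dd _)) (n≤1+n _))

solveR : ∀ {I : Set} {n} {σ : I → Scale} {ρ : I → Vec Val n} {e₁ e₂ e₃}
         {b toks : I → List Tok} {cs : I → List Col} {Z : I → ℕ} →
         Runs₀ σ ρ e₁ (encL encTok ∘ b) → Runs₀ σ ρ e₂ (encL encTok ∘ toks) → Runs₀ σ ρ e₃ (encCols ∘ cs) →
         FPT σ Z → Par σ (length ∘ cs) →
         (∀ ι → length (b ι) ≤ Z ι) → (∀ ι → length (toks ι) ≤ Z ι) → (∀ ι → All (TokOK (Z ι)) (toks ι)) →
         (∀ ι → 2 * suc (length (b ι)) ≤ Z ι) →
         (∀ ι i → StatesOK (Z ι) (loop (subs (cs ι)) ((start (b ι) (toks ι) , []) ∷ []) i)) →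
         (∀ ι → ChoicesOK (Z ι) (subs (cs ι))) →
         Runs₀ σ ρ (solveT e₁ e₂ e₃) (λ ι → encL encCols (solve (b ι) (toks ι) (cs ι)))
solveR {σ = σ} {b = b} {toks} {cs} {Z} r₁ r₂ r₃ fZ fc lb lt at b2 So Eo =
  unpairR (consR r₁ (consR r₂ r₃)) (unpairR varR
    (searchR {S = λ ι → loop (subs (cs ι)) ((start (b ι) (toks ι) , []) ∷ []) (suc (length (digits (length (b ι)))))}
      (loopR {k = λ ι → false ∷ digits (length (b ι))} {S = λ ι → (start (b ι) (toks ι) , []) ∷ []}
        (consR nilR (castR (λ ι → encN-digits (length (b ι))) (binR (lenR {xs = b} varR fb) fb)))
        (subsR varR fc)
        (consR (consR (startR {b = b} {toks = toks} varR varR fb (lin-≤ lt fZ) fZ at) nilR) nilR)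
        fZ
        (λ ι → ≤-trans (s≤s (length-digits (length (b ι)))) (≤-trans (m≤m+n _ _) (b2 ι)))
        (λ ι → ≤-trans (*-monoʳ-≤ 2 (2^digits (length (b ι)))) (b2 ι))
        So Eo)
      fZ (λ ι → So ι (suc (length (digits (length (b ι))))))))
  where
  fb : FPT σ (length ∘ b)
  fb = lin-≤ lb fZ

-- The complete program and its running time

record Raw : Set where
  field
    q     : ℕ
    caps  : List (List ℕ)
    avs   : List ℕ
    progs : List Val
    sizes : List (List ℕ)
    fps   : List ℕ

encRaw : Raw → Val
encRaw r = cons (encN q) (cons (encL (encL encN) caps) (cons (encL encN avs)
  (cons (encL id progs) (cons (encL (encL encN) sizes) (encL encN fps)))))
  where open Raw r

sumFirst : List (List ℕ) → ℕ
sumFirst []      = 0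
sumFirst (c ∷ _) = sum c

slots : ℕ → List Kind → List Tok
slots n []       = []
slots n (k ∷ ks) = replicate (n ⊓ av k) (kindTok k) ++ slots n ks

RawKind : Set
RawKind = List ℕ × ℕ × Val × ℕ

encRawKind : RawKind → Val
encRawKind = encPair (encL encN) (encPair encN (encPair id encN))

rawKind : Kind → RawKind
rawKind k = cap k , av k , prog k , idx k

rawKinds : Raw → List RawKind
rawKinds r = zip caps (zip avs (zip progs (upTo (length caps))))
  where open Raw r

encKinds : ∀ ks → encL encRawKind (map rawKind ks) ≡ encL encKind ks
encKinds []       = refl
encKinds (k ∷ ks) = cong (cons (encKind k)) (encKinds ks)

module Spec (r : Raw) (ks : List Kind) where
  open Raw r

  items : List Tok
  items = zip sizes fps

  choices : List (List Tok)
  choices = subs (keep codeTok (sumFirst caps) items)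

  columns : List Col
  columns = cols choices ks

  demand : List Tok
  demand = items ++ slots (suc (length items)) ks

  -- All kinds are listed, also those without available bins: they may have columns, and the demand
  -- 0 for their bins has to be enforced.
  toks : List Tok
  toks = keep codeTok 1 (items ++ map kindTok ks)

  sols : List (List Col)
  sols = solve demand toks columns

  answer : List (List Col) → Val
  answer []        = nil
  answer (sol ∷ _) = cons (encL encIndex (assign items (supply sol))) nil

sumT sumFirstT kindToksT : ∀ {n} → Term n → Term n
sumT l = foldrT l nil (appT (toUT v1) v0)
sumFirstT l = case l nil (sumT v0)
kindToksT l = foldrT l nil (case v1 nil (case v1 nil (case v1 nil (cons (cons nil v1) v6))))

slotsT : ∀ {n} → Term n → Term n → Term n
slotsT n l = case (cons n l) nil (foldrT v1 nil (case v1 nil (case v1 nil (case v1 nil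
  (appT (repT (capT v13 v2) (cons nil v1)) v6)))))

mainT : Term 1
mainT = case v0 nil (case v1 nil (case v1 nil (case v1 nil (case v1 nil
  (let′ (zipT v0 v1)
  (let′ (zipT v7 (zipT v5 (zipT v3 (natsT (lenT v7)))))
  (let′ (subsT (keepT (sumFirstT v8) v1))
  (let′ (colsT (toUT v11) v1 v0)
  (let′ (appT v3 (slotsT (cons tick (lenT v3)) v2))
  (let′ (keepT (cons tick nil) (appT v4 (kindToksT v3)))
  (case (solveT v1 v0 v2) nil (cons (assignT v7 (supplyT v0)) nil))))))))))))

module _ {I : Set} {n : ℕ} {σ : I → Scale} {ρ : I → Vec Val n} where

  kindToksR : ∀ {e ks} → Runs₀ σ ρ e (encL encKind ∘ ks) → FPT σ (length ∘ ks) →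
              Runs₀ σ ρ (kindToksT e) (λ ι → encL encTok (map kindTok (ks ι)))
  kindToksR r f = foldrR always (λ ι ks → encL encTok (map kindTok ks)) r (FPT→Iter f) _ _ nilR
    (unpairR varR (unpairR varR (unpairR varR (consR (consR nilR varR) varR))))

  slotsR : ∀ {e e′ ks} {m Z : I → ℕ} → Runs₀ σ ρ e (encU ∘ m) → Runs₀ σ ρ e′ (encL encKind ∘ ks) →
           FPT σ (length ∘ ks) → FPT σ m → FPT σ Z →
           (∀ ι → All (λ k → length (digits (av k)) ≤ Z ι) (ks ι)) →
           Runs₀ σ ρ (slotsT e e′) (λ ι → encL encTok (slots (m ι) (ks ι)))
  slotsR {m = m} {Z} r r′ f fm fZ all = unpairR (consR r r′)
    (foldrR (λ ι → All (λ k → length (digits (av k)) ≤ Z ι)) (λ ι ks → encL encTok (slots (m ι) ks))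
      varR (FPT→Iter f) all (λ _ _ _ → All.tail) nilR
      (unpairR varR (unpairR varR (unpairR varR
        (appR′ {xs = λ j → replicate (m (ixᶜ j) ⊓ av (hdᶜ j)) (kindTok (hdᶜ j))}
          (repR {enc = encTok} {k = λ j → m (ixᶜ j) ⊓ av (hdᶜ j)} {x = λ j → kindTok (hdᶜ j)}
            (capR {m = m ∘ ixᶜ} {k = λ j → av (hdᶜ j)} varR varR (re-lin ixᶜ fm)
              (lin-≤ (λ j → All.head (invᶜ j)) (re-lin ixᶜ fZ)))
            (consR nilR varR)
            (lin-≤ (λ j → m⊓n≤m (m (ixᶜ j)) _) (re-lin ixᶜ fm)))
          varR
          (lin-≤ (λ j → ≤-trans (≤-reflexive (length-replicate (m (ixᶜ j) ⊓ av (hdᶜ j)))) (m⊓n≤m (m (ixᶜ j)) _)) (re-lin ixᶜ fm)))))))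

  sumR : ∀ {e} {l : I → List ℕ} {Z : I → ℕ} → Runs₀ σ ρ e (encL encN ∘ l) → FPT σ (length ∘ l) → FPT σ Z →
         (∀ ι → All (_≤ Z ι) (l ι)) → Runs₀ σ ρ (sumT e) (λ ι → encU (sum (l ι)))
  sumR {Z = Z} r f fZ all = foldrR (λ ι → All (_≤ Z ι)) (λ ι l → encU (sum l)) r (FPT→Iter f) all
    (λ _ _ _ → All.tail) nilR (addR (toUR varR h) varR h)
    where
    h : FPT (σ ∘ ixᶜ) (λ (j : FoldCons {P = ⊤} (λ ι ys _ → All (_≤ Z ι) ys)) → hdᶜ j)
    h = lin-≤ (λ j → All.head (invᶜ j)) (re-lin ixᶜ fZ)

sumFirstR : ∀ {I : Set} {n} {σ : I → Scale} {ρ : I → Vec Val n} {e} {l : I → List (List ℕ)} {Z : I → ℕ} →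
            Runs₀ σ ρ e (encL (encL encN) ∘ l) → FPT σ Z →
            (∀ ι → All (λ c → length c ≤ Z ι × All (_≤ Z ι) c) (l ι)) →
            Runs₀ σ ρ (sumFirstT e) (λ ι → encU (sumFirst (l ι)))
sumFirstR {Z = Z} r fZ all = caseListR (λ ι l → encU (sumFirst l)) r nilR
  (sumR {l = ConsCase.hd} varR (lin-≤ (λ j → proj₁ (hd-ok j)) (re-lin ConsCase.ix fZ)) (re-lin ConsCase.ix fZ) (λ j → proj₂ (hd-ok j)))
  where
  hd-ok : ∀ (j : ConsCase _) → length (ConsCase.hd j) ≤ Z (ConsCase.ix j) × All (_≤ Z (ConsCase.ix j)) (ConsCase.hd j)
  hd-ok j = All.head (subst (All _) (ConsCase.eq j) (all (ConsCase.ix j)))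

-- P bounds quantities that depend on the parameter only, Z the others; t
-- is the time of a call of a predicate.
record Bounded (P Z t : ℕ) (r : Raw) (ks : List Kind) : Set where
  open Raw r
  open Spec r ks
  field
    kinds≡     : map rawKind ks ≡ rawKinds r
    q≤         : q ≤ P
    ks≤        : length ks ≤ P
    caps≤      : length caps ≤ P
    caps-ok    : All (λ c → length c ≤ P × All (_≤ P) c) caps
    sumFirst≤  : sumFirst caps ≤ P
    kept≤      : length (keep codeTok (sumFirst caps) items) ≤ P
    choices-ok : All (λ C → SizesBelow P (map proj₁ C)) choices
    kinds-ok   : All (KindOK q P t choices) ks
    avs≤       : length avs ≤ Z
    progs≤     : length progs ≤ Z
    sizes≤     : length sizes ≤ Z
    items≤     : length items ≤ Z
    items-ok   : All (TokOK Z) items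
    kinds-tok  : All (TokOK Z) (map kindTok ks)
    av-digits  : All (λ k → length (digits (av k)) ≤ Z) ks
    demand≤    : 2 * suc (length demand) ≤ Z
    states-ok  : ∀ i → StatesOK Z (loop (subs columns) ((start demand toks , []) ∷ []) i)
    subs-ok    : ChoicesOK Z (subs columns)
    sol-ok     : ∀ {sol rest} → sols ≡ sol ∷ rest → SolOK Z sol

cols-length : ∀ Cs ks → length (cols Cs ks) ≤ length ks * length Cs
cols-length Cs []       = z≤n
cols-length Cs (k ∷ ks) = ≤-trans (≤-reflexive (length-++ (kindCols k Cs)))
  (+-mono-≤ (kindCols-length k Cs) (cols-length Cs ks))

keep-all : ∀ {A} (C : Code A) {Q : A → Set} N {xs} → All Q xs → All Q (keep C N xs)
keep-all C N [] = []
keep-all C N {x ∷ xs} (p ∷ ps) with isZero (N ∸ count C x (keep C N xs))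
... | true  = keep-all C N ps
... | false = p ∷ keep-all C N ps

supply-length : ∀ {Z} cs → All (λ c → length c ≤ Z) cs → length (supply cs) ≤ length cs * Z
supply-length []             []       = z≤n
supply-length ([] ∷ cs)      (p ∷ ps) = ≤-trans (supply-length cs ps) (m≤n+m _ _)
supply-length ((k ∷ C) ∷ cs) (p ∷ ps) = ≤-trans (≤-reflexive (trans (length-++ (tag _ C)) (cong (_+ _) (length-map _ C))))
  (+-mono-≤ (<⇒≤ p) (supply-length cs ps))

module _ {I : Set} {σ : I → Scale} {τ : I → ℕ} {raw : I → Raw} {ks : I → List Kind} {P Z : I → ℕ}
         (fP : Par σ P) (fZ : FPT σ Z)
         (ok : ∀ ι → Bounded (P ι) (Z ι) (τ ι) (raw ι) (ks ι)) where

  private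
    module B ι = Bounded (ok ι)
    module S ι = Spec (raw ι) (ks ι)
    module W ι = Raw (raw ι)

    fPZ : FPT σ P
    fPZ = par→lin fP

    f-items : FPT σ (λ ι → length (S.items ι))
    f-items = lin-≤ B.items≤ fZ

    f-ks : FPT σ (λ ι → length (ks ι))
    f-ks = lin-≤ B.ks≤ fPZ

    f-choices : Par σ (λ ι → length (S.choices ι))
    f-choices = par-≤ (λ ι → ≤-trans (≤-reflexive (length-subs (keep codeTok (sumFirst (W.caps ι)) (S.items ι))))
      (^-monoʳ-≤ 2 (B.kept≤ ι))) (par-2^ fP)

    f-columns : Par σ (λ ι → length (S.columns ι))
    f-columns = par-≤ (λ ι → cols-length (S.choices ι) (ks ι)) (par-* (par-≤ B.ks≤ fP) f-choices)

    all-toks : ∀ ι → All (TokOK (Z ι)) (S.items ι ++ map kindTok (ks ι))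
    all-toks ι = All.++⁺ (B.items-ok ι) (B.kinds-tok ι)

    f-all-toks : FPT σ (λ ι → length (S.items ι ++ map kindTok (ks ι)))
    f-all-toks = lin-≤ (λ ι → ≤-reflexive (trans (length-++ (S.items ι)) (cong (length (S.items ι) +_) (length-map kindTok (ks ι)))))
      (lin-+ f-items f-ks)

  mainR : Runs σ τ (λ ι → encRaw (raw ι) ∷ []) mainT (λ ι → S.answer ι (S.sols ι))
  mainR =
    unpairR varR (unpairR varR (unpairR varR (unpairR varR (unpairR varR
    (letR (liftR (zipR {xs = W.sizes} {ys = W.fps} varR varR (lin-≤ B.sizes≤ fZ)))
    -- The program zips the input lists; the result has the same code as the list of kinds because
    -- `ok` is not encoded.
    (letR (castR (λ ι → trans (cong (encL encRawKind) (sym (B.kinds≡ ι))) (encKinds (ks ι)))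
            (liftR (zipR {xs = W.caps} varR (zipR {xs = W.avs} varR (zipR {xs = W.progs} varR
              (natsR (lenR {xs = W.caps} varR f-caps) f-caps) (lin-≤ B.progs≤ fZ)) (lin-≤ B.avs≤ fZ)) f-caps)))
    (letR (liftR (subsR {xs = λ ι → keep codeTok (sumFirst (W.caps ι)) (S.items ι)}
            (keepR codeTok {N = λ ι → sumFirst (W.caps ι)} {xs = S.items}
              (sumFirstR {l = W.caps} varR fPZ B.caps-ok) varR f-items fZ B.items-ok)
            (par-≤ B.kept≤ fP)))
    (letR (colsR {ks = ks} {Cs = S.choices} (liftR (toUR {k = W.q} varR (lin-≤ B.q≤ fPZ))) varR varR
            (par-≤ B.q≤ fP) (par-≤ B.ks≤ fP) f-choices fP B.choices-ok B.kinds-ok)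
    (letR (liftR (appR′ {xs = S.items} {ys = λ ι → slots (suc (length (S.items ι))) (ks ι)} varR
            (slotsR {ks = ks} {m = λ ι → suc (length (S.items ι))} (consR tickR (lenR {xs = S.items} varR f-items)) varR
              f-ks (lin-suc f-items) fZ B.av-digits) f-items))
    (letR (liftR (keepR codeTok {N = λ _ → 1} {xs = λ ι → S.items ι ++ map kindTok (ks ι)} (consR tickR nilR)
            (appR′ {xs = S.items} varR (kindToksR {ks = ks} varR f-ks) f-items) f-all-toks fZ all-toks))
    (liftR (caseListR {xs = S.sols} S.answer
      (solveR {b = S.demand} {toks = S.toks} {cs = S.columns} varR varR varR (lin-+ fZ (lin-+ f-all-toks fZ)) f-columns
        (λ ι → ≤-trans (n≤1+n _) (≤-trans (m≤m+n _ _) (b2 ι)))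
        (λ ι → ≤-trans (keep-length codeTok 1 (S.items ι ++ map kindTok (ks ι))) (≤-trans (m≤m+n _ _) (m≤n+m _ (Z ι))))
        (λ ι → All.map (λ p → ≤-trans p (m≤m+n _ _)) (keep-all codeTok 1 (all-toks ι)))
        b2
        (λ ι i → let l , a = B.states-ok ι i in ≤-trans l (m≤m+n _ _) ,
          All.map (λ { (u , v) → ≤-trans u (m≤m+n _ _) , All.map (λ { (x , y) → ≤-trans x (m≤m+n _ _) , ≤-trans y (m≤m+n _ _) }) v }) a)
        (λ ι → let l , a = B.subs-ok ι in ≤-trans l (m≤m+n _ _) ,
          All.map (λ { (u , v) → ≤-trans u (m≤m+n _ _) , All.map (λ x → ≤-trans x (m≤m+n _ _)) v }) a))
      nilR
      (consR (assignR {us = S.items ∘ ConsCase.ix} {s = supply ∘ ConsCase.hd} varR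
          (supplyR {cs = ConsCase.hd} varR fZ′ sol-ok)
          (re-lin ConsCase.ix f-items)
          (lin-≤ (λ j → let l , a = sol-ok j in ≤-trans (supply-length (ConsCase.hd j) (All.map proj₁ a)) (*-monoˡ-≤ _ l)) (fpt-* fZ′ fZ′))
          fZ′ (B.items-ok ∘ ConsCase.ix))
        nilR)))))))))))))
    where
    f-caps : FPT σ (λ ι → length (W.caps ι))
    f-caps = lin-≤ B.caps≤ fPZ
    b2 : ∀ ι → 2 * suc (length (S.demand ι)) ≤ Z ι + (length (S.items ι ++ map kindTok (ks ι)) + Z ι)
    b2 ι = ≤-trans (B.demand≤ ι) (m≤m+n _ _)
    fZ′ : FPT (σ ∘ ConsCase.ix) (λ (j : ConsCase S.sols) → Z (ConsCase.ix j))
    fZ′ = re-lin ConsCase.ix fZ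
    sol-ok : ∀ (j : ConsCase S.sols) → SolOK (Z (ConsCase.ix j)) (ConsCase.hd j)
    sol-ok j = B.sol-ok (ConsCase.ix j) (ConsCase.eq j)

-- Computability of the tower function

opaque
  unfolding encN

  -- In bijective binary 2 ^ k - 1 consists of k digits 1, so its code is the unary code of k. For
  -- this reason `E` is built from `ones`: one conversion to unary computes an exponential.
  encN-ones : ∀ k → encN (ones k) ≡ encU k
  encN-ones zero    = refl
  encN-ones (suc k) = trans (cong encℕᵇ eq) (cong (cons tickV) (encN-ones k))
    where
    eq : fromℕ (suc (2 * ones k)) ≡ 1+[2 fromℕ (ones k) ]
    eq = trans (cong (λ v → fromℕ (suc (2 * v))) (sym (toℕ-fromℕ (ones k))))
               (fromℕ-toℕ 1+[2 fromℕ (ones k) ])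

-- The three ticks realize the summand 3 in `E`.
towT : ∀ {n} → ℕ → Term n → Term n
towT zero    e = e
towT (suc h) e = cons tick (cons tick (cons tick (toUT (towT h e))))

tow-computable : ∀ h → Computable (tow h)
tow-computable h = towT h v0 , λ k →
  let open Runs (castR {v′ = λ _ → encℕ (tow h k)} (λ _ → encN≡encℕ (tow h k)) (towR h k))
  in time tt , eval tt
  where
  -- Computability asks for some terminating run only, so the family has one member and every number
  -- counts as a constant.
  towR : ∀ h k → Runs₀ {⊤} (λ _ → scale 0 0) (λ _ → encℕ k ∷ []) (towT h v0) (λ _ → encN (tow h k))
  towR zero    k = castR (λ _ → sym (encN≡encℕ k)) varR
  towR (suc h) k = castR (λ _ → sym (encN-ones (3 + tow h k)))
    (consR tickR (consR tickR (consR tickR (toUR {k = λ _ → tow h k} (towR h k) (lin-const (tow h k))))))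

-- Counting and permutations

module Counting {A : Set} (C : Code A) where

  _≐_ : A → A → Bool
  _≐_ = _==_ C

  #_ : A → List A → ℕ
  #_ = count C

  ==-case : ∀ x y → (x ≡ y × (x ≐ y) ≡ true) ⊎ (x ≢ y × (x ≐ y) ≡ false)
  ==-case x y with x ≐ y in eq
  ... | true  = inj₁ (==-sound C x y eq , refl)
  ... | false = inj₂ ((λ { refl → absurd (trans (sym eq) (==-refl C x)) }) , refl)
    where
    absurd : false ≡ true → ⊥
    absurd ()

  count-here : ∀ x xs → count C x (x ∷ xs) ≡ suc (count C x xs)
  count-here x xs rewrite ==-refl C x = refl

  count-there : ∀ {a x} xs → a ≢ x → count C a (x ∷ xs) ≡ count C a xs
  count-there {a} {x} xs a≢x with ==-case a x
  ... | inj₁ (e , _) = ⊥-elim (a≢x e)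
  ... | inj₂ (_ , e) rewrite e = refl

  count-∷ : ∀ a x xs → count C a xs ≤ count C a (x ∷ xs)
  count-∷ a x xs with a ≐ x
  ... | true  = n≤1+n _
  ... | false = ≤-refl

  count-++ : ∀ a xs ys → count C a (xs ++ ys) ≡ count C a xs + count C a ys
  count-++ a []       ys = refl
  count-++ a (x ∷ xs) ys with a ≐ x
  ... | true  = cong suc (count-++ a xs ys)
  ... | false = count-++ a xs ys

  count-↭ : ∀ a {xs ys} → xs ↭ ys → count C a xs ≡ count C a ys
  count-↭ a Perm.refl = refl
  count-↭ a (prep x p) with a ≐ x
  ... | true  = cong suc (count-↭ a p)
  ... | false = count-↭ a p
  count-↭ a (swap x y p) with a ≐ x | a ≐ y
  ... | true  | true  = cong (λ n → suc (suc n)) (count-↭ a p)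
  ... | true  | false = cong suc (count-↭ a p)
  ... | false | true  = cong suc (count-↭ a p)
  ... | false | false = count-↭ a p
  count-↭ a (Perm.trans p q) = trans (count-↭ a p) (count-↭ a q)

  ∈⇒count : ∀ {x xs} → x ∈ xs → 1 ≤ count C x xs
  ∈⇒count {x} {_ ∷ xs} (here refl) rewrite ==-refl C x = s≤s z≤n
  ∈⇒count {x} {y ∷ xs} (there p) = ≤-trans (∈⇒count p) (count-∷ x y xs)

  count⇒∈ : ∀ x xs → 1 ≤ count C x xs → x ∈ xs
  count⇒∈ x (y ∷ xs) p with x ≐ y in eq
  ... | true  = here (==-sound C x y eq)
  ... | false = there (count⇒∈ x xs p)

  pull-out : ∀ {x} {xs : List A} → x ∈ xs → ∃[ ys ] xs ↭ x ∷ ys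
  pull-out x∈xs with ys , zs , refl ← ∈-∃++ x∈xs = ys ++ zs , Perm.shift _ ys zs

  no-counts : ∀ xs → (∀ a → count C a xs ≡ 0) → xs ≡ []
  no-counts []       _ = refl
  no-counts (x ∷ xs) p with () ← trans (sym (count-here x xs)) (p x)

  counts⇒↭ : ∀ xs ys → (∀ a → count C a xs ≡ count C a ys) → xs ↭ ys
  counts⇒↭ [] ys p = ↭-reflexive (sym (no-counts ys (λ a → sym (p a))))
  counts⇒↭ (x ∷ xs) ys p
    with zs , q ← pull-out (count⇒∈ x ys (subst (1 ≤_) (p x) (∈⇒count {x} {x ∷ xs} (here refl)))) =
    ↭-trans (prep x (counts⇒↭ xs zs λ a → count-tail a {xs = xs} {zs} (trans (p a) (count-↭ a q)))) (↭-sym q)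
    where
    count-tail : ∀ a {x xs zs} → count C a (x ∷ xs) ≡ count C a (x ∷ zs) → count C a xs ≡ count C a zs
    count-tail a {x} e with a ≐ x
    ... | true  = suc-injective e
    ... | false = e

  -- Each element of R in turn takes an equal element out of D if there still is one; the bound on
  -- the counts ensures that D is used up. This turns the contents of a bin into a member of
  -- `choices`.
  sub-multiset : ∀ R D → (∀ a → count C a D ≤ count C a R) → ∃[ D′ ] D′ ∈ subs R × D′ ↭ D
  sub-multiset [] D p = [] , here refl , ↭-reflexive (sym (no-counts D (λ a → n≤0⇒n≡0 (p a))))
  sub-multiset (x ∷ R) D p with count C x D in eq
  ... | zero = let D′ , i , q = sub-multiset R D p′ in D′ , ∈-++⁺ʳ (map (x ∷_) (subs R)) i , q
    where
    p′ : ∀ a → count C a D ≤ count C a R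
    p′ a with ==-case a x
    ... | inj₁ (refl , _) = ≤-trans (≤-reflexive eq) z≤n
    ... | inj₂ (a≢x , _)  = ≤-trans (p a) (≤-reflexive (count-there R a≢x))
  ... | suc c with F , q ← pull-out (count⇒∈ x D (subst (1 ≤_) (sym eq) (s≤s z≤n))) =
    let D′ , i , q′ = sub-multiset R F p′
    in x ∷ D′ , ∈-++⁺ˡ (∈-map⁺ (x ∷_) i) , ↭-trans (prep x q′) (↭-sym q)
    where
    p′ : ∀ a → count C a F ≤ count C a R
    p′ a with a ≐ x | count-↭ a q | p a
    ... | true  | e | le = s≤s⁻¹ (subst (_≤ suc (count C a R)) e le)
    ... | false | e | le = subst (_≤ count C a R) e le

  -- An element is dropped only when N copies of it have been kept already, and then further copies
  -- do not change the minimum.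
  count-keep : ∀ N a xs → count C a (keep C N xs) ≡ count C a xs ⊓ N
  count-keep N a []       = refl
  count-keep N a (x ∷ xs) with isZero (N ∸ count C x (keep C N xs)) in full
  count-keep N a (x ∷ xs) | true with ==-case a x
  ... | inj₂ (_ , e)    rewrite e = count-keep N a xs
  ... | inj₁ (refl , e) rewrite e = trans (count-keep N x xs)
    (trans (m≥n⇒m⊓n≡n N≤) (sym (m≥n⇒m⊓n≡n (m≤n⇒m≤1+n N≤))))
    where
    N≤ : N ≤ count C x xs
    N≤ = ≤-trans (m∸n≡0⇒m≤n (isZero⇒≡0 full)) (≤-trans (≤-reflexive (count-keep N x xs)) (m⊓n≤m _ N))
      where
      isZero⇒≡0 : ∀ {k} → isZero k ≡ true → k ≡ 0
      isZero⇒≡0 {zero} _ = refl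
  count-keep N a (x ∷ xs) | false with ==-case a x
  ... | inj₂ (_ , e)    rewrite e = count-keep N a xs
  ... | inj₁ (refl , e) rewrite e = trans (cong suc (trans (count-keep N x xs) (m≤n⇒m⊓n≡m (<⇒≤ <N)))) (sym (m≤n⇒m⊓n≡m <N))
    where
    notFull : ∀ {k} → isZero k ≡ false → k ≢ 0
    notFull () refl
    <N : count C x xs < N
    <N with ≤-total N (count C x xs)
    ... | inj₁ N≤ = ⊥-elim (notFull full (m≤n⇒m∸n≡0 (≤-reflexive (sym (trans (count-keep N x xs) (m≥n⇒m⊓n≡n N≤))))))
    ... | inj₂ ≤N with m≤n⇒m<n∨m≡n ≤N
    ...   | inj₁ lt = lt
    ...   | inj₂ eq = ⊥-elim (notFull full (m≤n⇒m∸n≡0 (≤-reflexive (sym (trans (count-keep N x xs) (trans (cong (_⊓ N) eq) (⊓-idem N)))))))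

  -- Double counting of the pairs of an entry of L and an equal entry of xs: every entry of xs has a
  -- partner in L, and every entry of L has at most N partners.
  pigeonhole : ∀ N (L xs : List A) → All (_∈ L) xs → (∀ a → count C a xs ≤ N) →
               length xs ≤ length L * N
  pigeonhole N L xs i p = ≤-trans (total xs i) (capped L)
    where
    S : List A → List A → ℕ
    S L xs = sum (map (λ a → count C a xs) L)
    grow : ∀ {x} L xs → S L xs ≤ S L (x ∷ xs)
    grow []      xs = z≤n
    grow {x} (a ∷ L) xs = +-mono-≤ (count-∷ a x xs) (grow L xs)
    hit : ∀ {x L} xs → x ∈ L → suc (S L xs) ≤ S L (x ∷ xs)
    hit {x} {_ ∷ L} xs (here refl) = +-mono-≤ (≤-reflexive (sym (count-here x xs))) (grow L xs)
    hit {x} {a ∷ L} xs (there j) = ≤-trans (≤-reflexive (sym (+-suc _ _))) (+-mono-≤ (count-∷ a x xs) (hit xs j))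
    total : ∀ xs → All (_∈ L) xs → length xs ≤ S L xs
    total []       []       = z≤n
    total (x ∷ xs) (j ∷ js) = ≤-trans (s≤s (total xs js)) (hit xs j)
    capped : ∀ L → S L xs ≤ length L * N
    capped []      = z≤n
    capped (a ∷ L) = +-mono-≤ (p a) (capped L)

consEach : {A : Set} → List A → List (List A) → List (List A)
consEach []       yss = []
consEach (x ∷ xs) yss = map (x ∷_) yss ++ consEach xs yss

-- The Cartesian product of the lists.
picks : {A : Set} → List (List A) → List (List A)
picks []         = [] ∷ []
picks (xs ∷ xss) = consEach xs (picks xss)

length-consEach : ∀ {A : Set} (xs : List A) yss → length (consEach xs yss) ≡ length xs * length yss
length-consEach []       yss = refl
length-consEach (x ∷ xs) yss =
  trans (length-++ (map (x ∷_) yss)) (cong₂ _+_ (length-map (x ∷_) yss) (length-consEach xs yss))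

length-picks : ∀ {A : Set} {w} (xss : List (List A)) → All (λ xs → length xs ≤ w) xss →
               length (picks xss) ≤ w ^ length xss
length-picks []         []       = ≤-refl
length-picks (xs ∷ xss) (p ∷ ps) =
  ≤-trans (≤-reflexive (length-consEach xs (picks xss))) (*-mono-≤ p (length-picks xss ps))

∈-consEach : ∀ {A : Set} {x : A} {xs ys yss} → x ∈ xs → ys ∈ yss → x ∷ ys ∈ consEach xs yss
∈-consEach {x = x} (here refl) j = ∈-++⁺ˡ (∈-map⁺ (x ∷_) j)
∈-consEach {xs = x ∷ _} {yss = yss} (there i) j = ∈-++⁺ʳ (map (x ∷_) yss) (∈-consEach i j)

open Counting codeTok using (count-++; count-↭; counts⇒↭; count-keep; ∈⇒count; count⇒∈; count-here; count-there; ==-case; sub-multiset)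

-- Correctness of the dynamic program

subs-∈ : ∀ {A : Set} {ys} (xs : List A) → ys ∈ subs xs → All (_∈ xs) ys
subs-∈ []       (here refl) = []
subs-∈ (x ∷ xs) i with ∈-++⁻ (map (x ∷_) (subs xs)) i
... | inj₂ j = All.map there (subs-∈ xs j)
... | inj₁ j with ys , k , refl ← ∈-map⁻ (x ∷_) j = here refl ∷ All.map there (subs-∈ xs k)

[]∈subs : ∀ {A : Set} (xs : List A) → [] ∈ subs xs
[]∈subs []       = here refl
[]∈subs (x ∷ xs) = ∈-++⁺ʳ (map (x ∷_) (subs xs)) ([]∈subs xs)

cnt-concat-++ : ∀ τ (xs ys : List Col) → cnt τ (concat (xs ++ ys)) ≡ cnt τ (concat xs) + cnt τ (concat ys)
cnt-concat-++ τ []       ys = refl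
cnt-concat-++ τ (x ∷ xs) ys = trans (count-++ τ x (concat (xs ++ ys)))
  (trans (cong (cnt τ x +_) (cnt-concat-++ τ xs ys))
  (trans (sym (+-assoc (cnt τ x) _ _)) (cong (_+ cnt τ (concat ys)) (sym (count-++ τ x (concat xs))))))

cnt-concat-dbl : ∀ τ k (xs : List Col) → cnt τ (concat (dbl k xs)) ≡ 2 ^ k * cnt τ (concat xs)
cnt-concat-dbl τ zero    xs = sym (+-identityʳ _)
cnt-concat-dbl τ (suc k) xs = trans (cnt-concat-++ τ (dbl k xs) (dbl k xs))
  (trans (cong₂ _+_ (cnt-concat-dbl τ k xs) (cnt-concat-dbl τ k xs)) (lem (2 ^ k) _))
  where
  lem : ∀ x y → x * y + x * y ≡ 2 * x * y
  lem = solve-∀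

cnt-subs : ∀ τ {ε} (cs : List Col) → ε ∈ subs cs → cnt τ (concat ε) ≤ cnt τ (concat cs)
cnt-subs τ [] (here refl) = ≤-refl
cnt-subs τ (c ∷ cs) i with ∈-++⁻ (map (c ∷_) (subs cs)) i
... | inj₂ j = ≤-trans (cnt-subs τ cs j) (≤-trans (m≤n+m _ (cnt τ c)) (≤-reflexive (sym (count-++ τ c (concat cs)))))
... | inj₁ j with ys , k , refl ← ∈-map⁻ (c ∷_) j = begin
  cnt τ (c ++ concat ys)         ≡⟨ count-++ τ c (concat ys) ⟩
  cnt τ c + cnt τ (concat ys)    ≤⟨ +-monoʳ-≤ (cnt τ c) (cnt-subs τ cs k) ⟩
  cnt τ c + cnt τ (concat cs)    ≡⟨ count-++ τ c (concat cs) ⟨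
  cnt τ (c ++ concat cs)         ∎
  where open ≤-Reasoning

All-dbl : ∀ {A : Set} {Q : A → Set} k {xs} → All Q xs → All Q (dbl k xs)
All-dbl zero    p = p
All-dbl (suc k) p = All.++⁺ (All-dbl k p) (All-dbl k p)

double-half : ∀ a m → ⌊ (a + (m + m)) ∸ a /2⌋ ≡ m
double-half a m = trans (cong ⌊_/2⌋ (m+n∸m≡n a (m + m))) (sym (n≡⌊n+n/2⌋ m))

module DP (b toks : List Tok) (cs : List Col) where

  resOf : (Tok → ℕ) → Res
  resOf f = map (λ τ → τ , f τ) toks

  resOf-cong : ∀ {f g} → (∀ τ → f τ ≡ g τ) → resOf f ≡ resOf g
  resOf-cong e = map-cong (λ τ → cong (τ ,_) (e τ)) toks

  resOf-inj : ∀ {f g} → resOf f ≡ resOf g → ∀ {τ} → τ ∈ toks → f τ ≡ g τ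
  resOf-inj {f} {g} = go toks
    where
    go : ∀ ts → map (λ τ → τ , f τ) ts ≡ map (λ τ → τ , g τ) ts → ∀ {τ} → τ ∈ ts → f τ ≡ g τ
    go (t ∷ ts) e (here refl) = cong (λ { ((_ , x) ∷ _) → x ; [] → 0 }) e
    go (t ∷ ts) e (there i)   = go ts (cong (drop 1) e) i

  next-resOf : ∀ a f → next a (resOf f) ≡ resOf (λ τ → ⌊ f τ ∸ cnt τ a /2⌋)
  next-resOf a f = sym (map-∘ toks)

  recomb-resOf : ∀ a f → recomb a (resOf f) ≡ resOf (λ τ → cnt τ a + (f τ + f τ))
  recomb-resOf a f = sym (map-∘ toks)

  Es : List (List Col)
  Es = subs cs

  S₀ : List State
  S₀ = (start b toks , []) ∷ []

  W : ℕ
  W = length (concat cs)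

  -- The levels below k have total weight 2 ^ k - 1, whence the bounds on the partial solution. The
  -- balance `total` is known for the tracked tokens; `solve-sound` extends it to all others.
  record StateInv (k : ℕ) (s : State) : Set where
    field
      f       : Tok → ℕ
      res≡    : proj₁ s ≡ resOf f
      total   : ∀ {τ} → τ ∈ toks → cnt τ b ≡ 2 ^ k * f τ + cnt τ (concat (proj₂ s))
      sol∈    : All (_∈ cs) (proj₂ s)
      sol-len : length (proj₂ s) ≤ 2 ^ k * length cs
      sol-cnt : ∀ τ → cnt τ (concat (proj₂ s)) ≤ 2 ^ k * W

  record LevelInv (k : ℕ) (S : List State) : Set where
    field
      states   : All (StateInv k) S
      distinct : ∀ r → count codeRes r (map proj₁ S) ≤ 1

  insert-distinct : ∀ s S → (∀ r → count codeRes r (map proj₁ S) ≤ 1) →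
                    ∀ r → count codeRes r (map proj₁ (insert s S)) ≤ 1
  insert-distinct (r₀ , sol) S d r with count codeRes r₀ (map proj₁ S) in eq
  ... | suc _ = d r
  ... | zero with Counting.==-case codeRes r r₀
  ...   | inj₁ (refl , e) rewrite e | eq = ≤-refl
  ...   | inj₂ (_ , e)    rewrite e = d r

  insert-states : ∀ {k s S} → StateInv k s → All (StateInv k) S → All (StateInv k) (insert s S)
  insert-states {s = s} {S} i is with isZero (count codeRes (proj₁ s) (map proj₁ S))
  ... | true  = i ∷ is
  ... | false = is

  -- The accepted test makes subtraction and halving exact. The 2 ^ k new copies of the choice are
  -- therefore precisely the difference between the old residual times 2 ^ k and the new one times 2
  -- ^ (k + 1).
  step-inv : ∀ k {r sol ε} → StateInv k (r , sol) → ε ∈ Es →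
             r ≡ recomb (concat ε) (next (concat ε) r) →
             StateInv (suc k) (next (concat ε) r , dbl k ε ++ sol)
  step-inv k {r} {sol} {ε} inv ε∈ e = record
    { f       = f′
    ; res≡    = trans (cong (next a) res≡) (next-resOf a f)
    ; total   = λ {τ} i → begin
        cnt τ b                                                  ≡⟨ total i ⟩
        2 ^ k * f τ + cnt τ (concat sol)                         ≡⟨ cong (λ x → 2 ^ k * x + cnt τ (concat sol)) (f≡ i) ⟩
        2 ^ k * (cnt τ a + (f′ τ + f′ τ)) + cnt τ (concat sol)   ≡⟨ lem (2 ^ k) (cnt τ a) (f′ τ) (cnt τ (concat sol)) ⟩
        2 * 2 ^ k * f′ τ + (2 ^ k * cnt τ a + cnt τ (concat sol)) ≡⟨ cong (2 * 2 ^ k * f′ τ +_) (sym (new τ)) ⟩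
        2 * 2 ^ k * f′ τ + cnt τ (concat (dbl k ε ++ sol))       ∎
    ; sol∈    = All.++⁺ (All-dbl k (subs-∈ cs ε∈)) sol∈
    ; sol-len = ≤-trans (≤-reflexive (trans (length-++ (dbl k ε)) (cong (_+ length sol) (length-dbl k ε))))
        (≤-trans (+-mono-≤ (*-monoʳ-≤ (2 ^ k) (All.lookup (subs-length cs) ε∈)) sol-len)
          (≤-reflexive (two (2 ^ k) (length cs))))
    ; sol-cnt = λ τ → ≤-trans (≤-reflexive (new τ))
        (≤-trans (+-mono-≤ (*-monoʳ-≤ (2 ^ k) (≤-trans (cnt-subs τ cs ε∈) (count≤length codeTok τ (concat cs)))) (sol-cnt τ))
          (≤-reflexive (two (2 ^ k) W)))
    }
    where
    open StateInv inv
    open ≡-Reasoning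
    a = concat ε
    f′ : Tok → ℕ
    f′ τ = ⌊ f τ ∸ cnt τ a /2⌋
    f≡ : ∀ {τ} → τ ∈ toks → f τ ≡ cnt τ a + (f′ τ + f′ τ)
    f≡ = resOf-inj (trans (sym res≡) (trans e (trans (cong (recomb a) (trans (cong (next a) res≡) (next-resOf a f))) (recomb-resOf a f′))))
    new : ∀ τ → cnt τ (concat (dbl k ε ++ sol)) ≡ 2 ^ k * cnt τ a + cnt τ (concat sol)
    new τ = trans (cnt-concat-++ τ (dbl k ε) sol) (cong (_+ cnt τ (concat sol)) (cnt-concat-dbl τ k ε))
    lem : ∀ p a f s → p * (a + (f + f)) + s ≡ 2 * p * f + (p * a + s)
    lem = solve-∀
    two : ∀ p x → p * x + p * x ≡ 2 * p * x
    two = solve-∀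

  attempt-inv : ∀ k s ε S → StateInv k s → ε ∈ Es → LevelInv (suc k) S → LevelInv (suc k) (attempt k s ε S)
  attempt-inv k (r , sol) ε S i ε∈ L with _==_ codeRes r (recomb (concat ε) (next (concat ε) r)) in eq
  ... | false = L
  ... | true  = record
    { states   = insert-states (step-inv k i ε∈ (==-sound codeRes r _ eq)) (LevelInv.states L)
    ; distinct = insert-distinct (next (concat ε) r , dbl k ε ++ sol) S (LevelInv.distinct L)
    }

  expand-inv : ∀ k E′ s S → All (_∈ Es) E′ → StateInv k s → LevelInv (suc k) S → LevelInv (suc k) (expand k E′ s S)
  expand-inv k []       s S []       i L = L
  expand-inv k (ε ∷ E′) s S (j ∷ js) i L = attempt-inv k s ε _ i j (expand-inv k E′ s S js i L)

  level-inv : ∀ k S → All (StateInv k) S → LevelInv (suc k) (level k Es S)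
  level-inv k []      []       = record { states = [] ; distinct = λ _ → z≤n }
  level-inv k (s ∷ S) (i ∷ is) = expand-inv k Es s (level k Es S) (All.tabulate id) i (level-inv k S is)

  loop-inv : ∀ k → LevelInv k (loop Es S₀ k)
  loop-inv zero = record
    { states = record { f = λ τ → cnt τ b ; res≡ = refl ; total = λ _ → lem _
                      ; sol∈ = [] ; sol-len = z≤n ; sol-cnt = λ _ → z≤n } ∷ []
    ; distinct = one
    }
    where
    lem : ∀ x → x ≡ 1 * x + 0
    lem = solve-∀
    one : ∀ r → count codeRes r (start b toks ∷ []) ≤ 1
    one r with _==_ codeRes r (start b toks)
    ... | true  = ≤-refl
    ... | false = z≤n
  loop-inv (suc k) = level-inv k (loop Es S₀ k) (LevelInv.states (loop-inv k))

  box : ℕ → List Res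
  box k = picks (map (λ τ → map (λ e → τ , _/_ (cnt τ b) (2 ^ k) {{m^n≢0 2 k}} ∸ e) (upTo (suc W))) toks)

  -- The balance gives 2 ^ k * f ≤ b ≤ 2 ^ k * (f + W) for the counts of each token. Division by 2 ^
  -- k leaves f between B - W and B, where B is the rounded quotient, so f is B - e for some e ≤ W.
  ∈-box : ∀ k {s} → StateInv k s → proj₁ s ∈ box k
  ∈-box k {s} inv rewrite StateInv.res≡ inv = go toks id
    where
    open StateInv inv
    instance _ = m^n≢0 2 k
    choice : Tok → List (Tok × ℕ)
    choice τ = map (λ e → τ , cnt τ b / 2 ^ k ∸ e) (upTo (suc W))
    entry : ∀ {τ} → τ ∈ toks → (τ , f τ) ∈ choice τ
    entry {τ} i = subst (λ x → (τ , x) ∈ choice τ) (m∸[m∸n]≡n f≤B)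
      (∈-map⁺ (λ e → τ , cnt τ b / 2 ^ k ∸ e) (∈-upTo⁺ (s≤s B∸f≤W)))
      where
      B = cnt τ b / 2 ^ k
      f≤B : f τ ≤ B
      f≤B = ≤-trans (≤-reflexive (sym (m*n/n≡m (f τ) (2 ^ k))))
        (/-monoˡ-≤ (2 ^ k) (≤-trans (≤-reflexive (*-comm (f τ) (2 ^ k))) (≤-trans (m≤m+n _ _) (≤-reflexive (sym (total i))))))
      B≤f+W : B ≤ f τ + W
      B≤f+W = ≤-trans (/-monoˡ-≤ (2 ^ k) (≤-trans (≤-reflexive (total i))
          (≤-trans (+-monoʳ-≤ (2 ^ k * f τ) (sol-cnt τ))
            (≤-reflexive (trans (sym (*-distribˡ-+ (2 ^ k) (f τ) W)) (*-comm (2 ^ k) (f τ + W)))))))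
        (≤-reflexive (m*n/n≡m (f τ + W) (2 ^ k)))
      B∸f≤W : B ∸ f τ ≤ W
      B∸f≤W = m≤n+o⇒m∸n≤o B (f τ) B≤f+W
    go : ∀ ts → (∀ {τ} → τ ∈ ts → τ ∈ toks) → map (λ τ → τ , f τ) ts ∈ picks (map choice ts)
    go []       _ = here refl
    go (t ∷ ts) h = ∈-consEach (entry (h (here refl))) (go ts (λ i → h (there i)))

  -- The residuals are distinct and lie in a box with W + 1 values for each token, whatever the
  -- level.
  length-loop : ∀ k → length (loop Es S₀ k) ≤ suc W ^ length toks
  length-loop k = ≤-trans (≤-reflexive (sym (length-map proj₁ (loop Es S₀ k))))
    (≤-trans (Counting.pigeonhole codeRes 1 (box k) (map proj₁ (loop Es S₀ k))
               (All.map⁺ (All.map (∈-box k) states)) distinct)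
    (≤-trans (≤-reflexive (*-identityʳ _))
    (≤-trans (length-picks _ (All.map⁺ (All.universal (λ τ → ≤-reflexive (trans (length-map _ (upTo (suc W))) (length-upTo (suc W)))) toks)))
             (≤-reflexive (cong (suc W ^_) (length-map _ toks))))))
    where open LevelInv (loop-inv k)

-- A multiset of columns is given by the list of the multiplicities of
-- the members of cs; mult is the number of occurrences of a token in it.
mult : List Col → List ℕ → Tok → ℕ
mult []       _        τ = 0
mult (c ∷ cs) []       τ = 0
mult (c ∷ cs) (x ∷ xs) τ = x * cnt τ c + mult cs xs τ

pick : List Col → List ℕ → List Col
pick []       _        = []
pick (c ∷ cs) []       = []
pick (c ∷ cs) (x ∷ xs) = if isOdd x then c ∷ pick cs xs else pick cs xs

pick∈ : ∀ cs xs → pick cs xs ∈ subs cs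
pick∈ []       _        = here refl
pick∈ (c ∷ cs) []       = []∈subs (c ∷ cs)
pick∈ (c ∷ cs) (x ∷ xs) with isOdd x
... | true  = ∈-++⁺ˡ (∈-map⁺ (c ∷_) (pick∈ cs xs))
... | false = ∈-++⁺ʳ (map (c ∷_) (subs cs)) (pick∈ cs xs)

halves : List ℕ → List ℕ
halves = map ⌊_/2⌋

odd+halves : ∀ x → x ≡ (if isOdd x then 1 else 0) + (⌊ x /2⌋ + ⌊ x /2⌋)
odd+halves zero          = refl
odd+halves (suc zero)    = refl
odd+halves (suc (suc x)) = trans (cong (λ y → suc (suc y)) (odd+halves x)) (go (isOdd x) ⌊ x /2⌋)
  where
  lem : ∀ a h → suc (suc (a + (h + h))) ≡ a + (suc h + suc h)
  lem = solve-∀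
  go : ∀ b h → suc (suc ((if b then 1 else 0) + (h + h))) ≡ (if not (not b) then 1 else 0) + (suc h + suc h)
  go true  h = lem 1 h
  go false h = lem 0 h

mult-split : ∀ cs xs τ → mult cs xs τ ≡ cnt τ (concat (pick cs xs)) + (mult cs (halves xs) τ + mult cs (halves xs) τ)
mult-split []       xs       τ = refl
mult-split (c ∷ cs) []       τ = refl
mult-split (c ∷ cs) (x ∷ xs) τ = begin
  x * cnt τ c + mult cs xs τ
    ≡⟨ cong₂ (λ a b → a * cnt τ c + b) (odd+halves x) (mult-split cs xs τ) ⟩
  ((if isOdd x then 1 else 0) + (h + h)) * cnt τ c + (cnt τ (concat (pick cs xs)) + (m + m))
    ≡⟨ go (isOdd x) ⟩
  cnt τ (concat (if isOdd x then c ∷ pick cs xs else pick cs xs)) + ((h * cnt τ c + m) + (h * cnt τ c + m)) ∎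
  where
  open ≡-Reasoning
  h = ⌊ x /2⌋
  m = mult cs (halves xs) τ
  p = cnt τ (concat (pick cs xs))
  odd-lem : ∀ h a p m → (1 + (h + h)) * a + (p + (m + m)) ≡ (a + p) + ((h * a + m) + (h * a + m))
  odd-lem = solve-∀
  even-lem : ∀ h a p m → (0 + (h + h)) * a + (p + (m + m)) ≡ p + ((h * a + m) + (h * a + m))
  even-lem = solve-∀
  go : ∀ b → ((if b then 1 else 0) + (h + h)) * cnt τ c + (cnt τ (concat (pick cs xs)) + (m + m)) ≡
             cnt τ (concat (if b then c ∷ pick cs xs else pick cs xs)) + ((h * cnt τ c + m) + (h * cnt τ c + m))
  go true  = trans (odd-lem h (cnt τ c) p m) (cong (_+ ((h * cnt τ c + m) + (h * cnt τ c + m))) (sym (count-++ τ c (concat (pick cs xs)))))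
  go false = even-lem h (cnt τ c) p m

halvesⁿ : ℕ → List ℕ → List ℕ
halvesⁿ zero    xs = xs
halvesⁿ (suc k) xs = halves (halvesⁿ k xs)

halvesⁿ-< : ∀ k j {xs} → All (_< 2 ^ (k + j)) xs → All (_< 2 ^ j) (halvesⁿ k xs)
halvesⁿ-< zero    j p = p
halvesⁿ-< (suc k) j {xs} p = All.map⁺ (All.map half< (halvesⁿ-< k (suc j) (subst (λ e → All (_< 2 ^ e) xs) (sym (+-suc k j)) p)))
  where
  half< : ∀ {x} → x < 2 * 2 ^ j → ⌊ x /2⌋ < 2 ^ j
  half< {x} lt = ≰⇒> λ le → <⇒≱ lt (≤-trans
    (+-mono-≤ le (≤-trans (≤-reflexive (+-identityʳ (2 ^ j))) le))
    (≤-trans (m≤n+m _ (if isOdd x then 1 else 0)) (≤-reflexive (sym (odd+halves x)))))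

mult-0 : ∀ cs {xs} → All (_< 1) xs → ∀ τ → mult cs xs τ ≡ 0
mult-0 []       _               τ = refl
mult-0 (c ∷ cs) []              τ = refl
mult-0 (c ∷ cs) (s≤s z≤n ∷ ps)  τ = mult-0 cs ps τ

bump : ∀ {c : Col} {cs} → c ∈ cs → List ℕ → List ℕ
bump _         []       = []
bump (here _)  (x ∷ xs) = suc x ∷ xs
bump (there i) (x ∷ xs) = x ∷ bump i xs

length-bump : ∀ {c : Col} {cs} (i : c ∈ cs) xs → length (bump i xs) ≡ length xs
length-bump _         []       = refl
length-bump (here _)  (x ∷ xs) = refl
length-bump (there i) (x ∷ xs) = cong suc (length-bump i xs)

bump-≤ : ∀ {c : Col} {cs m} (i : c ∈ cs) {xs} → All (_≤ m) xs → All (_≤ suc m) (bump i xs)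
bump-≤ _         []       = []
bump-≤ (here _)  (p ∷ ps) = s≤s p ∷ All.map m≤n⇒m≤1+n ps
bump-≤ (there i) (p ∷ ps) = m≤n⇒m≤1+n p ∷ bump-≤ i ps

mult-bump : ∀ {c cs} (i : c ∈ cs) xs → length xs ≡ length cs →
            ∀ τ → mult cs (bump i xs) τ ≡ cnt τ c + mult cs xs τ
mult-bump {cs = c ∷ cs} (here refl) (x ∷ xs) e τ = +-assoc (cnt τ c) _ _
mult-bump {c} {cs = d ∷ cs} (there i) (x ∷ xs) e τ =
  trans (cong (x * cnt τ d +_) (mult-bump i xs (suc-injective e) τ)) (lem (x * cnt τ d) (cnt τ c) (mult cs xs τ))
  where
  lem : ∀ a b c → a + (b + c) ≡ b + (a + c)
  lem = solve-∀

-- Each column is counted at the position named by its membership proof, which settles the choice if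
-- `cs` has repetitions.
coeffs : ∀ {cs : List Col} {y} → All (_∈ cs) y → List ℕ
coeffs {cs} []       = replicate (length cs) 0
coeffs      (i ∷ is) = bump i (coeffs is)

length-coeffs : ∀ {cs y} (p : All (_∈ cs) y) → length (coeffs p) ≡ length cs
length-coeffs []       = length-replicate _
length-coeffs (i ∷ is) = trans (length-bump i (coeffs is)) (length-coeffs is)

mult-coeffs : ∀ {cs y} (p : All (_∈ cs) y) τ → mult cs (coeffs p) τ ≡ cnt τ (concat y)
mult-coeffs {cs} [] τ = mult-0 cs (All.replicate⁺ (length cs) (s≤s z≤n)) τ
mult-coeffs {y = c ∷ y} (i ∷ is) τ = trans (mult-bump i (coeffs is) (length-coeffs is) τ)
  (trans (cong (cnt τ c +_) (mult-coeffs is τ)) (sym (count-++ τ c (concat y))))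

coeffs-≤ : ∀ {cs y} (p : All (_∈ cs) y) → All (_≤ length y) (coeffs p)
coeffs-≤ {cs} []  = All.replicate⁺ (length cs) z≤n
coeffs-≤ (i ∷ is) = bump-≤ i (coeffs-≤ is)

-- L digits that are at most 2 denote at most 2 ^ (L + 1) - 2; the induction goes through in this
-- sharper form.
<2^digits : ∀ k → k < 2 ^ suc (length (digits k))
<2^digits k = subst (_< 2 ^ suc (length (digits k))) (bval-digits k) (≤-trans (n≤1+n _) (go (digits k)))
  where
  suc-dbl : ∀ x → suc (suc (suc (suc (x + x)))) ≡ suc (suc x) + (suc (suc x) + 0)
  suc-dbl = solve-∀
  go : ∀ bs → suc (suc (bval bs)) ≤ 2 ^ suc (length bs)
  go []           = ≤-refl
  go (true ∷ bs)  = ≤-trans (n≤1+n _) (≤-trans (≤-reflexive (suc-dbl (bval bs))) (*-monoʳ-≤ 2 (go bs)))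
  go (false ∷ bs) = ≤-trans (≤-reflexive (suc-dbl (bval bs))) (*-monoʳ-≤ 2 (go bs))

length≤concat : ∀ {y : List Col} → All (λ c → 1 ≤ length c) y → length y ≤ length (concat y)
length≤concat []                   = z≤n
length≤concat {c ∷ y} (p ∷ ps) = ≤-trans (+-mono-≤ p (length≤concat ps)) (≤-reflexive (sym (length-++ c)))

-- Completeness and soundness of the search

module DPComplete (b toks : List Tok) (cs : List Col) where
  open DP b toks cs

  Has : (Tok → ℕ) → List State → Set
  Has f = Any (λ s → proj₁ s ≡ resOf f)

  insert-grow : ∀ {Q : State → Set} s {S} → Any Q S → Any Q (insert s S)
  insert-grow s {S} p with isZero (count codeRes (proj₁ s) (map proj₁ S))
  ... | true  = there p
  ... | false = p

  -- If the state is rejected, another one with the same residual is present, and `Has` speaks of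
  -- residuals only.
  insert-has : ∀ {f} s S → proj₁ s ≡ resOf f → Has f (insert s S)
  insert-has s S e with count codeRes (proj₁ s) (map proj₁ S) in eq
  ... | zero  = here e
  ... | suc _ = Any.map (λ p → trans (sym p) e)
                  (Any.map⁻ (Counting.count⇒∈ codeRes (proj₁ s) (map proj₁ S) (subst (1 ≤_) (sym eq) (s≤s z≤n))))

  attempt-grow : ∀ {Q : State → Set} k s ε {S} → Any Q S → Any Q (attempt k s ε S)
  attempt-grow k (r , sol) ε p with _==_ codeRes r (recomb (concat ε) (next (concat ε) r))
  ... | true  = insert-grow _ p
  ... | false = p

  expand-grow : ∀ {Q : State → Set} k E′ s {S} → Any Q S → Any Q (expand k E′ s S)
  expand-grow k []       s p = p
  expand-grow k (ε ∷ E′) s p = attempt-grow k s ε (expand-grow k E′ s p)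

  attempt-has : ∀ {f g} k s ε S → proj₁ s ≡ resOf f →
                (∀ τ → f τ ≡ cnt τ (concat ε) + (g τ + g τ)) → Has g (attempt k s ε S)
  attempt-has {f} {g} k (r , sol) ε S refl e = go
    where
    a = concat ε
    next≡ : next a (resOf f) ≡ resOf g
    next≡ = trans (next-resOf a f) (resOf-cong λ τ →
      trans (cong (λ x → ⌊ x ∸ cnt τ a /2⌋) (e τ)) (double-half (cnt τ a) (g τ)))
    ok′ : _==_ codeRes (resOf f) (recomb a (next a (resOf f))) ≡ true
    ok′ = trans (cong (_==_ codeRes (resOf f)) (trans (cong (recomb a) next≡)
      (trans (recomb-resOf a g) (resOf-cong λ τ → sym (e τ))))) (==-refl codeRes (resOf f))
    go : Has g (attempt k (resOf f , sol) ε S)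
    go rewrite ok′ = insert-has (next a (resOf f) , dbl k ε ++ sol) S next≡

  expand-has : ∀ {f g} k E′ s S {ε} → ε ∈ E′ → proj₁ s ≡ resOf f →
               (∀ τ → f τ ≡ cnt τ (concat ε) + (g τ + g τ)) → Has g (expand k E′ s S)
  expand-has k (ε ∷ E′) s S (here refl) p e = attempt-has k s ε (expand k E′ s S) p e
  expand-has k (ε ∷ E′) s S (there i)   p e = attempt-grow k s ε (expand-has k E′ s S i p e)

  level-has : ∀ {f g} k S {ε} → ε ∈ Es → Has f S →
              (∀ τ → f τ ≡ cnt τ (concat ε) + (g τ + g τ)) → Has g (level k Es S)
  level-has k (s ∷ S) i (here p)  e = expand-has k Es s (level k Es S) i p e
  level-has k (s ∷ S) i (there p) e = expand-grow k Es s (level-has k S i p e)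

  -- A given solution is followed through the levels. The residual is what its halved multiplicities
  -- still supply, and the set of columns with an odd multiplicity is among the choices tried.
  loop-has : ∀ xs → (∀ τ → cnt τ b ≡ mult cs xs τ) → ∀ k → Has (mult cs (halvesⁿ k xs)) (loop Es S₀ k)
  loop-has xs e zero    = here (resOf-cong e)
  loop-has xs e (suc k) = level-has k (loop Es S₀ k) (pick∈ cs (halvesⁿ k xs)) (loop-has xs e k)
                            (mult-split cs (halvesⁿ k xs))

  search-has : ∀ S → Has (λ _ → 0) S → search S ≢ []
  search-has ((r , s) ∷ S) (here refl) e with () ← trans (sym e)
    (cong (λ t → if t then s ∷ [] else search S) (trans (cong (_==_ codeRes (resOf _)) (sym (map-∘ toks))) (==-refl codeRes (resOf (λ _ → 0)))))
  search-has ((r , s) ∷ S) (there p) e with _==_ codeRes r (zeros r)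
  ... | false = search-has S p e

  solve-complete : ∀ {y} → All (_∈ cs) y → All (λ c → 1 ≤ length c) y →
                   (∀ τ → cnt τ b ≡ cnt τ (concat y)) → solve b toks cs ≢ []
  solve-complete {y} p ne e = search-has _
    -- After L halvings every multiplicity is below 2 ^ 0, so the residual of this state vanishes.
    (Any.map (λ q → trans q (resOf-cong (mult-0 cs (halvesⁿ-< L 0 xs<))))
      (loop-has xs (λ τ → trans (e τ) (sym (mult-coeffs p τ))) L))
    where
    L = suc (length (digits (length b)))
    xs = coeffs p
    y≤b : length y ≤ length b
    y≤b = ≤-trans (length≤concat ne) (≤-reflexive (sym (Perm.↭-length (counts⇒↭ b (concat y) e))))
    xs< : All (_< 2 ^ (L + 0)) xs
    xs< = All.map (λ le → ≤-<-trans (≤-trans le y≤b) (subst (λ l → length b < 2 ^ l) (sym (+-identityʳ L)) (<2^digits (length b)))) (coeffs-≤ p)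

  search-sound : ∀ S {sol rest} → search S ≡ sol ∷ rest → ∃[ r ] (r , sol) ∈ S × r ≡ zeros r
  search-sound ((r , s) ∷ S) e with _==_ codeRes r (zeros r) in eq
  search-sound ((r , s) ∷ S) refl | true  = r , here refl , ==-sound codeRes r (zeros r) eq
  search-sound ((r , s) ∷ S) e    | false = let r′ , i , z = search-sound S e in r′ , there i , z

  solve-sound : (∀ {τ} → τ ∈ b → τ ∈ toks) → (∀ {τ} → τ ∈ concat cs → τ ∈ toks) →
                ∀ {sol rest} → solve b toks cs ≡ sol ∷ rest →
                All (_∈ cs) sol × length sol ≤ 2 ^ suc (length (digits (length b))) * length cs ×
                (∀ τ → cnt τ b ≡ cnt τ (concat sol))
  solve-sound b⊆ cs⊆ {sol} e with r , i , z ← search-sound _ e = sol∈ , sol-len , counts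
    where
    open StateInv (All.lookup (LevelInv.states (loop-inv (suc (length (digits (length b)))))) i)
    f≡0 : ∀ {τ} → τ ∈ toks → f τ ≡ 0
    f≡0 = resOf-inj (trans (sym res≡) (trans z (trans (cong zeros res≡) (sym (map-∘ toks)))))
    sol⊆ : ∀ {τ} → τ ∈ concat sol → τ ∈ toks
    sol⊆ j = let c , j′ , c∈ = ∈-concat⁻′ sol j in cs⊆ (∈-concat⁺′ j′ (All.lookup sol∈ c∈))
    on : ∀ {τ} → τ ∈ toks → cnt τ b ≡ cnt τ (concat sol)
    on {τ} t = trans (total t) (cong (_+ cnt τ (concat sol))
      (trans (cong (2 ^ suc (length (digits (length b))) *_) (f≡0 t)) (*-zeroʳ (2 ^ suc (length (digits (length b)))))))
    counts : ∀ τ → cnt τ b ≡ cnt τ (concat sol)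
    -- A token with a positive count on one side is tracked; for any other token both counts are 0.
    counts τ with cnt τ b in e₁ | cnt τ (concat sol) in e₂
    ... | zero  | zero  = refl
    ... | suc x | y     = trans (sym e₁) (trans (on (b⊆ (count⇒∈ τ b (subst (1 ≤_) (sym e₁) (s≤s z≤n))))) e₂)
    ... | zero  | suc y = trans (sym e₁) (trans (on (sol⊆ (count⇒∈ τ (concat sol) (subst (1 ≤_) (sym e₂) (s≤s z≤n))))) e₂)

-- Correctness of the reduction to columns

∈-addCol⁻ : ∀ k C {r c} → c ∈ addCol k C r →
            (c ≡ kindTok k ∷ C × fits (cap k) (map proj₁ C) ≡ true × ok k C ≡ true) ⊎ c ∈ r
∈-addCol⁻ k C i with fits (cap k) (map proj₁ C) | ok k C
... | false | _     = inj₂ i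
... | true  | false = inj₂ i
∈-addCol⁻ k C (here e)  | true | true = inj₁ (e , refl , refl)
∈-addCol⁻ k C (there i) | true | true = inj₂ i

record IsColumn (Cs : List (List Tok)) (ks : List Kind) (c : Col) : Set where
  constructor isColumn
  field
    k    : Kind
    C    : List Tok
    k∈   : k ∈ ks
    C∈   : C ∈ Cs
    c≡   : c ≡ kindTok k ∷ C
    fit  : fits (cap k) (map proj₁ C) ≡ true
    good : ok k C ≡ true

∈-cols⁻ : ∀ Cs ks {c} → c ∈ cols Cs ks → IsColumn Cs ks c
∈-cols⁻ Cs (k ∷ ks) i with ∈-++⁻ (kindCols k Cs) i
... | inj₂ j = record { IsColumn (∈-cols⁻ Cs ks j) ; k∈ = there (IsColumn.k∈ (∈-cols⁻ Cs ks j)) }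
... | inj₁ j = go Cs j
  where
  go : ∀ Cs {c} → c ∈ kindCols k Cs → IsColumn Cs (k ∷ ks) c
  go (C ∷ Cs) i with ∈-addCol⁻ k C i
  ... | inj₁ (e , f , g) = isColumn k C (here refl) (here refl) e f g
  ... | inj₂ j = record { IsColumn (go Cs j) ; C∈ = there (IsColumn.C∈ (go Cs j)) }

∈-cols⁺ : ∀ {Cs ks k C} → k ∈ ks → C ∈ Cs → fits (cap k) (map proj₁ C) ≡ true → ok k C ≡ true →
          kindTok k ∷ C ∈ cols Cs ks
∈-cols⁺ {Cs} {k = k} {C} (here refl) j f g = ∈-++⁺ˡ (go j)
  where
  keepIn : ∀ C′ {r c} → c ∈ r → c ∈ addCol k C′ r
  keepIn C′ i with fits (cap k) (map proj₁ C′) | ok k C′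
  ... | true  | true  = there i
  ... | true  | false = i
  ... | false | _     = i
  go : ∀ {Cs} → C ∈ Cs → kindTok k ∷ C ∈ kindCols k Cs
  go (here refl) rewrite f | g = here refl
  go (there i) = keepIn _ (go i)
∈-cols⁺ {Cs} {k ∷ _} (there i) j f g = ∈-++⁺ʳ (kindCols k Cs) (∈-cols⁺ i j f g)

nth : ℕ → List ℕ → ℕ
nth c       []      = 0
nth zero    (x ∷ s) = x
nth (suc c) (x ∷ s) = nth c s

nth-drop : ∀ c s → nth c (drop 1 s) ≡ nth (suc c) s
nth-drop c []      = refl
nth-drop c (x ∷ s) = refl

heads≡ : ∀ ss → heads ss ≡ sum (map (nth 0) ss)
heads≡ []              = refl
heads≡ ([] ∷ ss)       = heads≡ ss
heads≡ ((x ∷ _) ∷ ss) = cong (x +_) (heads≡ ss)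

sum-nth-drop : ∀ c ss → sum (map (nth c) (map (drop 1) ss)) ≡ sum (map (nth (suc c)) ss)
sum-nth-drop c []       = refl
sum-nth-drop c (s ∷ ss) = cong₂ _+_ (nth-drop c s) (sum-nth-drop c ss)

-- The meaning of `fits` by coordinates. As it involves sums only, it is invariant under permutation
-- of the items.
Fit : List ℕ → List (List ℕ) → Set
Fit Bs ss = ∀ c → c < length Bs → sum (map (nth c) ss) ≤ nth c Bs

fits⇒Fit : ∀ Bs ss → fits Bs ss ≡ true → Fit Bs ss
fits⇒Fit (B ∷ Bs) ss e c lt with heads ss ∸ B in eq
fits⇒Fit (B ∷ Bs) ss e zero    lt       | zero = subst (_≤ B) (heads≡ ss) (m∸n≡0⇒m≤n eq)
fits⇒Fit (B ∷ Bs) ss e (suc c) (s≤s lt) | zero =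
  subst (_≤ nth c Bs) (sum-nth-drop c ss) (fits⇒Fit Bs (map (drop 1) ss) e c lt)

Fit⇒fits : ∀ Bs ss → Fit Bs ss → fits Bs ss ≡ true
Fit⇒fits []       ss f = refl
Fit⇒fits (B ∷ Bs) ss f rewrite m≤n⇒m∸n≡0 (≤-trans (≤-reflexive (heads≡ ss)) (f 0 (s≤s z≤n))) =
  Fit⇒fits Bs (map (drop 1) ss) (λ c lt → ≤-trans (≤-reflexive (sum-nth-drop c ss)) (f (suc c) (s≤s lt)))

Fit-↭ : ∀ {Bs ss ss′} → ss ↭ ss′ → Fit Bs ss → Fit Bs ss′
Fit-↭ {Bs} p f c lt = subst (_≤ nth c Bs) (sum-↭ (Perm.map⁺ (nth c) p)) (f c lt)

keys : Supply → List Tok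
keys = map proj₁

look-remove : ∀ u s → u ∈ keys s → s ↭ (u , look u s) ∷ remove u s
look-remove u ((x , v) ∷ s) i with ==-case u x
... | inj₁ (refl , e) rewrite e = ↭-refl
look-remove u ((x , v) ∷ s) (here refl) | inj₂ (u≢x , e) = ⊥-elim (u≢x refl)
look-remove u ((x , v) ∷ s) (there i)   | inj₂ (u≢x , e) rewrite e =
  ↭-trans (prep (x , v) (look-remove u s i)) (swap (x , v) (u , look u s) ↭-refl)

-- Items with the same token are interchangeable, so giving each item the first matching entry never
-- gets stuck while the counts agree.
assign-↭ : ∀ us s → (∀ τ → cnt τ us ≡ cnt τ (keys s)) → zip us (assign us s) ↭ s
assign-↭ [] s p = ↭-reflexive (sym (empty s (Counting.no-counts codeTok (keys s) (λ τ → sym (p τ)))))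
  where
  empty : ∀ (s : Supply) → keys s ≡ [] → s ≡ []
  empty [] _ = refl
assign-↭ (u ∷ us) s p = ↭-trans (prep (u , look u s) (assign-↭ us (remove u s) p′)) (↭-sym q)
  where
  q : s ↭ (u , look u s) ∷ remove u s
  q = look-remove u s (count⇒∈ u (keys s) (subst (1 ≤_) (p u) (∈⇒count {u} {u ∷ us} (here refl))))
  strip : ∀ τ {xs ys} → cnt τ (u ∷ xs) ≡ cnt τ (u ∷ ys) → cnt τ xs ≡ cnt τ ys
  strip τ e with _==_ codeTok τ u
  ... | true  = suc-injective e
  ... | false = e
  p′ : ∀ τ → cnt τ us ≡ cnt τ (keys (remove u s))
  p′ τ = strip τ {us} {keys (remove u s)} (trans (p τ) (count-↭ τ (Perm.map⁺ proj₁ q)))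

length-assign : ∀ us s → length (assign us s) ≡ length us
length-assign []       s = refl
length-assign (u ∷ us) s = cong suc (length-assign us (remove u s))

pickKeys : (Index → Bool) → Supply → List Tok
pickKeys Q []            = []
pickKeys Q ((x , v) ∷ s) = if Q v then x ∷ pickKeys Q s else pickKeys Q s

pickKeys-↭ : ∀ Q {s s′} → s ↭ s′ → pickKeys Q s ↭ pickKeys Q s′
pickKeys-↭ Q Perm.refl = ↭-refl
pickKeys-↭ Q (prep (x , v) p) with Q v
... | true  = prep x (pickKeys-↭ Q p)
... | false = pickKeys-↭ Q p
pickKeys-↭ Q (swap (x , v) (y , w) p) with Q v | Q w
... | true  | true  = swap x y (pickKeys-↭ Q p)
... | true  | false = prep x (pickKeys-↭ Q p)
... | false | true  = prep y (pickKeys-↭ Q p)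
... | false | false = pickKeys-↭ Q p
pickKeys-↭ Q (Perm.trans p q) = ↭-trans (pickKeys-↭ Q p) (pickKeys-↭ Q q)

codeIndex : Code Index
codeIndex = codePair codeℕ codeℕ

_≟ᵢ_ : Index → Index → Bool
_≟ᵢ_ = _==_ codeIndex

-- Sizes of items are nonempty lists because d > 0, so an item is never mistaken for the token of a
-- kind.
WF : Col → Set
WF c = ∃[ a ] ∃[ C ] c ≡ ([] , a) ∷ C × All (λ τ → proj₁ τ ≢ []) C

binCount : ℕ → List Col → ℕ
binCount i sol = cnt ([] , i) (concat sol)

cnt-items : ∀ {i C} → All (λ τ → proj₁ τ ≢ []) C → cnt ([] , i) C ≡ 0
cnt-items []       = refl
cnt-items {i} {C = x ∷ C} (p ∷ ps) = trans (count-there C (λ e → p (sym (cong proj₁ e)))) (cnt-items ps)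

binCount-same : ∀ i {C cs} → All (λ τ → proj₁ τ ≢ []) C →
                binCount i ((([] , i) ∷ C) ∷ cs) ≡ suc (binCount i cs)
binCount-same i {C} {cs} p = trans (count-here ([] , i) (C ++ concat cs))
  (cong suc (trans (count-++ ([] , i) C (concat cs)) (cong (_+ binCount i cs) (cnt-items p))))

binCount-other : ∀ {i a C cs} → i ≢ a → All (λ τ → proj₁ τ ≢ []) C →
                 binCount i ((([] , a) ∷ C) ∷ cs) ≡ binCount i cs
binCount-other {i} {a} {C} {cs} n p = trans (count-there {[] , i} {[] , a} (C ++ concat cs) (λ e → n (cong proj₂ e)))
  (trans (count-++ ([] , i) C (concat cs)) (cong (_+ binCount i cs) (cnt-items p)))

pickKeys-tag : ∀ Q v C s → pickKeys Q (tag v C ++ s) ≡ (if Q v then C ++ pickKeys Q s else pickKeys Q s)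
pickKeys-tag Q v [] s with Q v
... | true  = refl
... | false = refl
pickKeys-tag Q v (x ∷ C) s with Q v in eq
... | true  = cong (x ∷_) (trans (pickKeys-tag Q v C s) (cong (λ b → if b then C ++ pickKeys Q s else pickKeys Q s) eq))
... | false = trans (pickKeys-tag Q v C s) (cong (λ b → if b then C ++ pickKeys Q s else pickKeys Q s) eq)

-- The first column has the largest index of its kind, and the columns after it own the smaller
-- ones. The second half of the claim shows that the new index is not yet in use, so its items are
-- exactly those of the first column.
bin-contents : ∀ i j sol → All WF sol →
  (j < binCount i sol → ∃[ C ] (([] , i) ∷ C) ∈ sol × pickKeys (λ w → w ≟ᵢ (i , j)) (supply sol) ≡ C) ×
  (binCount i sol ≤ j → pickKeys (λ w → w ≟ᵢ (i , j)) (supply sol) ≡ [])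
bin-contents i j [] [] = (λ ()) , (λ _ → refl)
bin-contents i j (_ ∷ cs) ((a , C , refl , p) ∷ ps)
  rewrite pickKeys-tag (λ w → w ≟ᵢ (i , j)) (a , binCount a cs) C (supply cs)
  with bin-contents i j cs ps | Counting.==-case codeIndex (a , binCount a cs) (i , j)
... | inside , outside | inj₁ (refl , e) rewrite e | outside ≤-refl | binCount-same a {C} {cs} p =
  (λ _ → C , here refl , ++-[] C) , (λ le → ⊥-elim (<-irrefl refl le))
  where
  ++-[] : ∀ {A : Set} (xs : List A) → xs ++ [] ≡ xs
  ++-[] []       = refl
  ++-[] (x ∷ xs) = cong (x ∷_) (++-[] xs)
... | inside , outside | inj₂ (n , e) rewrite e with i ≟ a
...   | no i≢a rewrite binCount-other {cs = cs} i≢a p =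
  (λ lt → let D , D∈ , eq = inside lt in D , there D∈ , eq) , outside
...   | yes refl rewrite binCount-same i {C} {cs} p =
  (λ lt → let D , D∈ , eq = inside (≤∧≢⇒< (s≤s⁻¹ lt) (λ j≡ → n (cong (i ,_) (sym j≡)))) in D , there D∈ , eq) ,
  (λ le → outside (<⇒≤ le))

supply-index : ∀ {x a j} sol → All WF sol → (x , (a , j)) ∈ supply sol → j < binCount a sol
supply-index {x} {a} {j} (_ ∷ cs) ((b , C , refl , p) ∷ ps) i with ∈-++⁻ (tag (b , binCount b cs) C) i
... | inj₁ t with _ , _ , refl ← ∈-map⁻ _ t = ≤-reflexive (sym (binCount-same b {C} {cs} p))
... | inj₂ r = ≤-trans (supply-index cs ps r) (≤-trans (m≤n+m _ (cnt ([] , a) (([] , b) ∷ C)))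
                 (≤-reflexive (sym (count-++ ([] , a) (([] , b) ∷ C) (concat cs)))))

-- Without an empty column of kind i each of its bins holds an item of its own. For n + 1 bins this
-- is impossible, so the empty multiset has passed the validity test of that kind.
empty-bin : ∀ i sol → All WF sol → (([] , i) ∷ []) ∈ sol ⊎ binCount i sol ≤ length (supply sol)
empty-bin i [] [] = inj₂ z≤n
empty-bin i (_ ∷ cs) ((a , C , refl , p) ∷ ps) with empty-bin i cs ps
... | inj₁ e  = inj₁ (there e)
... | inj₂ le with i ≟ a
...   | no i≢a rewrite binCount-other {cs = cs} i≢a p | length-++ (tag (a , binCount a cs) C) {supply cs} =
  inj₂ (≤-trans le (m≤n+m _ _))
...   | yes refl with C
...     | []     = inj₁ (here refl)
...     | x ∷ C′ rewrite binCount-same i {x ∷ C′} {cs} p | length-++ (tag (i , binCount i cs) C′) {supply cs} =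
  inj₂ (s≤s (≤-trans le (m≤n+m _ _)))

cnt-keys : ∀ τ sol → All WF sol → proj₁ τ ≢ [] → cnt τ (keys (supply sol)) ≡ cnt τ (concat sol)
cnt-keys τ [] [] n = refl
cnt-keys τ (_ ∷ cs) ((a , C , refl , p) ∷ ps) n = begin
  cnt τ (keys (tag v C ++ supply cs))         ≡⟨ cong (cnt τ) (keys-tag C) ⟩
  cnt τ (C ++ keys (supply cs))               ≡⟨ count-++ τ C (keys (supply cs)) ⟩
  cnt τ C + cnt τ (keys (supply cs))          ≡⟨ cong (cnt τ C +_) (cnt-keys τ cs ps n) ⟩
  cnt τ C + cnt τ (concat cs)                 ≡⟨ count-++ τ C (concat cs) ⟨
  cnt τ (C ++ concat cs)                      ≡⟨ count-there (C ++ concat cs) (λ e → n (cong proj₁ e)) ⟨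
  cnt τ (([] , a) ∷ C ++ concat cs)           ∎
  where
  open ≡-Reasoning
  v = a , binCount a cs
  keys-tag : ∀ C → keys (tag v C ++ supply cs) ≡ C ++ keys (supply cs)
  keys-tag []      = refl
  keys-tag (x ∷ C) = cong (x ∷_) (keys-tag C)

keys-items : ∀ sol → All WF sol → All (λ τ → proj₁ τ ≢ []) (keys (supply sol))
keys-items [] [] = []
keys-items (_ ∷ cs) ((a , C , refl , p) ∷ ps) = go p
  where
  go : ∀ {D} → All (λ τ → proj₁ τ ≢ []) D → All (λ τ → proj₁ τ ≢ []) (keys (tag (a , binCount a cs) D ++ supply cs))
  go []       = keys-items cs ps
  go (q ∷ qs) = q ∷ go qs

-- Translation of subsets and vectors into lists of tokens

selectV : ∀ {A : Set} {n} → Subset n → Vec A n → List A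
selectV []          []       = []
selectV (true ∷ S)  (x ∷ xs) = x ∷ selectV S xs
selectV (false ∷ S) (x ∷ xs) = selectV S xs

lookup-sumOver : ∀ {n d} (S : Subset n) (xs : Vec (Vec ℕ d) n) c →
                 lookup (sumOver S xs) c ≡ sum (map (λ v → lookup v c) (selectV S xs))
lookup-sumOver []          []       c = lookup-replicate c 0
lookup-sumOver (true ∷ S)  (x ∷ xs) c =
  trans (lookup-zipWith _+_ c x (sumOver S xs)) (cong (lookup x c +_) (lookup-sumOver S xs c))
lookup-sumOver (false ∷ S) (x ∷ xs) c = lookup-sumOver S xs c

nth-toList : ∀ {n} (v : Vec ℕ n) c → nth (toℕ c) (toList v) ≡ lookup v c
nth-toList (x ∷ v) zero    = refl
nth-toList (x ∷ v) (suc c) = nth-toList v c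

tok : ∀ {d q} → Vec ℕ d → Fin q → Tok
tok s φ = toList s , toℕ φ

select-sizes : ∀ {n d q} (S : Subset n) (ss : Vec (Vec ℕ d) n) (F : Vec (Fin q) n) c →
               lookup (sumOver S ss) c ≡ sum (map (nth (toℕ c)) (map proj₁ (selectV S (Vec.zipWith tok ss F))))
select-sizes S ss F c = trans (lookup-sumOver S ss c) (go S ss F)
  where
  go : ∀ {n} (S : Subset n) ss (F : Vec _ n) → sum (map (λ v → lookup v c) (selectV S ss)) ≡
       sum (map (nth (toℕ c)) (map proj₁ (selectV S (Vec.zipWith tok ss F))))
  go []          []       []      = refl
  go (true ∷ S)  (s ∷ ss) (_ ∷ F) = cong₂ _+_ (sym (nth-toList s c)) (go S ss F)
  go (false ∷ S) (s ∷ ss) (_ ∷ F) = go S ss F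

fpMultiset : ∀ q → List Tok → Vec ℕ q
fpMultiset q C = Vec.tabulate λ φ → count codeℕ (toℕ φ) (map proj₂ C)

lookup-singleton : ∀ {q} (φ ψ : Fin q) → lookup (singleton φ) ψ ≡ (if _==_ codeℕ (toℕ ψ) (toℕ φ) then 1 else 0)
lookup-singleton φ ψ with Counting.==-case codeℕ (toℕ ψ) (toℕ φ)
... | inj₁ (e , t) rewrite t | toℕ-injective e = Vec.lookup∘updateAt φ (Vec.replicate _ 0)
... | inj₂ (n , f) rewrite f =
  trans (Vec.lookup∘updateAt′ ψ φ (λ e → n (cong toℕ e)) (Vec.replicate _ 0)) (lookup-replicate ψ 0)

fingerprints≡ : ∀ {n d q} (S : Subset n) (ss : Vec (Vec ℕ d) n) (F : Vec (Fin q) n) →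
                fingerprintsOf F S ≡ fpMultiset q (selectV S (Vec.zipWith tok ss F))
fingerprints≡ {q = q} S ss F = trans (sym (tabulate∘lookup _)) (tabulate-cong λ φ →
  trans (lookup-sumOver S (Vec.map singleton F) φ) (go φ S ss F))
  where
  go : ∀ {n} (φ : Fin q) (S : Subset n) ss (F : Vec (Fin q) n) →
       sum (map (λ v → lookup v φ) (selectV S (Vec.map singleton F))) ≡
       count codeℕ (toℕ φ) (map proj₂ (selectV S (Vec.zipWith tok ss F)))
  go φ []          []       []      = refl
  go φ (false ∷ S) (s ∷ ss) (ψ ∷ F) = go φ S ss F
  go φ (true ∷ S)  (s ∷ ss) (ψ ∷ F) rewrite lookup-singleton ψ φ with _==_ codeℕ (toℕ φ) (toℕ ψ)
  ... | true  = cong suc (go φ S ss F)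
  ... | false = go φ S ss F

fpMultiset-↭ : ∀ q {C D} → C ↭ D → fpMultiset q C ≡ fpMultiset q D
fpMultiset-↭ q p = tabulate-cong λ φ → Counting.count-↭ codeℕ (toℕ φ) (Perm.map⁺ proj₂ p)

toList-tabulate : ∀ {A : Set} n (g : ℕ → A) → toList (Vec.tabulate {n = n} (λ i → g (toℕ i))) ≡ applyUpTo g n
toList-tabulate zero    g = refl
toList-tabulate (suc n) g = cong (g 0 ∷_) (toList-tabulate n (λ i → g (suc i)))

toList-fpMultiset : ∀ q C → toList (fpMultiset q C) ≡ mset q C
toList-fpMultiset q C = trans (toList-tabulate q (λ φ → count codeℕ φ (map proj₂ C)))
  (sym (map-applyUpTo id (λ φ → count codeℕ φ (map proj₂ C)) q))

pointwise : ∀ {n} {xs ys : Vec ℕ n} → (∀ i → lookup xs i ≤ lookup ys i) → Pointwise _≤_ xs ys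
pointwise {xs = []}     {[]}     p = []
pointwise {xs = x ∷ xs} {y ∷ ys} p = p zero ∷ pointwise (λ i → p (suc i))

pointwise-lookup : ∀ {n} {xs ys : Vec ℕ n} → Pointwise _≤_ xs ys → ∀ i → lookup xs i ≤ lookup ys i
pointwise-lookup (p ∷ ps) zero    = p
pointwise-lookup (p ∷ ps) (suc i) = pointwise-lookup ps i

norm-mono : ∀ {n} {xs ys : Vec ℕ n} → Pointwise _≤_ xs ys → ‖ xs ‖₁ ≤ ‖ ys ‖₁
norm-mono []       = z≤n
norm-mono (p ∷ ps) = +-mono-≤ p (norm-mono ps)

norm-+ : ∀ {n} (xs ys : Vec ℕ n) → ‖ Vec.zipWith _+_ xs ys ‖₁ ≡ ‖ xs ‖₁ + ‖ ys ‖₁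
norm-+ []       []       = refl
norm-+ (x ∷ xs) (y ∷ ys) = trans (cong (x + y +_) (norm-+ xs ys)) (lem x y _ _)
  where
  lem : ∀ a b c d → a + b + (c + d) ≡ (a + c) + (b + d)
  lem = solve-∀

norm>0 : ∀ {n} (v : Vec ℕ n) → v ≢ Vec.replicate n 0 → 1 ≤ ‖ v ‖₁
norm>0 []          n = ⊥-elim (n refl)
norm>0 (zero ∷ v)  n = norm>0 v (λ e → n (cong (0 ∷_) e))
norm>0 (suc x ∷ v) n = s≤s z≤n

-- A nonzero size has norm at least 1. Together with `norm-mono` this bounds the number of items in
-- a bin by the norm of its capacity.
length-select : ∀ {n d q} (S : Subset n) (ss : Vec (Vec ℕ d) n) (F : Vec (Fin q) n) →
                (∀ u → lookup ss u ≢ Vec.replicate d 0) →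
                length (selectV S (Vec.zipWith tok ss F)) ≤ ‖ sumOver S ss ‖₁
length-select []          []       []      _ = z≤n
length-select (false ∷ S) (s ∷ ss) (_ ∷ F) n = length-select S ss F (λ u → n (suc u))
length-select (true ∷ S)  (s ∷ ss) (_ ∷ F) n = ≤-trans
  (+-mono-≤ (norm>0 s (n zero)) (length-select S ss F (λ u → n (suc u))))
  (≤-reflexive (sym (norm-+ s (sumOver S ss))))

cnt-select : ∀ {n} τ (S : Subset n) v → cnt τ (selectV S v) ≤ cnt τ (toList v)
cnt-select τ []          []      = z≤n
cnt-select τ (false ∷ S) (x ∷ v) = ≤-trans (cnt-select τ S v) (Counting.count-∷ codeTok τ x (toList v))
cnt-select τ (true ∷ S)  (x ∷ v) with _==_ codeTok τ x
... | true  = s≤s (cnt-select τ S v)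
... | false = cnt-select τ S v

-- Finite sums and lists of bins

sumF : ∀ {n} → (Fin n → ℕ) → ℕ
sumF {zero}  f = 0
sumF {suc n} f = f zero + sumF (λ i → f (suc i))

sumF-cong : ∀ {n} {f g : Fin n → ℕ} → (∀ i → f i ≡ g i) → sumF f ≡ sumF g
sumF-cong {zero}  e = refl
sumF-cong {suc n} e = cong₂ _+_ (e zero) (sumF-cong (λ i → e (suc i)))

sumF-0 : ∀ {n} {f : Fin n → ℕ} → (∀ i → f i ≡ 0) → sumF f ≡ 0
sumF-0 {zero}  e = refl
sumF-0 {suc n} e = cong₂ _+_ (e zero) (sumF-0 (λ i → e (suc i)))

sumF-+ : ∀ {n} (f g : Fin n → ℕ) → sumF (λ i → f i + g i) ≡ sumF f + sumF g
sumF-+ {zero}  f g = refl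
sumF-+ {suc n} f g = trans (cong (f zero + g zero +_) (sumF-+ (λ i → f (suc i)) (λ i → g (suc i)))) (lem (f zero) (g zero) _ _)
  where
  lem : ∀ a b c d → a + b + (c + d) ≡ (a + c) + (b + d)
  lem = solve-∀

sumF-swap : ∀ {n m} (f : Fin n → Fin m → ℕ) → sumF (λ i → sumF (f i)) ≡ sumF (λ j → sumF (λ i → f i j))
sumF-swap {zero} {m} f = sym (sumF-0 {m} {λ _ → 0} (λ _ → refl))
sumF-swap {suc n} f = trans (cong (sumF (f zero) +_) (sumF-swap (λ i → f (suc i))))
  (sym (sumF-+ (f zero) (λ j → sumF (λ i → f (suc i) j))))

sumF-single : ∀ {n} {f : Fin n → ℕ} i₀ → (∀ i → i ≢ i₀ → f i ≡ 0) → sumF f ≡ f i₀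
sumF-single {f = f} zero     z = trans (cong (f zero +_) (sumF-0 (λ i → z (suc i) λ ()))) (+-identityʳ (f zero))
sumF-single (suc i₀) z = cong₂ _+_ (z zero λ ()) (sumF-single i₀ (λ i n → z (suc i) (λ e → n (Fin.suc-injective e))))

δ : Tok → Tok → ℕ
δ τ x = if _==_ codeTok τ x then 1 else 0

cnt-toList : ∀ {n} τ (v : Vec Tok n) → cnt τ (toList v) ≡ sumF (λ u → δ τ (lookup v u))
cnt-toList τ []      = refl
cnt-toList τ (x ∷ v) with _==_ codeTok τ x
... | true  = cong suc (cnt-toList τ v)
... | false = cnt-toList τ v

cnt-selectV : ∀ {n} τ (S : Subset n) (v : Vec Tok n) →
              cnt τ (selectV S v) ≡ sumF (λ u → if lookup S u then δ τ (lookup v u) else 0)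
cnt-selectV τ []          []      = refl
cnt-selectV τ (false ∷ S) (x ∷ v) = cnt-selectV τ S v
cnt-selectV τ (true ∷ S)  (x ∷ v) with _==_ codeTok τ x
... | true  = cong suc (cnt-selectV τ S v)
... | false = cnt-selectV τ S v

cnt-tabulate : ∀ {n} τ (f : Fin n → List Tok) → cnt τ (concat (List.tabulate f)) ≡ sumF (λ i → cnt τ (f i))
cnt-tabulate {zero}  τ f = refl
cnt-tabulate {suc n} τ f = trans (count-++ τ (f zero) _) (cong (cnt τ (f zero) +_) (cnt-tabulate τ (λ i → f (suc i))))

length-concat-tabulate : ∀ {n} (f : Fin n → List Tok) i → length (f i) ≤ length (concat (List.tabulate f))
length-concat-tabulate {suc n} f zero    = ≤-trans (m≤m+n _ _) (≤-reflexive (sym (length-++ (f zero))))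
length-concat-tabulate {suc n} f (suc i) =
  ≤-trans (length-concat-tabulate (λ i → f (suc i)) i) (≤-trans (m≤n+m _ _) (≤-reflexive (sym (length-++ (f zero)))))

nonEmpty : {A : Set} → List (List A) → List (List A)
nonEmpty []              = []
nonEmpty ([] ∷ xss)      = nonEmpty xss
nonEmpty ((x ∷ xs) ∷ xss) = (x ∷ xs) ∷ nonEmpty xss

concat-nonEmpty : ∀ {A : Set} (xss : List (List A)) → concat (nonEmpty xss) ≡ concat xss
concat-nonEmpty []              = refl
concat-nonEmpty ([] ∷ xss)      = concat-nonEmpty xss
concat-nonEmpty ((x ∷ xs) ∷ xss) = cong (λ ys → x ∷ xs ++ ys) (concat-nonEmpty xss)

nonEmpty-∈ : ∀ {A : Set} {Q : List A → Set} {xss} → All Q xss → All Q (nonEmpty xss)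
nonEmpty-∈ []                          = []
nonEmpty-∈ {xss = [] ∷ _}      (p ∷ ps) = nonEmpty-∈ ps
nonEmpty-∈ {xss = (_ ∷ _) ∷ _} (p ∷ ps) = p ∷ nonEmpty-∈ ps

length-nonEmpty : ∀ {A : Set} (xss : List (List A)) → length (nonEmpty xss) ≤ length xss
length-nonEmpty []              = z≤n
length-nonEmpty ([] ∷ xss)      = m≤n⇒m≤1+n (length-nonEmpty xss)
length-nonEmpty ((_ ∷ _) ∷ xss) = s≤s (length-nonEmpty xss)

length-nonEmpty-concat : ∀ {A : Set} (xss : List (List A)) → length (nonEmpty xss) ≤ length (concat xss)
length-nonEmpty-concat []              = z≤n
length-nonEmpty-concat ([] ∷ xss)      = length-nonEmpty-concat xss
length-nonEmpty-concat ((x ∷ xs) ∷ xss) =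
  s≤s (≤-trans (length-nonEmpty-concat xss) (≤-trans (m≤n+m _ (length xs)) (≤-reflexive (sym (length-++ xs)))))

-- If the filter shortens the list, [] is one of its entries. This provides the validity of the
-- empty columns used as padding.
nonEmpty-missing : ∀ {A : Set} {Q : List A → Set} {xss} → All Q xss → length (nonEmpty xss) < length xss → Q []
nonEmpty-missing {xss = [] ∷ _}      (p ∷ ps) lt       = p
nonEmpty-missing {xss = (_ ∷ _) ∷ _} (p ∷ ps) (s≤s lt) = nonEmpty-missing ps lt

cnt-map-∷ : ∀ τ t (xss : List (List Tok)) →
            cnt τ (concat (map (t ∷_) xss)) ≡ cnt τ (replicate (length xss) t) + cnt τ (concat xss)
cnt-map-∷ τ t []         = refl
cnt-map-∷ τ t (xs ∷ xss) = begin
  cnt τ (t ∷ xs ++ concat (map (t ∷_) xss))        ≡⟨ count-++ τ (t ∷ []) (xs ++ concat (map (t ∷_) xss)) ⟩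
  a + cnt τ (xs ++ concat (map (t ∷_) xss))        ≡⟨ cong (a +_) (count-++ τ xs _) ⟩
  a + (cnt τ xs + cnt τ (concat (map (t ∷_) xss))) ≡⟨ cong (λ z → a + (cnt τ xs + z)) (cnt-map-∷ τ t xss) ⟩
  a + (cnt τ xs + (cnt τ (replicate (length xss) t) + cnt τ (concat xss))) ≡⟨ lem a (cnt τ xs) _ _ ⟩
  (a + cnt τ (replicate (length xss) t)) + (cnt τ xs + cnt τ (concat xss))
    ≡⟨ cong₂ _+_ (count-++ τ (t ∷ []) (replicate (length xss) t)) (count-++ τ xs (concat xss)) ⟨
  cnt τ (t ∷ replicate (length xss) t) + cnt τ (xs ++ concat xss) ∎
  where
  open ≡-Reasoning
  a = cnt τ (t ∷ [])
  lem : ∀ a b c d → a + (b + (c + d)) ≡ (a + c) + (b + d)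
  lem = solve-∀

concat-replicate-[] : ∀ {A : Set} k (xss : List (List A)) → concat (xss ++ replicate k []) ≡ concat xss
concat-replicate-[] zero    []         = refl
concat-replicate-[] (suc k) []         = concat-replicate-[] k []
concat-replicate-[] k       (xs ∷ xss) = cong (xs ++_) (concat-replicate-[] k xss)

slots-tabulate : ∀ {m} N (K : Fin m → Kind) τ →
                 cnt τ (slots N (List.tabulate K)) ≡ sumF (λ i → cnt τ (replicate (N ⊓ av (K i)) (kindTok (K i))))
slots-tabulate {zero}  N K τ = refl
slots-tabulate {suc m} N K τ = trans (count-++ τ (replicate (N ⊓ av (K zero)) (kindTok (K zero))) _)
  (cong (cnt τ (replicate (N ⊓ av (K zero)) (kindTok (K zero))) +_) (slots-tabulate N (λ i → K (suc i)) τ))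

-- Instances and their columns

module Problem (𝓑 : Instance) {T : ℕ → ℕ} (𝓥 : Evaluators 𝓑 T) where
  open Instance 𝓑
  open Evaluators 𝓥

  raw : Raw
  raw = record
    { q     = q
    ; caps  = map toList (toList capacity)
    ; avs   = toList available
    ; progs = toList program
    ; sizes = map toList (toList itemSize)
    ; fps   = map toℕ (toList fingerprint)
    }

  kindOf : Fin m → Kind
  kindOf i = kind (toList (lookup capacity i)) (lookup available i) (lookup program i) (toℕ i)
                  (λ C → valid i (fpMultiset q C))

  kinds : List Kind
  kinds = List.tabulate kindOf

  open Raw raw using (caps)
  open Spec raw kinds

  itemToks : Vec Tok n
  itemToks = Vec.zipWith tok itemSize fingerprint

  items≡ : items ≡ toList itemToks
  items≡ = go itemSize fingerprint
    where
    go : ∀ {n} (ss : Vec (Vec ℕ d) n) (F : Vec (Fin q) n) →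
         zip (map toList (toList ss)) (map toℕ (toList F)) ≡ toList (Vec.zipWith tok ss F)
    go []       []      = refl
    go (s ∷ ss) (φ ∷ F) = cong (tok s φ ∷_) (go ss F)

  length-items : length items ≡ n
  length-items = trans (cong length items≡) (length-toList itemToks)

  sumFirst≡ : sumFirst caps ≡ ‖ B₁ ‖₁
  sumFirst≡ = go capacity m>0
    where
    sum-toList : ∀ {d} (v : Vec ℕ d) → sum (toList v) ≡ ‖ v ‖₁
    sum-toList []      = refl
    sum-toList (x ∷ v) = cong (x +_) (sum-toList v)
    go : ∀ {m} (v : Vec (Vec ℕ d) m) (p : 0 < m) → sumFirst (map toList (toList v)) ≡ ‖ lookup v (fromℕ< p) ‖₁
    go (c ∷ v) (s≤s z≤n) = sum-toList c

  fit⇒pointwise : ∀ i S → Fit (toList (lookup capacity i)) (map proj₁ (selectV S itemToks)) →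
                  Pointwise _≤_ (sumOver S itemSize) (lookup capacity i)
  fit⇒pointwise i S f = pointwise λ c → ≤-trans (≤-reflexive (select-sizes S itemSize fingerprint c))
    (≤-trans (f (toℕ c) (subst (toℕ c <_) (sym (length-toList (lookup capacity i))) (toℕ<n c)))
             (≤-reflexive (nth-toList (lookup capacity i) c)))

  pointwise⇒fit : ∀ i S → Pointwise _≤_ (sumOver S itemSize) (lookup capacity i) →
                  Fit (toList (lookup capacity i)) (map proj₁ (selectV S itemToks))
  pointwise⇒fit i S p c lt =
    subst (λ c → sum (map (nth c) (map proj₁ (selectV S itemToks))) ≤ nth c (toList (lookup capacity i)))
          (toℕ-fromℕ< lt′)
          (≤-trans (≤-reflexive (sym (select-sizes S itemSize fingerprint (fromℕ< lt′))))
            (≤-trans (pointwise-lookup p (fromℕ< lt′)) (≤-reflexive (sym (nth-toList (lookup capacity i) (fromℕ< lt′))))))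
    where
    lt′ : c < d
    lt′ = subst (c <_) (length-toList (lookup capacity i)) lt

  N : ℕ
  N = sumFirst caps

  capacity≤N : ∀ i → ‖ lookup capacity i ‖₁ ≤ N
  capacity≤N i = ≤-trans (capacity-decreasing (fromℕ< m>0) i (≤-trans (≤-reflexive (toℕ-fromℕ< m>0)) z≤n))
    (≤-reflexive (sym sumFirst≡))

  column⁺ : ∀ i S {C} → C ∈ choices → C ↭ selectV S itemToks →
            Pointwise _≤_ (sumOver S itemSize) (lookup capacity i) →
            valid i (fingerprintsOf fingerprint S) ≡ true → kindTok (kindOf i) ∷ C ∈ columns
  column⁺ i S {C} C∈ p f v = let cᵢ = toList (lookup capacity i) in ∈-cols⁺ (∈-tabulate⁺ {f = kindOf} i) C∈
    (Fit⇒fits cᵢ (map proj₁ C) (Fit-↭ {cᵢ} (Perm.map⁺ proj₁ (↭-sym p)) (pointwise⇒fit i S f)))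
    (trans (cong (valid i) (trans (fpMultiset-↭ q p) (sym (fingerprints≡ S itemSize fingerprint)))) v)

  -- From a feasible partition to a multiset of columns

  module FromPartition (P : FeasiblePartition 𝓑) where
    open FeasiblePartition P renaming (fits to within)

    contents : ∀ i (j : Fin (lookup available i)) → List Tok
    contents i j = selectV (part i j) itemToks

    -- No token occurs more than N times among at most N items, so the contents are a sub-multiset
    -- of the kept items. Other items may stand in for the original ones, since only tokens matter.
    representative : ∀ i j → ∃[ C ] C ∈ choices × C ↭ contents i j
    representative i j = sub-multiset (keep codeTok N items) (contents i j) λ τ →
      subst (cnt τ (contents i j) ≤_) (sym (count-keep N τ items))
        (⊓-glb (≤-trans (cnt-select τ (part i j) itemToks) (≤-reflexive (cong (cnt τ) (sym items≡))))
               (≤-trans (count≤length codeTok τ (contents i j))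
                 (≤-trans (length-select (part i j) itemSize fingerprint itemSize≢0)
                   (≤-trans (norm-mono (within i j)) (capacity≤N i)))))

    rep : ∀ i → Fin (lookup available i) → List Tok
    rep i j = proj₁ (representative i j)

    bins : Fin m → List (List Tok)
    bins i = List.tabulate (rep i)

    bins-ok : ∀ i → All (λ C → kindTok (kindOf i) ∷ C ∈ columns) (bins i)
    bins-ok i = All.tabulate⁺ λ j → let C , C∈ , p = representative i j in
      column⁺ i (part i j) C∈ p (within i j) (isValid i j)

    K : Fin m → ℕ
    K i = suc (length items) ⊓ lookup available i

    -- The partition may have far more empty bins than the demand has slots. All of them are removed
    -- and just enough are put back to reach K i.
    padded : Fin m → List (List Tok)
    padded i = nonEmpty (bins i) ++ replicate (K i ∸ length (nonEmpty (bins i))) []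

    y : Fin m → List Col
    y i = map (kindTok (kindOf i) ∷_) (padded i)

    -- `covering` supplies the one nonvanishing index pair, and `disjoint` makes the terms of all
    -- other pairs vanish.
    δ-once : ∀ τ u → sumF (λ i → sumF (λ j → if lookup (part i j) u then δ τ (lookup itemToks u) else 0)) ≡
                     δ τ (lookup itemToks u)
    δ-once τ u with i₀ , j₀ , u∈ ← covering u = trans
      (sumF-single i₀ λ i n → sumF-0 λ j → other i j λ { refl → n refl })
      (trans (sumF-single j₀ λ j n → other i₀ j λ { refl → n refl })
             (cong (λ t → if t then δ τ (lookup itemToks u) else 0) ([]=⇒lookup u∈)))
      where
      other : ∀ i j → _≢_ {A = Σ (Fin m) λ i → Fin (lookup available i)} (i , j) (i₀ , j₀) →
              (if lookup (part i j) u then δ τ (lookup itemToks u) else 0) ≡ 0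
      other i j n with lookup (part i j) u in eq
      ... | false = refl
      ... | true  = ⊥-elim (n (disjoint (lookup⇒[]= u (part i j) eq) u∈))

    -- Double counting: the sums are exchanged until the items are outermost, where `δ-once`
    -- collapses the inner ones.
    cnt-bins : ∀ τ → cnt τ (concat (List.tabulate λ i → concat (bins i))) ≡ cnt τ items
    cnt-bins τ = begin
      cnt τ (concat (List.tabulate λ i → concat (bins i)))
        ≡⟨ cnt-tabulate τ (λ i → concat (bins i)) ⟩
      sumF (λ i → cnt τ (concat (bins i)))
        ≡⟨ sumF-cong (λ i → cnt-tabulate τ (rep i)) ⟩
      sumF (λ i → sumF (λ j → cnt τ (rep i j)))
        ≡⟨ sumF-cong (λ i → sumF-cong (λ j → trans (count-↭ τ (proj₂ (proj₂ (representative i j))))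
             (cnt-selectV τ (part i j) itemToks))) ⟩
      sumF (λ i → sumF (λ j → sumF (λ u → w i j u)))
        ≡⟨ sumF-cong (λ i → sumF-swap (w i)) ⟩
      sumF (λ i → sumF (λ u → sumF (λ j → w i j u)))
        ≡⟨ sumF-swap (λ i u → sumF (λ j → w i j u)) ⟩
      sumF (λ u → sumF (λ i → sumF (λ j → w i j u)))
        ≡⟨ sumF-cong (δ-once τ) ⟩
      sumF (λ u → δ τ (lookup itemToks u))
        ≡⟨ cnt-toList τ itemToks ⟨
      cnt τ (toList itemToks)
        ≡⟨ cong (cnt τ) items≡ ⟨
      cnt τ items ∎
      where
      open ≡-Reasoning
      w : ∀ i → Fin (lookup available i) → Fin n → ℕ
      w i j u = if lookup (part i j) u then δ τ (lookup itemToks u) else 0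

    nonEmpty≤K : ∀ i → length (nonEmpty (bins i)) ≤ K i
    nonEmpty≤K i = ⊓-glb
      (m≤n⇒m≤1+n (≤-trans (length-nonEmpty-concat (bins i))
        (≤-trans (length-concat-tabulate (λ i → concat (bins i)) i)
          (≤-reflexive (Perm.↭-length (counts⇒↭ (concat (List.tabulate λ i → concat (bins i))) items cnt-bins))))))
      (≤-trans (length-nonEmpty (bins i)) (≤-reflexive (length-tabulate (rep i))))

    length-padded : ∀ i → length (padded i) ≡ K i
    length-padded i = trans (length-++ (nonEmpty (bins i)))
      (trans (cong (length (nonEmpty (bins i)) +_) (length-replicate (K i ∸ length (nonEmpty (bins i)))))
             (m+[n∸m]≡n (nonEmpty≤K i)))

    padded-ok : ∀ i → All (λ C → kindTok (kindOf i) ∷ C ∈ columns) (padded i)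
    padded-ok i = All.++⁺ (nonEmpty-∈ (bins-ok i)) pad
      where
      pad : All (λ C → kindTok (kindOf i) ∷ C ∈ columns) (replicate (K i ∸ length (nonEmpty (bins i))) [])
      pad with K i ∸ length (nonEmpty (bins i)) in eq
      ... | zero  = []
      -- Padding occurs only if the nonempty bins number fewer than K i, hence fewer than the
      -- available bins. So the partition itself has an empty bin of this kind.
      ... | suc x = All.replicate⁺ (suc x) (nonEmpty-missing (bins-ok i)
        (≤-trans (m∸n≢0⇒n<m (λ e → nz (trans (sym eq) e)))
          (≤-trans (m⊓n≤n (suc (length items)) _) (≤-reflexive (sym (length-tabulate (rep i)))))))
        where
        nz : suc x ≢ 0
        nz ()

    solution : List Col
    solution = concat (List.tabulate y)

    solution∈ : All (_∈ columns) solution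
    solution∈ = All.concat⁺ (All.tabulate⁺ λ i → All.map⁺ (padded-ok i))

    solution≥1 : All (λ c → 1 ≤ length c) solution
    solution≥1 = All.concat⁺ (All.tabulate⁺ λ i → All.map⁺ (All.universal (λ _ → s≤s z≤n) (padded i)))

    cnt-y : ∀ τ i → cnt τ (concat (y i)) ≡ cnt τ (replicate (K i) (kindTok (kindOf i))) + cnt τ (concat (bins i))
    cnt-y τ i = trans (cnt-map-∷ τ (kindTok (kindOf i)) (padded i))
      (cong₂ _+_ (cong (λ k → cnt τ (replicate k (kindTok (kindOf i)))) (length-padded i))
        (cong (cnt τ) (trans (concat-replicate-[] _ (nonEmpty (bins i))) (concat-nonEmpty (bins i)))))

    cnt-solution : ∀ τ → cnt τ demand ≡ cnt τ (concat solution)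
    cnt-solution τ = begin
      cnt τ demand
        ≡⟨ count-++ τ items (slots (suc (length items)) kinds) ⟩
      cnt τ items + cnt τ (slots (suc (length items)) kinds)
        ≡⟨ cong₂ _+_ (trans (sym (cnt-bins τ)) (cnt-tabulate τ (λ i → concat (bins i)))) (slots-tabulate (suc (length items)) kindOf τ) ⟩
      sumF (λ i → cnt τ (concat (bins i))) + sumF (λ i → cnt τ (replicate (K i) (kindTok (kindOf i))))
        ≡⟨ +-comm (sumF (λ i → cnt τ (concat (bins i)))) _ ⟩
      sumF (λ i → cnt τ (replicate (K i) (kindTok (kindOf i)))) + sumF (λ i → cnt τ (concat (bins i)))
        ≡⟨ sumF-+ (λ i → cnt τ (replicate (K i) (kindTok (kindOf i)))) (λ i → cnt τ (concat (bins i))) ⟨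
      sumF (λ i → cnt τ (replicate (K i) (kindTok (kindOf i))) + cnt τ (concat (bins i)))
        ≡⟨ sumF-cong (cnt-y τ) ⟨
      sumF (λ i → cnt τ (concat (y i)))
        ≡⟨ cnt-cc y ⟩
      cnt τ (concat solution) ∎
      where
      open ≡-Reasoning
      cnt-cc : ∀ {m} (y : Fin m → List Col) → sumF (λ i → cnt τ (concat (y i))) ≡ cnt τ (concat (concat (List.tabulate y)))
      cnt-cc {zero}  y = refl
      cnt-cc {suc m} y = trans (cong (cnt τ (concat (y zero)) +_) (cnt-cc (λ i → y (suc i)))) (sym (cnt-concat-++ τ (y zero) _))

    solvable : sols ≢ []
    solvable = DPComplete.solve-complete demand toks columns solution∈ solution≥1 cnt-solution

  -- From a multiset of columns to a feasible partition

  module FromSolution {sol : List Col} (sol∈ : All (_∈ columns) sol) (counts : ∀ τ → cnt τ demand ≡ cnt τ (concat sol)) where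

    isItem : All (λ τ → proj₁ τ ≢ []) items
    isItem = subst (All _) (sym items≡) (go itemSize fingerprint d>0)
      where
      go : ∀ {n d} (ss : Vec (Vec ℕ d) n) (F : Vec (Fin q) n) → 0 < d →
           All (λ τ → proj₁ τ ≢ []) (toList (Vec.zipWith tok ss F))
      go []             []      p = []
      go ((x ∷ s) ∷ ss) (φ ∷ F) p = (λ ()) ∷ go ss F p

    wf : All WF sol
    wf = All.map col sol∈
      where
      col : ∀ {c} → c ∈ columns → WF c
      col {c} i = let open IsColumn (∈-cols⁻ choices kinds i) in
        idx k , C , c≡ , All.map (λ j → All.lookup isItem (All.lookup (keep-all codeTok N (All.tabulate id)) j)) (subs-∈ (keep codeTok N items) C∈)

    cnt-slots-item : ∀ τ M ks → proj₁ τ ≢ [] → cnt τ (slots M ks) ≡ 0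
    cnt-slots-item τ M []       n = refl
    cnt-slots-item τ M (k ∷ ks) n = trans (count-++ τ (replicate (M ⊓ av k) (kindTok k)) (slots M ks))
      (cong₂ _+_ (rep0 (M ⊓ av k)) (cnt-slots-item τ M ks n))
      where
      rep0 : ∀ x → cnt τ (replicate x (kindTok k)) ≡ 0
      rep0 zero    = refl
      rep0 (suc x) = trans (count-there (replicate x (kindTok k)) (λ e → n (cong proj₁ e))) (rep0 x)

    -- The slots contribute tokens of kinds only, so for an item token the demand counts the items
    -- alone. Tokens of kinds occur on neither side.
    keys≡ : ∀ τ → cnt τ items ≡ cnt τ (keys (supply sol))
    keys≡ ([] , a)    = trans (cnt-items isItem) (sym (cnt-items (keys-items sol wf)))
    keys≡ (x ∷ s , φ) = begin
      cnt τ items                                  ≡⟨ +-identityʳ _ ⟨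
      cnt τ items + 0                              ≡⟨ cong (cnt τ items +_) (cnt-slots-item τ _ kinds (λ ())) ⟨
      cnt τ items + cnt τ (slots _ kinds)          ≡⟨ count-++ τ items _ ⟨
      cnt τ demand                                 ≡⟨ counts τ ⟩
      cnt τ (concat sol)                           ≡⟨ cnt-keys τ sol wf (λ ()) ⟨
      cnt τ (keys (supply sol))                    ∎
      where
      open ≡-Reasoning
      τ = x ∷ s , φ

    cnt-rep : ∀ t k → cnt t (replicate k t) ≡ k
    cnt-rep t zero    = refl
    cnt-rep t (suc k) = trans (count-here t (replicate k t)) (cong suc (cnt-rep t k))

    cnt-rep-other : ∀ {t t′} k → t ≢ t′ → cnt t (replicate k t′) ≡ 0
    cnt-rep-other zero    n = refl
    cnt-rep-other {t′ = t′} (suc k) n = trans (count-there (replicate k t′) n) (cnt-rep-other k n)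

    binCount≡ : ∀ i → binCount (toℕ i) sol ≡ suc (length items) ⊓ lookup available i
    binCount≡ i = begin
      cnt ([] , toℕ i) (concat sol)             ≡⟨ counts ([] , toℕ i) ⟨
      cnt ([] , toℕ i) demand                   ≡⟨ count-++ ([] , toℕ i) items _ ⟩
      cnt ([] , toℕ i) items + cnt ([] , toℕ i) (slots (suc (length items)) kinds)
        ≡⟨ cong₂ _+_ (cnt-items isItem) (slots-tabulate (suc (length items)) kindOf ([] , toℕ i)) ⟩
      sumF (λ i′ → cnt ([] , toℕ i) (replicate (suc (length items) ⊓ lookup available i′) ([] , toℕ i′)))
        ≡⟨ sumF-single i (λ i′ n → cnt-rep-other {[] , toℕ i} {[] , toℕ i′} (suc (length items) ⊓ lookup available i′) (λ e → n (toℕ-injective (sym (cong proj₂ e))))) ⟩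
      cnt ([] , toℕ i) (replicate (suc (length items) ⊓ lookup available i) ([] , toℕ i)) ≡⟨ cnt-rep ([] , toℕ i) _ ⟩
      suc (length items) ⊓ lookup available i ∎
      where open ≡-Reasoning

    assignV : ∀ {n} → Vec Tok n → Supply → Vec Index n
    assignV []       s = []
    assignV (u ∷ us) s = look u s ∷ assignV us (remove u s)

    toList-assignV : ∀ {n} (us : Vec Tok n) s → toList (assignV us s) ≡ assign (toList us) s
    toList-assignV []       s = refl
    toList-assignV (u ∷ us) s = cong (look u s ∷_) (toList-assignV us (remove u s))

    asg : Vec Index n
    asg = assignV itemToks (supply sol)

    asg-↭ : zip (toList itemToks) (toList asg) ↭ supply sol
    asg-↭ = subst (λ is → zip (toList itemToks) is ↭ supply sol) (sym (toList-assignV itemToks (supply sol)))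
      (assign-↭ (toList itemToks) (supply sol) (λ τ → trans (cong (cnt τ) (sym items≡)) (keys≡ τ)))

    ∈-zip : ∀ {n} (us : Vec Tok n) (ws : Vec Index n) u → (lookup us u , lookup ws u) ∈ zip (toList us) (toList ws)
    ∈-zip (_ ∷ _)  (_ ∷ _)  zero    = here refl
    ∈-zip (_ ∷ us) (_ ∷ ws) (suc u) = there (∈-zip us ws u)

    asg∈ : ∀ u → (lookup itemToks u , lookup asg u) ∈ supply sol
    asg∈ u = Perm.∈-resp-↭ asg-↭ (∈-zip itemToks asg u)

    -- A positive count means that some column contains this kind token. As items have nonempty
    -- sizes, it is the head of that column, hence the token of a kind of the instance.
    kind-index : ∀ {a} → 0 < binCount a sol → ∃[ i ] toℕ i ≡ a
    kind-index {a} p = let c , t∈ , c∈ = ∈-concat⁻′ sol (count⇒∈ ([] , a) (concat sol) p) in col (All.lookup sol∈ c∈) (All.lookup wf c∈) t∈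
      where
      col : ∀ {c} → c ∈ columns → WF c → ([] , a) ∈ c → ∃[ i ] toℕ {m} i ≡ a
      col c∈ (b , C , refl , items) (there t∈)  = ⊥-elim (All.lookup items t∈ refl)
      col c∈ (b , C , refl , items) (here refl) with ∈-cols⁻ choices kinds c∈
      ... | isColumn k C′ k∈ _ refl _ _ with i , refl ← ∈-tabulate⁻ {f = kindOf} k∈ = i , refl

    place : ∀ u → Σ (Fin m) λ i → Σ (Fin (lookup available i)) λ j → lookup asg u ≡ (toℕ i , toℕ j)
    place u = go (lookup asg u) (asg∈ u)
      where
      go : ∀ v → (lookup itemToks u , v) ∈ supply sol →
           Σ (Fin m) λ i → Σ (Fin (lookup available i)) λ j → v ≡ (toℕ i , toℕ j)
      go (a , b) v∈ with b< ← supply-index sol wf v∈ with i , refl ← kind-index (≤-trans (s≤s z≤n) b<) =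
        i , fromℕ< b<k , cong (toℕ i ,_) (sym (toℕ-fromℕ< b<k))
        where
        b<k : b < lookup available i
        b<k = ≤-trans b< (≤-trans (≤-reflexive (binCount≡ i)) (m⊓n≤n (suc (length items)) _))

    parts : (i : Fin m) → Fin (lookup available i) → Subset n
    parts i j = Vec.map (λ w → w ≟ᵢ (toℕ i , toℕ j)) asg

    select-pickKeys : ∀ {n} Q (us : Vec Tok n) ws → selectV (Vec.map Q ws) us ≡ pickKeys Q (zip (toList us) (toList ws))
    select-pickKeys Q []       []       = refl
    select-pickKeys Q (u ∷ us) (w ∷ ws) with Q w
    ... | true  = cong (u ∷_) (select-pickKeys Q us ws)
    ... | false = select-pickKeys Q us ws

    ColOK : Fin m → List Tok → Set
    ColOK i C = fits (toList (lookup capacity i)) (map proj₁ C) ≡ true × valid i (fpMultiset q C) ≡ true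

    col-ok : ∀ i {C} → (([] , toℕ i) ∷ C) ∈ sol → ColOK i C
    col-ok i {C} c∈ with isColumn k C′ k∈ _ c≡ f g ← ∈-cols⁻ choices kinds (All.lookup sol∈ c∈)
      with i′ , refl ← ∈-tabulate⁻ {f = kindOf} k∈ | c≡
    ... | e with refl ← toℕ-injective (cong (λ { ((_ , a) ∷ _) → a ; [] → 0 }) e) | refl ← cong (drop 1) e = f , g

    -- A part with j below `binCount` is a column of the solution up to order. The remaining parts
    -- are empty, and their validity is inherited from an empty column.
    part-ok : ∀ i j → ∃[ C ] ColOK i C × C ↭ selectV (parts i j) itemToks
    part-ok i j with toℕ j <? binCount (toℕ i) sol
    ... | yes lt = let C , C∈ , e = proj₁ (bin-contents (toℕ i) (toℕ j) sol wf) lt in C , col-ok i C∈ , perm e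
      where
      perm : ∀ {C} → pickKeys (λ w → w ≟ᵢ (toℕ i , toℕ j)) (supply sol) ≡ C → C ↭ selectV (parts i j) itemToks
      perm refl = ↭-sym (↭-trans (↭-reflexive (select-pickKeys _ itemToks asg)) (pickKeys-↭ _ asg-↭))
    ... | no ≥ = [] , empty-ok (empty-bin (toℕ i) sol wf) , perm (proj₂ (bin-contents (toℕ i) (toℕ j) sol wf) (≮⇒≥ ≥))
      where
      perm : ∀ {C} → pickKeys (λ w → w ≟ᵢ (toℕ i , toℕ j)) (supply sol) ≡ C → C ↭ selectV (parts i j) itemToks
      perm refl = ↭-sym (↭-trans (↭-reflexive (select-pickKeys _ itemToks asg)) (pickKeys-↭ _ asg-↭))
      -- Here j is below the available count but not below `binCount`, so the minimum in `binCount≡`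
      -- is attained by n + 1.
      full : suc (length items) ≤ binCount (toℕ i) sol
      full with ≤-total (suc (length items)) (lookup available i)
      ... | inj₁ le = ≤-reflexive (sym (trans (binCount≡ i) (m≤n⇒m⊓n≡m le)))
      ... | inj₂ le = ⊥-elim (<⇒≱ (toℕ<n j) (≤-trans (≤-reflexive (sym (trans (binCount≡ i) (m≥n⇒m⊓n≡n le)))) (≮⇒≥ ≥)))
      empty-ok : (([] , toℕ i) ∷ []) ∈ sol ⊎ binCount (toℕ i) sol ≤ length (supply sol) → ColOK i []
      empty-ok (inj₁ c∈) = col-ok i c∈
      empty-ok (inj₂ le) = ⊥-elim (<⇒≱ full (≤-trans le (≤-reflexive (trans (sym (length-map proj₁ (supply sol)))
        (sym (Perm.↭-length (counts⇒↭ items (keys (supply sol)) keys≡)))))))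

    partition : FeasiblePartition 𝓑
    partition = record
      { part     = parts
      ; covering = λ u → let i , j , e = place u in i , j , lookup⇒[]= u (parts i j)
          (trans (lookup-map u _ asg) (trans (cong (_≟ᵢ (toℕ i , toℕ j)) e) (==-refl codeIndex (toℕ i , toℕ j))))
      ; disjoint = λ {u} {i} {j} {i′} {j′} p p′ → same (trans (sym (index i j p)) (index i′ j′ p′))
      ; fits     = λ i j → let C , (f , _) , p = part-ok i j in
          fit⇒pointwise i (parts i j)
            (Fit-↭ {toList (lookup capacity i)} (Perm.map⁺ proj₁ p) (fits⇒Fit (toList (lookup capacity i)) (map proj₁ C) f))
      ; isValid  = λ i j → let C , (_ , v) , p = part-ok i j in
          trans (cong (valid i) (trans (fingerprints≡ (parts i j) itemSize fingerprint) (sym (fpMultiset-↭ q p)))) v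
      }
      where
      index : ∀ {u} i j → u Subset.∈ parts i j → lookup asg u ≡ (toℕ i , toℕ j)
      index {u} i j p = ==-sound codeIndex _ _ (trans (sym (lookup-map u _ asg)) ([]=⇒lookup p))
      same : ∀ {i i′} {j : Fin (lookup available i)} {j′ : Fin (lookup available i′)} →
             (toℕ i , toℕ j) ≡ (toℕ i′ , toℕ j′) → _≡_ {A = Σ (Fin m) λ i → Fin (lookup available i)} (i , j) (i′ , j′)
      same e with refl ← toℕ-injective (cong proj₁ e) = cong (_ ,_) (toℕ-injective (cong proj₂ e))

    encPartition≡ : encPartition 𝓑 partition ≡ encL encIndex (assign items (supply sol))
    encPartition≡ = trans (go asg (λ u → u) (λ u → cong₂ cons (enc≡ (sym (cong proj₁ (proj₂ (proj₂ (place u))))))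
                                                              (enc≡ (sym (cong proj₂ (proj₂ (proj₂ (place u))))))))
      (trans (cong (encL encIndex) (toList-assignV itemToks (supply sol))) (cong (λ is → encL encIndex (assign is (supply sol))) (sym items≡)))
      where
      enc≡ : ∀ {a b} → a ≡ b → encℕ a ≡ encN b
      enc≡ refl = sym (encN≡encℕ _)
      go : ∀ {A : Set} {k} (w : Vec Index k) (f : Fin k → A) {e : A → Val} →
           (∀ u → e (f u) ≡ encIndex (lookup w u)) → encVec e (Vec.tabulate f) ≡ encL encIndex (toList w)
      go []      f p = refl
      go (x ∷ w) f p = cong₂ cons (p zero) (go w (λ u → f (suc u)) (λ u → p (suc u)))

-- Bounds on the sizes

∈⇒≤sum : ∀ {x xs} → x ∈ xs → x ≤ sum xs
∈⇒≤sum (here refl) = m≤m+n _ _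
∈⇒≤sum {xs = y ∷ _} (there i) = ≤-trans (∈⇒≤sum i) (m≤n+m _ y)

length≤size : ∀ {A : Set} (e : A → Val) xs → length xs ≤ size (encL e xs)
length≤size e []       = z≤n
length≤size e (x ∷ xs) = s≤s (≤-trans (length≤size e xs) (m≤n+m _ (size (e x))))

∈⇒size≤ : ∀ {A : Set} (e : A → Val) {x xs} → x ∈ xs → size (e x) ≤ size (encL e xs)
∈⇒size≤ e (here refl) = m≤n⇒m≤1+n (m≤m+n _ _)
∈⇒size≤ e {xs = y ∷ _} (there i) = ≤-trans (∈⇒size≤ e i) (m≤n⇒m≤1+n (m≤n+m _ (size (e y))))

encVec≡ : ∀ {A : Set} (e : A → Val) {n} (v : Vec A n) → encVec e v ≡ encL e (toList v)
encVec≡ e []      = refl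
encVec≡ e (x ∷ v) = cong (cons (e x)) (encVec≡ e v)

encL-cong : ∀ {A : Set} {e e′ : A → Val} → (∀ x → e x ≡ e′ x) → ∀ xs → encL e xs ≡ encL e′ xs
encL-cong p []       = refl
encL-cong p (x ∷ xs) = cong₂ cons (p x) (encL-cong p xs)

encL-map : ∀ {A B : Set} {e : A → Val} {e′ : B → Val} (g : A → B) → (∀ x → e x ≡ e′ (g x)) →
           ∀ xs → encL e xs ≡ encL e′ (map g xs)
encL-map g p []       = refl
encL-map g p (x ∷ xs) = cong₂ cons (p x) (encL-map g p xs)

encVecℕ≡ : ∀ {n} (v : Vec ℕ n) → encVec encℕ v ≡ encL encN (toList v)
encVecℕ≡ v = trans (encVec≡ encℕ v) (encL-cong (λ k → sym (encN≡encℕ k)) (toList v))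

norm-toList : ∀ {n} (v : Vec ℕ n) → All (_≤ ‖ v ‖₁) (toList v)
norm-toList []      = []
norm-toList (x ∷ v) = m≤m+n x _ ∷ All.map (λ p → ≤-trans p (m≤n+m _ x)) (norm-toList v)

-- Each token contributes to at most one coordinate. The running time of a predicate is stated in
-- terms of this norm.
norm-fpMultiset : ∀ q C → ‖ fpMultiset q C ‖₁ ≤ length C
norm-fpMultiset q C = ≤-trans (≤-reflexive (norm-tabulate {q} (λ φ → count codeℕ (toℕ φ) (map proj₂ C)))) (go C)
  where
  norm-tabulate : ∀ {n} (f : Fin n → ℕ) → ‖ Vec.tabulate f ‖₁ ≡ sumF f
  norm-tabulate {zero}  f = refl
  norm-tabulate {suc n} f = cong (f zero +_) (norm-tabulate (λ i → f (suc i)))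
  ind : ℕ → Fin q → ℕ
  ind x φ = if _==_ codeℕ (toℕ φ) x then 1 else 0
  ind-≢ : ∀ {x} φ → toℕ φ ≢ x → ind x φ ≡ 0
  ind-≢ {x} φ n with Counting.==-case codeℕ (toℕ φ) x
  ... | inj₁ (e , _) = ⊥-elim (n e)
  ... | inj₂ (_ , f) rewrite f = refl
  ind≤1 : ∀ x φ → ind x φ ≤ 1
  ind≤1 x φ with _==_ codeℕ (toℕ φ) x
  ... | true  = ≤-refl
  ... | false = z≤n
  sum-ind : ∀ x → sumF (ind x) ≤ 1
  sum-ind x with x <? q
  ... | yes x<q = ≤-trans (≤-reflexive (sumF-single (fromℕ< x<q)
                    (λ φ n → ind-≢ φ (λ e → n (toℕ-injective (trans e (sym (toℕ-fromℕ< x<q)))))))) (ind≤1 x (fromℕ< x<q))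
  ... | no x≮q  = ≤-trans (≤-reflexive (sumF-0 (λ φ → ind-≢ φ (λ e → x≮q (subst (_< q) e (toℕ<n φ)))))) z≤n
  count-ind : ∀ x xs φ → count codeℕ (toℕ φ) (x ∷ xs) ≡ ind x φ + count codeℕ (toℕ φ) xs
  count-ind x xs φ with _==_ codeℕ (toℕ φ) x
  ... | true  = refl
  ... | false = refl
  go : ∀ C → sumF {q} (λ φ → count codeℕ (toℕ φ) (map proj₂ C)) ≤ length C
  go []      = ≤-reflexive (sumF-0 {q} (λ _ → refl))
  go (τ ∷ C) = ≤-trans (≤-reflexive (trans (sumF-cong (count-ind (proj₂ τ) (map proj₂ C)))
                 (sumF-+ (ind (proj₂ τ)) (λ φ → count codeℕ (toℕ φ) (map proj₂ C)))))
               (+-mono-≤ (sum-ind (proj₂ τ)) (go C))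

toTok : List ℕ → Tok
toTok []      = [] , 0
toTok (φ ∷ s) = s , φ

-- All conceivable item tokens with entries below w; the fingerprint is the leading factor of the
-- product.
tokens : ℕ → ℕ → List Tok
tokens d w = map toTok (picks (upTo w ∷ replicate d (upTo w)))

length-tokens : ∀ d w → length (tokens d w) ≤ w ^ suc d
length-tokens d w = ≤-trans (≤-reflexive (length-map toTok (picks (upTo w ∷ replicate d (upTo w)))))
  (≤-trans (length-picks (upTo w ∷ replicate d (upTo w)) (All.replicate⁺ (suc d) (≤-reflexive (length-upTo w))))
    (≤-reflexive (cong (w ^_) (cong suc (length-replicate d)))))

∈-tokens : ∀ {d w q} (s : Vec ℕ d) (φ : Fin q) → All (_< w) (toList s) → q ≤ w → tok s φ ∈ tokens d w
∈-tokens {w = w} s φ p le = ∈-map⁺ toTok (∈-consEach (∈-upTo⁺ (≤-trans (toℕ<n φ) le)) (go s p))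
  where
  go : ∀ {d} (s : Vec ℕ d) → All (_< w) (toList s) → toList s ∈ picks (replicate d (upTo w))
  go []      []       = here refl
  go (x ∷ s) (p ∷ ps) = ∈-consEach (∈-upTo⁺ p) (go s ps)

length-slots : ∀ N ks → length (slots N ks) ≤ length ks * N
length-slots N []       = z≤n
length-slots N (k ∷ ks) = ≤-trans (≤-reflexive (trans (length-++ (replicate (N ⊓ av k) (kindTok k)))
    (cong (_+ length (slots N ks)) (length-replicate (N ⊓ av k)))))
  (+-mono-≤ (m⊓n≤m N (av k)) (length-slots N ks))

slots⊆ : ∀ N ks → All (_∈ map kindTok ks) (slots N ks)
slots⊆ N []       = []
slots⊆ N (k ∷ ks) = All.++⁺ (All.replicate⁺ (N ⊓ av k) (here refl)) (All.map there (slots⊆ N ks))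

keep∈ : ∀ {x xs} → x ∈ xs → x ∈ keep codeTok 1 xs
keep∈ {x} {xs} i = count⇒∈ x (keep codeTok 1 xs)
  (subst (1 ≤_) (sym (count-keep 1 x xs)) (⊓-glb (∈⇒count i) ≤-refl))

module Bounds (𝓑 : Instance) {T : ℕ → ℕ} (𝓥 : Evaluators 𝓑 T) where
  open Instance 𝓑
  open Evaluators 𝓥
  open Problem 𝓑 𝓥
  open Spec raw kinds
  open DP demand toks columns
  open Raw raw using (caps; avs; progs; sizes; fps)

  -- There are at most `suc K ^ suc K` item tokens, one entry for the fingerprint and d for the
  -- size, and at most K items of each are kept: this gives `P`, where the summand `K` makes it
  -- dominate the parameter too. `M` bounds the columns by kinds times sublists, and `W′` allows
  -- each column 1 + P tokens. `D` bounds n items and n + 1 slots per kind, and `Tk` the distinct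
  -- tokens of items and kinds.
  K S P M W′ D Tk : ℕ
  K  = parameter 𝓑
  S  = size (encRaw raw)
  P  = K + suc K ^ suc K * K
  M  = K * 2 ^ P
  W′ = M * suc P
  D  = S + K * suc S
  Tk = suc K ^ suc K + K

  -- Membership in this list yields each bound by `Z`. The less evident entries are the size of a
  -- kind token, `3 + 4 * K`, the number of states, `suc W′ ^ Tk`, the number of choices, `2 ^ M`,
  -- and the length of a solution, `2 * suc D * M`.
  terms : List ℕ
  terms = K ∷ S ∷ P ∷ (3 + 4 * K) ∷ 2 * suc D ∷ Tk ∷ suc W′ ^ Tk ∷ 2 ^ M ∷ M ∷ suc P ∷ 2 * suc D * M ∷ []

  Z : ℕ
  Z = sum terms

  q≤K : q ≤ K
  q≤K = ≤-trans (m≤m+n q d) (≤-trans (m≤m+n _ m) (m≤m+n _ ‖ B₁ ‖₁))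

  d≤K : d ≤ K
  d≤K = ≤-trans (m≤n+m d q) (≤-trans (m≤m+n _ m) (m≤m+n _ ‖ B₁ ‖₁))

  m≤K : m ≤ K
  m≤K = ≤-trans (m≤n+m m (q + d)) (m≤m+n _ ‖ B₁ ‖₁)

  N≤K : N ≤ K
  N≤K = ≤-trans (≤-reflexive sumFirst≡) (m≤n+m ‖ B₁ ‖₁ (q + d + m))

  K≤P : K ≤ P
  K≤P = m≤m+n K _

  length-kinds : length kinds ≡ m
  length-kinds = length-tabulate kindOf

  sizes≤N : All (λ τ → All (_≤ N) (proj₁ τ)) items
  sizes≤N = subst (All _) (sym items≡) (go itemSize fingerprint λ u →
      ≤-trans (itemSize≤B₁ u) (≤-reflexive (sym sumFirst≡)))
    where
    go : ∀ {n} (ss : Vec (Vec ℕ d) n) (F : Vec (Fin q) n) → (∀ u → ‖ lookup ss u ‖₁ ≤ N) →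
         All (λ τ → All (_≤ N) (proj₁ τ)) (toList (Vec.zipWith tok ss F))
    go []       []      p = []
    go (s ∷ ss) (φ ∷ F) p = All.map (λ le → ≤-trans le (p zero)) (norm-toList s) ∷ go ss F (λ u → p (suc u))

  items∈tokens : All (_∈ tokens d (suc K)) items
  items∈tokens = subst (All _) (sym items≡)
    (go itemSize fingerprint (subst (All (λ τ → All (_≤ N) (proj₁ τ))) items≡ sizes≤N))
    where
    go : ∀ {n} (ss : Vec (Vec ℕ d) n) (F : Vec (Fin q) n) →
         All (λ τ → All (_≤ N) (proj₁ τ)) (toList (Vec.zipWith tok ss F)) →
         All (_∈ tokens d (suc K)) (toList (Vec.zipWith tok ss F))
    go []       []      _        = []
    go (s ∷ ss) (φ ∷ F) (p ∷ ps) =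
      ∈-tokens s φ (All.map (λ le → s≤s (≤-trans le N≤K)) p) (m≤n⇒m≤1+n q≤K) ∷ go ss F ps

  tokens≤ : length (tokens d (suc K)) ≤ suc K ^ suc K
  tokens≤ = ≤-trans (length-tokens d (suc K)) (^-monoʳ-≤ (suc K) (s≤s d≤K))

  kept : List Tok
  kept = keep codeTok N items

  kept≤P : length kept ≤ P
  kept≤P = ≤-trans (Counting.pigeonhole codeTok N (tokens d (suc K)) kept (keep-all codeTok N items∈tokens)
      (λ τ → ≤-trans (≤-reflexive (count-keep N τ items)) (m⊓n≤n _ N)))
    (≤-trans (*-mono-≤ tokens≤ N≤K) (m≤n+m _ K))

  choices-ok : All (λ C → SizesBelow P (map proj₁ C)) choices
  choices-ok = All.tabulate λ {C} i →
    ≤-trans (≤-reflexive (length-map proj₁ C)) (≤-trans (All.lookup (subs-length kept) i) kept≤P) ,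
    All.map⁺ (All.map (λ j → All.map (λ le → ≤-trans le (≤-trans N≤K K≤P)) (All.lookup (keep-all codeTok N sizes≤N) j)) (subs-∈ kept i))

  kind-ok : ∀ i → KindOK q P (T n) choices (kindOf i)
  kind-ok i = record
    { cap-length = ≤-trans (≤-reflexive (length-toList (lookup capacity i))) (≤-trans d≤K K≤P)
    ; cap≤       = All.map (λ le → ≤-trans le (≤-trans (capacity≤N i) (≤-trans N≤K K≤P))) (norm-toList (lookup capacity i))
    ; call       = All.tabulate λ {C} j →
        -- A sublist of the items has at most n elements, so the call is charged `T n`.
        let t , e , le = correct i (fpMultiset q C) n (≤-trans (norm-fpMultiset q C)
              (≤-trans (All.lookup (subs-length kept) j) (≤-trans (keep-length codeTok N items) (≤-reflexive length-items))))
        in t , subst (λ v → lookup program i · v ⇓ encBool (valid i (fpMultiset q C)) [ t ])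
                 (trans (encVecℕ≡ (fpMultiset q C)) (cong (encL encN) (toList-fpMultiset q C))) e , le
    }

  col-length : All (λ c → length c ≤ suc P) columns
  col-length = All.tabulate λ i → go (∈-cols⁻ choices kinds i)
    where
    go : ∀ {c} → IsColumn choices kinds c → length c ≤ suc P
    go (isColumn k C _ C∈ refl _ _) = s≤s (≤-trans (All.lookup (subs-length kept) C∈) kept≤P)

  columns≤M : length columns ≤ M
  columns≤M = ≤-trans (cols-length choices kinds)
    (*-mono-≤ (≤-trans (≤-reflexive length-kinds) m≤K) (≤-trans (≤-reflexive (length-subs kept)) (^-monoʳ-≤ 2 kept≤P)))

  W≤W′ : W ≤ W′
  W≤W′ = ≤-trans (length-concat≤ col-length) (*-monoˡ-≤ (suc P) columns≤M)

  all-toks : List Tok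
  all-toks = items ++ map kindTok kinds

  toks≤Tk : length toks ≤ Tk
  toks≤Tk = ≤-trans (Counting.pigeonhole codeTok 1 (tokens d (suc K) ++ map kindTok kinds) toks
      (keep-all codeTok 1 (All.++⁺ (All.map ∈-++⁺ˡ items∈tokens) (All.tabulate (∈-++⁺ʳ (tokens d (suc K))))))
      (λ τ → ≤-trans (≤-reflexive (count-keep 1 τ all-toks)) (m⊓n≤n _ 1)))
    (≤-trans (≤-reflexive (*-identityʳ _)) (≤-trans (≤-reflexive (length-++ (tokens d (suc K))))
      (+-mono-≤ tokens≤ (≤-trans (≤-reflexive (trans (length-map kindTok kinds) length-kinds)) m≤K))))

  column⊆ : ∀ {c} → c ∈ columns → All (_∈ all-toks) c
  column⊆ i = go (∈-cols⁻ choices kinds i)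
    where
    go : ∀ {c} → IsColumn choices kinds c → All (_∈ all-toks) c
    go (isColumn k C k∈ C∈ refl _ _) = ∈-++⁺ʳ items (∈-map⁺ kindTok k∈) ∷
      All.map (λ j → ∈-++⁺ˡ {xs = items} (All.lookup (keep-all codeTok N {items} (All.tabulate id)) j)) (subs-∈ kept C∈)

  demand⊆toks : ∀ {τ} → τ ∈ demand → τ ∈ toks
  demand⊆toks i = keep∈ {xs = all-toks} (All.lookup (All.++⁺ (All.tabulate ∈-++⁺ˡ) (All.map (∈-++⁺ʳ items) (slots⊆ (suc (length items)) kinds))) i)

  columns⊆toks : ∀ {τ} → τ ∈ concat columns → τ ∈ toks
  columns⊆toks i = let c , j , c∈ = ∈-concat⁻′ columns i in keep∈ {xs = all-toks} (All.lookup (column⊆ c∈) j)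

  sound : ∀ {sol rest} → sols ≡ sol ∷ rest →
          All (_∈ columns) sol × length sol ≤ 2 ^ suc (length (digits (length demand))) * length columns ×
          (∀ τ → cnt τ demand ≡ cnt τ (concat sol))
  sound = DPComplete.solve-sound demand toks columns demand⊆toks columns⊆toks

  open ≤-Reasoning

  size-head : ∀ a b → size a ≤ size (Val.cons a b)
  size-head a b = m≤n⇒m≤1+n (m≤m+n _ _)

  size-tail : ∀ a b → size b ≤ size (Val.cons a b)
  size-tail a b = m≤n⇒m≤1+n (m≤n+m _ (size a))

  tail₁ tail₂ tail₃ tail₄ : Val
  tail₄ = cons (encL (encL encN) sizes) (encL encN fps)
  tail₃ = cons (encL id progs) tail₄
  tail₂ = cons (encL encN avs) tail₃
  tail₁ = cons (encL (encL encN) caps) tail₂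

  tail₂≤S : size tail₂ ≤ S
  tail₂≤S = ≤-trans (size-tail (encL (encL encN) caps) tail₂) (size-tail (encN q) tail₁)

  tail₄≤S : size tail₄ ≤ S
  tail₄≤S = ≤-trans (size-tail (encL id progs) tail₄) (≤-trans (size-tail (encL encN avs) tail₃) tail₂≤S)

  n≤S : n ≤ S
  n≤S = ≤-trans (≤-reflexive (sym (trans (length-map toList (toList itemSize)) (length-toList itemSize))))
    (≤-trans (length≤size (encL encN) sizes)
      (≤-trans (size-head (encL (encL encN) sizes) (encL encN fps)) tail₄≤S))

  avs≤S : size (encL encN avs) ≤ S
  avs≤S = ≤-trans (size-head (encL encN avs) tail₃) tail₂≤S

  items-size : All (λ τ → size (encTok τ) ≤ S) items
  items-size = All.map (λ p → ≤-trans p tail₄≤S) (All.tabulate λ i → let a , b = zip∈ sizes fps i in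
      s≤s (+-mono-≤ (∈⇒size≤ (encL encN) a) (∈⇒size≤ encN b)))
    where
    zip∈ : ∀ (xs : List (List ℕ)) (ys : List ℕ) {x y} → (x , y) ∈ zip xs ys → x ∈ xs × y ∈ ys
    zip∈ (x ∷ xs) (y ∷ ys) (here refl) = here refl , here refl
    zip∈ (x ∷ xs) (y ∷ ys) (there i)   = let a , b = zip∈ xs ys i in there a , there b

  Z≥ : ∀ {x} → x ∈ terms → x ≤ Z
  Z≥ = ∈⇒≤sum

  K≤Z : K ≤ Z
  K≤Z = Z≥ (here refl)

  S≤Z : S ≤ Z
  S≤Z = Z≥ (there (here refl))

  D≤Z : 2 * suc D ≤ Z
  D≤Z = Z≥ (there (there (there (there (here refl)))))

  Tk≤Z : Tk ≤ Z
  Tk≤Z = Z≥ (there (there (there (there (there (here refl))))))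

  M≤Z : M ≤ Z
  M≤Z = Z≥ (there (there (there (there (there (there (there (there (here refl)))))))))

  sucP≤Z : suc P ≤ Z
  sucP≤Z = Z≥ (there (there (there (there (there (there (there (there (there (here refl))))))))))

  demand≤D : length demand ≤ D
  demand≤D = ≤-trans (≤-reflexive (length-++ items)) (+-mono-≤ i≤S
    (≤-trans (length-slots (suc (length items)) kinds)
      (*-mono-≤ (≤-trans (≤-reflexive length-kinds) m≤K) (s≤s i≤S))))
    where
    i≤S : length items ≤ S
    i≤S = ≤-trans (≤-reflexive length-items) n≤S

  kinds-tok : All (TokOK Z) (map kindTok kinds)
  kinds-tok = All.map⁺ (All.tabulate⁺ λ i → ≤-trans
    (+-monoʳ-≤ 2 (≤-trans (size-encN (toℕ i)) (s≤s (*-monoʳ-≤ 4 (≤-trans (<⇒≤ (toℕ<n i)) m≤K)))))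
    (Z≥ (there (there (there (here refl))))))

  all-toks-ok : All (TokOK Z) all-toks
  all-toks-ok = All.++⁺ (All.map (λ p → ≤-trans p S≤Z) items-size) kinds-tok

  states-ok : ∀ k → StatesOK Z (loop Es S₀ k)
  states-ok k =
    ≤-trans (length-loop k) (≤-trans (^-mono (s≤s W≤W′) toks≤Tk) (Z≥ (there (there (there (there (there (there (here refl)))))))) ) ,
    All.map res-ok (LevelInv.states (loop-inv k))
    where
    ^-mono : ∀ {a b c d} → suc a ≤ suc b → c ≤ d → suc a ^ c ≤ suc b ^ d
    ^-mono {b = b} {c} p q = ≤-trans (^-monoˡ-≤ c p) (^-monoʳ-≤ (suc b) q)
    res-ok : ∀ {s} → StateInv k s → ResOK Z (proj₁ s)
    res-ok {s} inv rewrite StateInv.res≡ inv =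
      ≤-trans (≤-reflexive (length-map _ toks)) (≤-trans toks≤Tk Tk≤Z) ,
      All.map⁺ (All.tabulate λ {τ} i → All.lookup (keep-all codeTok 1 all-toks-ok) i , (begin
        f τ                                     ≤⟨ m≤n*m (f τ) (2 ^ k) {{m^n≢0 2 k}} ⟩
        2 ^ k * f τ                             ≤⟨ m≤m+n _ _ ⟩
        2 ^ k * f τ + cnt τ (concat (proj₂ s))  ≡⟨ total i ⟨
        cnt τ demand                            ≤⟨ count≤length codeTok τ demand ⟩
        length demand                           ≤⟨ demand≤D ⟩
        D                                       ≤⟨ ≤-trans (n≤1+n D) (m≤m+n _ _) ⟩
        2 * suc D                               ≤⟨ D≤Z ⟩
        Z                                       ∎))
      where open StateInv inv

  bounded : Bounded P Z (T n) raw kinds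
  bounded = record
    { kinds≡     = kinds≡
    ; q≤         = ≤-trans q≤K K≤P
    ; ks≤        = ≤-trans (≤-reflexive length-kinds) (≤-trans m≤K K≤P)
    ; caps≤      = ≤-trans (≤-reflexive (trans (length-map toList (toList capacity)) (length-toList capacity))) (≤-trans m≤K K≤P)
    ; caps-ok    = All.map⁺ (caps-ok capacity capacity≤N)
    ; sumFirst≤  = ≤-trans N≤K K≤P
    ; kept≤      = kept≤P
    ; choices-ok = choices-ok
    ; kinds-ok   = All.tabulate⁺ kind-ok
    ; avs≤       = ≤-trans (≤-reflexive (length-toList available)) (≤-trans m≤K K≤Z)
    ; progs≤     = ≤-trans (≤-reflexive (length-toList program)) (≤-trans m≤K K≤Z)
    ; sizes≤     = ≤-trans (≤-reflexive (trans (length-map toList (toList itemSize)) (length-toList itemSize))) (≤-trans n≤S S≤Z)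
    ; items≤     = ≤-trans (≤-reflexive length-items) (≤-trans n≤S S≤Z)
    ; items-ok   = All.map (λ p → ≤-trans p S≤Z) items-size
    ; kinds-tok  = kinds-tok
    ; av-digits  = All.tabulate⁺ λ i → ≤-trans (digits≤ (lookup available i))
        (≤-trans (∈⇒size≤ encN (lookup∈ available i)) (≤-trans avs≤S S≤Z))
    ; demand≤    = ≤-trans (*-monoʳ-≤ 2 (s≤s demand≤D)) D≤Z
    ; states-ok  = states-ok
    ; subs-ok    = ≤-trans (≤-reflexive (length-subs columns)) (≤-trans (^-monoʳ-≤ 2 columns≤M)
                     (Z≥ (there (there (there (there (there (there (there (here refl)))))))))) ,
                   All.tabulate (λ i → ≤-trans (All.lookup (subs-length columns) i) (≤-trans columns≤M M≤Z) ,
                     All.map (λ j → ≤-trans (All.lookup col-length j) sucP≤Z) (subs-∈ columns i))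
    ; sol-ok     = λ {sol} e → let sol∈ , len , _ = sound e in
        (begin
          length sol                                            ≤⟨ len ⟩
          2 ^ suc (length (digits (length demand))) * length columns
            ≤⟨ *-mono-≤ (*-monoʳ-≤ 2 (≤-trans (2^digits (length demand)) (s≤s demand≤D))) columns≤M ⟩
          2 * suc D * M
            ≤⟨ Z≥ (there (there (there (there (there (there (there (there (there (there (here refl))))))))))) ⟩
          Z ∎) ,
        All.map (λ i → ≤-trans (All.lookup col-length i) sucP≤Z , All.map (All.lookup all-toks-ok) (column⊆ i)) sol∈
    }
    where
    digits≤ : ∀ k → length (digits k) ≤ size (encN k)
    digits≤ k = ≤-trans (length≤size encBool (digits k)) (≤-reflexive (cong size (sym (encN-digits k))))
    lookup∈ : ∀ {A : Set} {n} (v : Vec A n) i → lookup v i ∈ toList v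
    lookup∈ (x ∷ v) zero    = here refl
    lookup∈ (x ∷ v) (suc i) = there (lookup∈ v i)
    caps-ok : ∀ {m} (v : Vec (Vec ℕ d) m) → (∀ i → ‖ lookup v i ‖₁ ≤ N) →
              All (λ c → length (toList c) ≤ P × All (_≤ P) (toList c)) (toList v)
    caps-ok []      p = []
    caps-ok (c ∷ v) p = (≤-trans (≤-reflexive (length-toList c)) (≤-trans d≤K K≤P) ,
      All.map (λ le → ≤-trans le (≤-trans (p zero) (≤-trans N≤K K≤P))) (norm-toList c)) ∷ caps-ok v (λ i → p (suc i))
    kinds≡ : map rawKind kinds ≡ rawKinds raw
    kinds≡ = trans (go capacity available program id)
      (cong (λ l → zip caps (zip avs (zip progs (upTo l)))) (sym (trans (length-map toList (toList capacity)) (length-toList capacity))))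
      where
      go : ∀ {m} (cs : Vec (Vec ℕ d) m) (as : Vec ℕ m) (ps : Vec Val m) (g : ℕ → ℕ) {okay : Fin m → List Tok → Bool} →
           map rawKind (List.tabulate λ i → kind (toList (lookup cs i)) (lookup as i) (lookup ps i) (g (toℕ i)) (okay i)) ≡
           zip (map toList (toList cs)) (zip (toList as) (zip (toList ps) (applyUpTo g m)))
      go []       []       []       g = refl
      go (c ∷ cs) (a ∷ as) (p ∷ ps) g {okay} = cong (_ ∷_) (go cs as ps (λ i → g (suc i)) {λ i → okay (suc i)})

  encInstance≡ : encRaw raw ≡ encInstance 𝓑 program
  encInstance≡ = sym (cong₂ cons (sym (encN≡encℕ q)) (cong₂ cons (vecs capacity) (cong₂ cons (encVecℕ≡ available)
    (cong₂ cons (encVec≡ id program) (cong₂ cons (vecs itemSize)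
      (trans (encVec≡ encFin fingerprint) (encL-map toℕ (λ φ → sym (encN≡encℕ (toℕ φ))) (toList fingerprint))))))))
    where
    vecs : ∀ {a b} (v : Vec (Vec ℕ a) b) → encVec (encVec encℕ) v ≡ encL (encL encN) (map toList (toList v))
    vecs v = trans (encVec≡ (encVec encℕ) v) (encL-map toList encVecℕ≡ (toList v))

  correctAnswer : CorrectAnswer 𝓑 (answer sols)
  correctAnswer with sols in eq
  ... | []        = none λ p → FromPartition.solvable p eq
  ... | sol ∷ _ = let sol∈ , _ , counts = sound eq in
    subst (λ v → CorrectAnswer 𝓑 (cons v nil)) (FromSolution.encPartition≡ sol∈ counts)
      (found (FromSolution.partition sol∈ counts))

-- The final uniform bound

-- T and the evaluators belong to the input, so the height and the exponent extracted from the bound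
-- do not depend on them.
record Input : Set where
  constructor input
  field
    𝓑 : Instance
    T : ℕ → ℕ
    𝓥 : Evaluators 𝓑 T

module _ where
  open Input

  scaleOf : Input → Scale
  scaleOf ι = scale (parameter (𝓑 ι)) (pred (Bounds.S (𝓑 ι) (𝓥 ι)))

  opaque

    -- Opaque, so that the concrete height and exponent are not unfolded where the bound is used.
    main-runs : Runs scaleOf (λ ι → T ι (Instance.n (𝓑 ι))) (λ ι → encRaw (Problem.raw (𝓑 ι) (𝓥 ι)) ∷ []) mainT
                     (λ ι → let open Problem (𝓑 ι) (𝓥 ι) in Spec.answer raw kinds (Spec.sols raw kinds))
    main-runs = mainR fP fZ (λ ι → Bounds.bounded (𝓑 ι) (𝓥 ι))
      where
      module B ι = Bounds (𝓑 ι) (𝓥 ι)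
      fK : Par scaleOf B.K
      fK = par-par
      fKK : Par scaleOf (λ ι → suc (B.K ι) ^ suc (B.K ι))
      fKK = par-^ (par-suc fK) (par-suc fK)
      fP : Par scaleOf B.P
      fP = par-+ fK (par-* fKK fK)
      fM : Par scaleOf B.M
      fM = par-* fK (par-2^ fP)
      fTk : Par scaleOf B.Tk
      fTk = par-+ fKK fK
      fS : FPT scaleOf B.S
      -- The code of an instance is a `cons`, so its size is definitionally the successor of its
      -- predecessor.
      fS = fpt-sz
      fD : FPT scaleOf (λ ι → 2 * suc (B.D ι))
      fD = fpt-* (lin-const 2) (lin-suc (lin-+ fS (fpt-* (par→lin fK) (lin-suc fS))))
      fZ : FPT scaleOf B.Z
      fZ = lin-+ (par→lin fK) (lin-+ fS (lin-+ (par→lin fP) (lin-+ (lin-+ (lin-const 3) (par→lin (par-* (par-const 4) fK)))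
        (lin-+ fD (lin-+ (par→lin fTk) (lin-+ (par→lin (par-^ (par-suc (par-* fM (par-suc fP))) fTk))
        (lin-+ (par→lin (par-2^ fM)) (lin-+ (par→lin fM) (lin-+ (par→lin (par-suc fP))
        (lin-+ (fpt-* fD (par→lin fM)) (lin-const 0)))))))))))

theorem4p19 : Σ (ℕ → ℕ) λ f → Computable f ×
    (Σ (Term 1) λ algorithm → Σ ℕ λ c →
    (𝓑 : Instance) (T : ℕ → ℕ) (𝓥 : Evaluators 𝓑 T) →
    let x = encInstance 𝓑 (Evaluators.program 𝓥) in
    ∃[ answer ] ∃[ t ]
    ((x ∷ []) ⊢ algorithm ⇓ answer [ t ])
    × CorrectAnswer 𝓑 answer
    × t ≤ f (parameter 𝓑) * (T (Instance.n 𝓑) + size x ^ c))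
theorem4p19 = tow h , tow-computable h , mainT , c , λ 𝓑 T 𝓥 →
  let open Bounds 𝓑 𝓥
      open Problem 𝓑 𝓥
      ι = input 𝓑 T 𝓥
      output = Spec.answer raw kinds (Spec.sols raw kinds)
  in
  output , time ι ,
  subst (λ x → (x ∷ []) ⊢ mainT ⇓ output [ time ι ]) encInstance≡ (eval ι) ,
  correctAnswer ,
  subst (λ x → time ι ≤ tow h (parameter 𝓑) * (T (Instance.n 𝓑) + size x ^ c)) encInstance≡ (≤bound ι)
  where
  open Runs main-runs
  open Lin cost
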